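{- The number $\frac{6}{121}\left(5\sqrt5-2\right)$ ($=0.4552\dots$) is a non-jump for $3$-graphs (i.e. it is not a jump for $3$-graphs).
   Context: For a set $S$, $S^{(r)}$ denotes the set of all $r$-element subsets of $S$. An $r$-graph ($r$-uniform hypergraph) is a pair $G=(V(G),E(G))$ with $V(G)$ finite and $E(G)\subseteq V(G)^{(r)}$. Its order is $|V(G)|$, and its density is $D(G)=|E(G)|/|V(G)^{(r)}|$. A number $\alpha\in[0,1)$ is a jump for $r$-graphs if there is $\delta=\delta(\alpha)>0$ such that for each $\varepsilon>0$ and each integer $n\geq r$, any sufficiently large $r$-graph (i.e. of order at least some $N=N(\varepsilon,n)$) of density at least $\alpha+\varepsilon$ has a subgraph of order $n$ and density at least $\alpha+\delta$. Otherwise $\alpha\in[0,1)$ is a non-jump for $r$-graphs. -}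

module Defs where

open import Data.Bool using (Bool; T)
open import Data.Bool.Properties using (T?)
open import Data.Fin.Subset using (Subset; inside; outside; _⊆_; ∣_∣) renaming (⊥ to ∅)
open import Data.Fin.Subset.Properties using (_⊆?_; out⊆; s⊆s; ∣⊥∣≡0; ⊥⊆)
open import Data.Integer using (-[1+_])
import Data.Integer as ℤ
import Data.Integer.Properties as ℤₚ
open import Data.List using (List; []; _∷_; _++_; map; filter; length)
open import Data.List.Membership.Propositional using (_∈_)
open import Data.List.Membership.Propositional.Properties using (∈-map⁺; ∈-++⁺ˡ; ∈-++⁺ʳ; ∈-filter⁺)
open import Data.List.Relation.Unary.Any using (here; there)
open import Data.Nat using (ℕ; zero; suc; z≤n; s≤s)
import Data.Nat as ℕ
open import Data.Product using (Σ-syntax; ∃-syntax; _×_; _,_)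
open import Data.Rational hiding (∣_∣)
open import Data.Rational.Properties
open import Data.Rational.Solver using (module +-*-Solver)
import Data.Rational.Unnormalised as ℚᵘ
import Data.Rational.Unnormalised.Properties as ℚᵘₚ
open import Data.Sum using (_⊎_; inj₁; inj₂; swap)
import Data.Sum as Sum
open import Data.Vec using ([]; _∷_)
open import Function using (_∘_)
open import Relation.Binary.Definitions using (tri<; tri≈; tri>)
open import Relation.Binary.PropositionalEquality
open import Relation.Nullary using (¬_; yes; no; contradiction)
open import Relation.Nullary.Decidable using (_×-dec_)

-- Real numbers as two-sided (located) Dedekind cuts of ℚ.
-- L q means q < x, and U q means x < q.

record ℝ : Set₁ where
  field
    L U         : ℚ → Set
    L-inhabited : ∃[ q ] L q
    U-inhabited : ∃[ q ] U q
    L-lower     : ∀ {p q} → p < q → L q → L p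
    U-upper     : ∀ {p q} → p < q → U p → U q
    L-open      : ∀ {p} → L p → ∃[ q ] (p < q × L q)
    U-open      : ∀ {q} → U q → ∃[ p ] (p < q × U p)
    disjoint    : ∀ {q} → L q → ¬ U q
    located     : ∀ {p q} → p < q → L p ⊎ U q

  L<U : ∀ {p q} → L p → U q → p < q
  L<U {p} {q} Lp Uq with <-cmp p q
  ... | tri< p<q _ _    = p<q
  ... | tri≈ _ refl _   = contradiction Uq (disjoint Lp)
  ... | tri> _ _ q<p    = contradiction (U-upper q<p Uq) (disjoint Lp)

open ℝ

infix 4 _≤ᴿ_ _<ᴿ_

_≤ᴿ_ : ℝ → ℝ → Set
x ≤ᴿ y = ∀ q → L x q → L y q

_<ᴿ_ : ℝ → ℝ → Set
x <ᴿ y = ∃[ q ] (U x q × L y q)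

private
  ≤⇒≯ : ∀ {p q} → p ≤ q → ¬ q < p
  ≤⇒≯ p≤q q<p = <-irrefl refl (≤-<-trans p≤q q<p)

  q-1<q : ∀ q → q - 1ℚ < q
  q-1<q q = subst (q - 1ℚ <_) (+-identityʳ q) (+-monoʳ-< q (negative⁻¹ (- 1ℚ)))

  q<q+1 : ∀ q → q < q + 1ℚ
  q<q+1 q = subst (_< q + 1ℚ) (+-identityʳ q) (+-monoʳ-< q (positive⁻¹ 1ℚ))

fromℚ : ℚ → ℝ
fromℚ x = record
  { L           = _< x
  ; U           = x <_
  ; L-inhabited = x - 1ℚ , q-1<q x
  ; U-inhabited = x + 1ℚ , q<q+1 x
  ; L-lower     = <-trans
  ; U-upper     = λ p<q x<p → <-trans x<p p<q
  ; L-open      = λ p<x → let m , p<m , m<x = <-dense p<x in m , p<m , m<x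
  ; U-open      = λ x<q → let m , x<m , m<q = <-dense x<q in m , m<q , x<m
  ; disjoint    = <-asym
  ; located     = loc
  }
  where
  loc : ∀ {p q} → p < q → p < x ⊎ x < q
  loc {p} p<q with p <? x
  ... | yes p<x = inj₁ p<x
  ... | no  p≮x = inj₂ (≤-<-trans (≮⇒≥ p≮x) p<q)

0ᴿ 1ᴿ : ℝ
0ᴿ = fromℚ 0ℚ
1ᴿ = fromℚ 1ℚ

infix 8 -ᴿ_

-ᴿ_ : ℝ → ℝ
-ᴿ x = record
  { L           = λ q → U x (- q)
  ; U           = λ q → L x (- q)
  ; L-inhabited = let q , Uq = U-inhabited x in - q , subst (U x) (sym (neg² q)) Uq
  ; U-inhabited = let q , Lq = L-inhabited x in - q , subst (L x) (sym (neg² q)) Lq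
  ; L-lower     = λ p<q → U-upper x (neg-antimono-< p<q)
  ; U-upper     = λ p<q → L-lower x (neg-antimono-< p<q)
  ; L-open      = λ {p} Up → let q , q<-p , Uq = U-open x Up in
                  - q , subst (_< - q) (neg² p) (neg-antimono-< q<-p)
                      , subst (U x) (sym (neg² q)) Uq
  ; U-open      = λ {p} Lp → let q , -p<q , Lq = L-open x Lp in
                  - q , subst (- q <_) (neg² p) (neg-antimono-< -p<q)
                      , subst (L x) (sym (neg² q)) Lq
  ; disjoint    = λ Uq Lq → disjoint x Lq Uq
  ; located     = λ p<q → swap (located x (neg-antimono-< p<q))
  }
  where
  neg² : ∀ q → - (- q) ≡ q
  neg² = solve 1 (λ q → :- (:- q) := q) refl where open +-*-Solver

private
  natℚ : ℕ → ℚ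
  natℚ zero    = 0ℚ
  natℚ (suc k) = 1ℚ + natℚ k

  natℚ-toℚᵘ : ∀ k → toℚᵘ (natℚ k) ℚᵘ.≃ ℚᵘ.mkℚᵘ (ℤ.+ k) 0
  natℚ-toℚᵘ zero    = ℚᵘ.*≡* refl
  natℚ-toℚᵘ (suc k) =
    ℚᵘₚ.≃-trans (toℚᵘ-homo-+ 1ℚ (natℚ k))
      (ℚᵘₚ.≃-trans (ℚᵘₚ.+-congʳ (toℚᵘ 1ℚ) (natℚ-toℚᵘ k))
        (ℚᵘ.*≡* (cong (ℤ._* ℤ.+ 1) (cong (λ i → ℤ.+ 1 ℤ.+ i) (ℤₚ.*-identityʳ (ℤ.+ k))))))

  archimedean : ∀ p → ∃[ k ] (p ≤ natℚ k)
  archimedean p@(mkℚ n d _) = ℤ.∣ n ∣ , toℚᵘ-cancel-≤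
    (ℚᵘₚ.≤-respʳ-≃ (ℚᵘₚ.≃-sym (natℚ-toℚᵘ ℤ.∣ n ∣)) (ℚᵘ.*≤* (lemma n)))
    where
    lemma : ∀ n → n ℤ.* ℤ.+ 1 ℤ.≤ ℤ.+ ℤ.∣ n ∣ ℤ.* ℤ.+ suc d
    lemma (ℤ.+ n)    = ℤₚ.*-monoˡ-≤-nonNeg (ℤ.+ n) (ℤ.+≤+ (s≤s z≤n))
    lemma -[1+ n ] = ℤ.-≤+

  module _ (x : ℝ) where

    steps : ∀ {h} → 0ℚ < h → ∀ k a → L x a → U x (a + natℚ k * h) →
            ∃[ b ] (L x b × U x (b + (h + h)))
    steps {h} 0<h zero a La Ua =
      contradiction (subst (U x) (solve 2 (λ a h → a :+ con 0ℚ :* h := a) refl a h) Ua)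
                    (disjoint x La)
      where open +-*-Solver
    steps {h} 0<h (suc k) a La Ua
      with located x (+-monoʳ-< a (subst (_< h + h) (+-identityʳ h) (+-monoʳ-< h 0<h)))
    ... | inj₁ La+h  = steps 0<h k (a + h) La+h
      (subst (U x)
        (solve 3 (λ a h n → a :+ (con 1ℚ :+ n) :* h := (a :+ h) :+ n :* h) refl a h (natℚ k))
        Ua)
      where open +-*-Solver
    ... | inj₂ Ua+2h = a , La , Ua+2h

    straddle : ∀ {e} → 0ℚ < e → ∃[ a ] (L x a × U x (a + e))
    straddle {e} 0<e =
      let l , Ll = L-inhabited x
          u , Uu = U-inhabited x
          k , le = archimedean ((u - l) * 1/h)
          u≤     = ≤-trans (≤-reflexive (sym (cancel u l)))
                     (+-monoʳ-≤ l (*-monoʳ-≤-nonNeg h {{pos⇒nonNeg h}} le))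
          a , La , Ua = steps 0<h k l Ll (upper u≤ Uu)
      in a , La , subst (U x) (cong (a +_) (halves e)) Ua
      where
      open +-*-Solver
      h : ℚ
      h = ½ * e
      instance
        h-pos : Positive h
        h-pos = positive (subst (_< h) (*-zeroʳ ½) (*-monoʳ-<-pos ½ 0<e))
        h-nz : NonZero h
        h-nz = pos⇒nonZero h
      0<h : 0ℚ < h
      0<h = positive⁻¹ h
      1/h : ℚ
      1/h = 1/ h
      halves : ∀ e → ½ * e + ½ * e ≡ e
      halves = solve 1 (λ e → con ½ :* e :+ con ½ :* e := e) refl
      cancel : ∀ u l → l + (u - l) * 1/h * h ≡ u
      cancel u l = trans (cong (l +_) (trans (*-assoc (u - l) 1/h h)
                     (trans (cong ((u - l) *_) (*-inverseˡ h)) (*-identityʳ (u - l)))))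
                     (solve 2 (λ u l → l :+ (u :- l) := u) refl u l)
      upper : ∀ {p q} → p ≤ q → U x p → U x q
      upper {p} {q} p≤q Up with <-cmp p q
      ... | tri< p<q _ _  = U-upper x p<q Up
      ... | tri≈ _ refl _ = Up
      ... | tri> _ _ q<p  = contradiction q<p (≤⇒≯ p≤q)

infixl 6 _+ᴿ_ _-ᴿ_
infixl 7 _·ᴿ_

_+ᴿ_ : ℝ → ℝ → ℝ
x +ᴿ y = record
  { L           = λ q → ∃[ a ] ∃[ b ] (L x a × L y b × q < a + b)
  ; U           = λ q → ∃[ a ] ∃[ b ] (U x a × U y b × a + b < q)
  ; L-inhabited = let a , La = L-inhabited x ; b , Lb = L-inhabited y in
                  a + b - 1ℚ , a , b , La , Lb , q-1<q (a + b)
  ; U-inhabited = let a , Ua = U-inhabited x ; b , Ub = U-inhabited y in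
                  a + b + 1ℚ , a , b , Ua , Ub , q<q+1 (a + b)
  ; L-lower     = λ { p<q (a , b , La , Lb , q<) → a , b , La , Lb , <-trans p<q q< }
  ; U-upper     = λ { p<q (a , b , Ua , Ub , <p) → a , b , Ua , Ub , <-trans <p p<q }
  ; L-open      = λ { (a , b , La , Lb , p<) → let m , p<m , m< = <-dense p< in
                      m , p<m , a , b , La , Lb , m< }
  ; U-open      = λ { (a , b , Ua , Ub , <q) → let m , <m , m<q = <-dense <q in
                      m , m<q , a , b , Ua , Ub , <m }
  ; disjoint    = λ { (a , b , La , Lb , q<) (c , d , Uc , Ud , <q) →
                      <-asym (<-trans <q q<) (+-mono-< (L<U x La Uc) (L<U y Lb Ud)) }
  ; located     = loc
  }
  where
  open +-*-Solver
  loc : ∀ {p r} → p < r →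
        (∃[ a ] ∃[ b ] (L x a × L y b × p < a + b)) ⊎
        (∃[ a ] ∃[ b ] (U x a × U y b × a + b < r))
  loc {p} {r} p<r =
    let m , p<m , m<r  = <-dense p<r
        0<m-p          = subst (_< m - p) (+-inverseʳ p) (+-monoˡ-< (- p) p<m)
        a , La , Ua    = straddle x 0<m-p
        n , m<n , n<r  = <-dense m<r
        lt             = subst₂ _<_ (solve 3 (λ m p a → m :- (a :+ (m :- p)) := p :- a) refl m p a)
                           refl (+-monoˡ-< (- (a + (m - p))) m<n)
    in Sum.map
         (λ Lb → let b , <b , Lb′ = L-open y Lb in
           a , b , La , Lb′ ,
           subst (_< a + b) (solve 2 (λ p a → a :+ (p :- a) := p) refl p a) (+-monoʳ-< a <b))
         (λ Ub → a + (m - p) , n - (a + (m - p)) , Ua , Ub ,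
           subst (_< r) (solve 2 (λ n c → n := c :+ (n :- c)) refl n (a + (m - p))) n<r)
         (located y lt)

_-ᴿ_ : ℝ → ℝ → ℝ
x -ᴿ y = x +ᴿ -ᴿ y

_·ᴿ_ : (c : ℚ) .{{_ : Positive c}} → ℝ → ℝ
c ·ᴿ x = record
  { L           = λ q → ∃[ a ] (L x a × q < c * a)
  ; U           = λ q → ∃[ a ] (U x a × c * a < q)
  ; L-inhabited = let a , La = L-inhabited x in c * a - 1ℚ , a , La , q-1<q (c * a)
  ; U-inhabited = let a , Ua = U-inhabited x in c * a + 1ℚ , a , Ua , q<q+1 (c * a)
  ; L-lower     = λ { p<q (a , La , q<) → a , La , <-trans p<q q< }
  ; U-upper     = λ { p<q (a , Ua , <p) → a , Ua , <-trans <p p<q }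
  ; L-open      = λ { (a , La , p<) → let m , p<m , m< = <-dense p< in m , p<m , a , La , m< }
  ; U-open      = λ { (a , Ua , <q) → let m , <m , m<q = <-dense <q in m , m<q , a , Ua , <m }
  ; disjoint    = λ { (a , La , q<) (b , Ub , <q) →
                      <-asym (<-trans <q q<) (*-monoʳ-<-pos c (L<U x La Ub)) }
  ; located     = loc
  }
  where
  c⁻¹ : ℚ
  c⁻¹ = (1/ c) {{pos⇒nonZero c}}
  cancel : ∀ q → c * (c⁻¹ * q) ≡ q
  cancel q = trans (sym (*-assoc c c⁻¹ q))
               (trans (cong (_* q) (*-inverseʳ c {{pos⇒nonZero c}})) (*-identityˡ q))
  loc : ∀ {p r} → p < r →
        (∃[ a ] (L x a × p < c * a)) ⊎ (∃[ a ] (U x a × c * a < r))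
  loc {p} {r} p<r =
    let m , p<m , m<r = <-dense p<r
        n , m<n , n<r = <-dense m<r
    in Sum.map
         (λ La → c⁻¹ * m , La , subst (p <_) (sym (cancel m)) p<m)
         (λ Ua → c⁻¹ * n , Ua , subst (_< r) (sym (cancel n)) n<r)
         (located x (*-monoʳ-<-pos c⁻¹ {{1/pos⇒pos c}} m<n))

-- The non-negative square root: q < √c iff q < a for some rational a with
-- a² ≤ c, and √c < q iff b < q for some rational b > 0 with c ≤ b².
√ : (c : ℚ) .{{_ : NonNegative c}} → ℝ
√ c = record
  { L           = λ q → ∃[ a ] (a * a ≤ c × q < a)
  ; U           = λ q → ∃[ b ] (0ℚ < b × c ≤ b * b × b < q)
  ; L-inhabited = - 1ℚ , 0ℚ , nonNegative⁻¹ c , negative⁻¹ (- 1ℚ)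
  ; U-inhabited = c + 1ℚ + 1ℚ , c + 1ℚ , 0<c+1 , c≤[c+1]² , q<q+1 (c + 1ℚ)
  ; L-lower     = λ { p<q (a , le , q<a) → a , le , <-trans p<q q<a }
  ; U-upper     = λ { p<q (b , 0<b , le , b<p) → b , 0<b , le , <-trans b<p p<q }
  ; L-open      = λ { (a , le , p<a) → let m , p<m , m<a = <-dense p<a in m , p<m , a , le , m<a }
  ; U-open      = λ { (b , 0<b , le , b<q) → let m , b<m , m<q = <-dense b<q in
                      m , m<q , b , 0<b , le , b<m }
  ; disjoint    = λ { (a , a²≤c , q<a) (b , 0<b , c≤b² , b<q) →
                      ≤⇒≯ (≤-trans a²≤c c≤b²) (square-mono 0<b (<-trans b<q q<a)) }
  ; located     = loc
  }
  where
  0<c+1 : 0ℚ < c + 1ℚ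
  0<c+1 = +-mono-≤-< (nonNegative⁻¹ c) (positive⁻¹ 1ℚ)
  1≤c+1 : 1ℚ ≤ c + 1ℚ
  1≤c+1 = +-monoˡ-≤ 1ℚ (nonNegative⁻¹ c)
  c≤[c+1]² : c ≤ (c + 1ℚ) * (c + 1ℚ)
  c≤[c+1]² = ≤-trans (<⇒≤ (q<q+1 c))
    (subst (_≤ (c + 1ℚ) * (c + 1ℚ)) (*-identityʳ (c + 1ℚ))
      (*-monoˡ-≤-nonNeg (c + 1ℚ) {{nonNegative (<⇒≤ 0<c+1)}} 1≤c+1))
  square-mono : ∀ {b a} → 0ℚ < b → b < a → b * b < a * a
  square-mono {b} {a} 0<b b<a = <-trans
    (*-monoʳ-<-pos b {{positive 0<b}} b<a)
    (*-monoˡ-<-pos a {{positive (<-trans 0<b b<a)}} b<a)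
  loc : ∀ {p r} → p < r →
        (∃[ a ] (a * a ≤ c × p < a)) ⊎ (∃[ b ] (0ℚ < b × c ≤ b * b × b < r))
  loc p<r with <-dense p<r
  ... | m , p<m , m<r with 0ℚ <? m | m * m ≤? c
  ...   | no  m≤0 | _         = inj₁ (0ℚ , nonNegative⁻¹ c , <-≤-trans p<m (≮⇒≥ m≤0))
  ...   | yes _   | yes m²≤c  = inj₁ (m , m²≤c , p<m)
  ...   | yes 0<m | no  m²≰c  = inj₂ (m , 0<m , <⇒≤ (≰⇒> m²≰c) , m<r)

subsets : ∀ m → List (Subset m)
subsets zero    = [] ∷ []
subsets (suc m) = map (outside ∷_) (subsets m) ++ map (inside ∷_) (subsets m)

infix 9 _⁽_⁾

_⁽_⁾ : ∀ {m} → Subset m → ℕ → List (Subset m)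
V ⁽ r ⁾ = filter (λ s → s ⊆? V ×-dec ∣ s ∣ ℕ.≟ r) (subsets _)

private
  ∈-subsets : ∀ {m} (s : Subset m) → s ∈ subsets m
  ∈-subsets []            = here refl
  ∈-subsets (outside ∷ s) = ∈-++⁺ˡ (∈-map⁺ (outside ∷_) (∈-subsets s))
  ∈-subsets (inside ∷ s)  = ∈-++⁺ʳ _ (∈-map⁺ (inside ∷_) (∈-subsets s))

  r-subset : ∀ {m r} (V : Subset m) → r ℕ.≤ ∣ V ∣ → ∃[ s ] (s ⊆ V × ∣ s ∣ ≡ r)
  r-subset {m} {zero} V _ = ∅ , ⊥⊆ , ∣⊥∣≡0 m
  r-subset {r = suc r} (outside ∷ V) le =
    let s , s⊆V , eq = r-subset V le in outside ∷ s , out⊆ s⊆V , eq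
  r-subset {r = suc r} (inside ∷ V) (s≤s le) =
    let s , s⊆V , eq = r-subset V le in inside ∷ s , s⊆s s⊆V , cong suc eq

⁽⁾-nonZero : ∀ {m r} (V : Subset m) → r ℕ.≤ ∣ V ∣ → ℕ.NonZero (length (V ⁽ r ⁾))
⁽⁾-nonZero {r = r} V le =
  let s , s⊆V , eq = r-subset V le
  in nz (∈-filter⁺ (λ s → s ⊆? V ×-dec ∣ s ∣ ℕ.≟ r) (∈-subsets s) ((λ {x} → s⊆V {x}) , eq))
  where
  nz : ∀ {A : Set} {x : A} {xs} → x ∈ xs → ℕ.NonZero (length xs)
  nz (here _)  = _
  nz (there _) = _

-- The vertex set may be any subset of an ambient Fin m, so that a graph and
-- its subgraphs live over the same ambient set.
record Hypergraph (r m : ℕ) : Set where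
  field
    V       : Subset m
    edge    : Subset m → Bool
    uniform : ∀ {s} → T (edge s) → s ⊆ V × ∣ s ∣ ≡ r

  order : ℕ
  order = ∣ V ∣

  E : List (Subset m)
  E = filter (T? ∘ edge) (subsets m)

  density : r ℕ.≤ order → ℚ
  density r≤order = _/_ (ℤ.+ length E) (length (V ⁽ r ⁾)) {{⁽⁾-nonZero V r≤order}}

open Hypergraph

_IsSubgraphOf_ : ∀ {r m} → Hypergraph r m → Hypergraph r m → Set
H IsSubgraphOf G = V H ⊆ V G × (∀ {s} → T (edge H s) → T (edge G s))

-- Graphs of order less than r, for which the density would be 0/0, are excluded.
DensityAtLeast : ∀ {r m} → ℝ → Hypergraph r m → Set
DensityAtLeast {r} x G = Σ[ r≤order ∈ r ℕ.≤ order G ] x ≤ᴿ fromℚ (density G r≤order)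

IsJump : ℕ → ℝ → Set₁
IsJump r α =
  Σ[ δ ∈ ℝ ] 0ᴿ <ᴿ δ ×
    (∀ (ε : ℝ) → 0ᴿ <ᴿ ε → ∀ (n : ℕ) → r ℕ.≤ n →
      Σ[ N ∈ ℕ ] ∀ {m} (G : Hypergraph r m) → N ℕ.≤ order G →
        DensityAtLeast (α +ᴿ ε) G →
        Σ[ H ∈ Hypergraph r m ]
          H IsSubgraphOf G × order H ≡ n × DensityAtLeast (α +ᴿ δ) H)

IsNonJump : ℕ → ℝ → Set₁
IsNonJump r α = 0ᴿ ≤ᴿ α × α <ᴿ 1ᴿ × ¬ IsJump r α

{-# OPTIONS --safe #-}

-- The number α is the maximal density of blow-ups of the pattern with parts x₀, x₁, Y, b and
-- edges x₀x₁Y, bx₀x₁, bx₀Y, bx₁Y and bYY, attained for x₀ : x₁ : Y : b = 1 : 1 : 1 + √5 : √5.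
-- Split Y into T classes and keep only those triples bYY that meet two of them: this costs a
-- term of order 1/T. Then add a sparse 3-graph Q on the T classes; with at least 2T²/5 edges it
-- wins back more than was lost, so large blow-ups have density at least α + ε for a fixed ε > 0.
-- On the other hand Q can be chosen (at random, with a few edges deleted) such that any v classes
-- with 2 ≤ v ≤ n span at most v − 2 edges of Q and any two classes lie in at most 8 of them. For
-- all weights on at most n classes Q then gains too little to push the density above α, so that
-- the subgraphs of order n have density at most α n² / ((n − 1)(n − 2)) up to a small error, which
-- is below α + δ when n is large.
module Submission where

-- Let Y be the sum of the weights of the T classes and s the sum of their squares. Splitting costs
-- 3 b s and the triples of Q, of total weight q, win 6 q. So Q pays iff q / (Y s) exceeds b / (2
-- Y), which is (5 - √5) / 8 = 0.345... at the optimal ratio. Equal weights on all T classes reach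
-- 0.4; on at most n classes 0.29 is never exceeded. Sparsity alone would not give this: a book, v -
-- 2 triples through one common pair, is sparse and for large v and suitable weights comes close to
-- 1/2. Hence the bound on the codegrees. For smaller b / Y the system Q may win, but there the
-- density without Q is far enough below α. The irrational √5 is replaced by u / v with u² = 5 v² +
-- 1: u / v is slightly above √5 and 5 v / u slightly below. All estimates become polynomial
-- inequalities over ℤ, proved by certificates: a positive multiple of the difference is written as
-- a sum of products of nonnegative terms.

-- Sums of natural numbers over lists.

module FiniteSums where

  open import Data.Bool using (Bool; true; false; if_then_else_)
  open import Data.Fin using (Fin; zero; suc)
  open import Data.List using (List; []; _∷_; _++_; map; length; allFin; filter)
  open import Data.List.Properties using (length-tabulate; map-tabulate; map-++; map-∘)
  open import Data.List.Membership.Propositional using (_∈_)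
  open import Data.List.Relation.Unary.Any using (here; there)
  open import Data.List.Relation.Binary.Permutation.Propositional using (_↭_; refl; prep; swap; trans)
  open import Data.Nat
  open import Data.Nat.ListAction using (sum)
  open import Data.Nat.ListAction.Properties using (sum-++)
  open import Data.Nat.Properties
  open import Data.Nat.Tactic.RingSolver using (solve-∀)
  open import Function using (_∘_)
  open import Relation.Binary.PropositionalEquality hiding (trans)
  import Relation.Binary.PropositionalEquality as ≡
  open import Relation.Nullary using (does)
  open import Relation.Unary using (Decidable)

  private variable
    A B : Set

  ∑ : List A → (A → ℕ) → ℕ
  ∑ xs f = sum (map f xs)

  ∑-cong : (xs : List A) {f g : A → ℕ} → (∀ x → f x ≡ g x) → ∑ xs f ≡ ∑ xs g
  ∑-cong []       eq = refl
  ∑-cong (x ∷ xs) eq = cong₂ _+_ (eq x) (∑-cong xs eq)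

  ∑-mono : (xs : List A) {f g : A → ℕ} → (∀ {x} → x ∈ xs → f x ≤ g x) → ∑ xs f ≤ ∑ xs g
  ∑-mono []       le = z≤n
  ∑-mono (x ∷ xs) le = +-mono-≤ (le (here refl)) (∑-mono xs (le ∘ there))

  ∑-+ : (xs : List A) (f g : A → ℕ) → ∑ xs (λ x → f x + g x) ≡ ∑ xs f + ∑ xs g
  ∑-+ []       f g = refl
  ∑-+ (x ∷ xs) f g = ≡.trans (cong (f x + g x +_) (∑-+ xs f g)) (lemma (f x) (g x) (∑ xs f) (∑ xs g))
    where
    lemma : ∀ a b c d → a + b + (c + d) ≡ a + c + (b + d)
    lemma = solve-∀

  ∑-*ˡ : (xs : List A) (k : ℕ) (f : A → ℕ) → ∑ xs (λ x → k * f x) ≡ k * ∑ xs f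
  ∑-*ˡ []       k f = sym (*-zeroʳ k)
  ∑-*ˡ (x ∷ xs) k f = ≡.trans (cong (k * f x +_) (∑-*ˡ xs k f)) (sym (*-distribˡ-+ k (f x) (∑ xs f)))

  ∑-*ʳ : (xs : List A) (k : ℕ) (f : A → ℕ) → ∑ xs (λ x → f x * k) ≡ ∑ xs f * k
  ∑-*ʳ xs k f = ≡.trans (∑-cong xs (λ x → *-comm (f x) k)) (≡.trans (∑-*ˡ xs k f) (*-comm k (∑ xs f)))

  ∑-const : (xs : List A) (k : ℕ) → ∑ xs (λ _ → k) ≡ length xs * k
  ∑-const []       k = refl
  ∑-const (x ∷ xs) k = cong (k +_) (∑-const xs k)

  ∑-zero : (xs : List A) → ∑ xs (λ _ → 0) ≡ 0
  ∑-zero xs = ≡.trans (∑-const xs 0) (*-zeroʳ (length xs))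

  ∑-++ : (xs ys : List A) (f : A → ℕ) → ∑ (xs ++ ys) f ≡ ∑ xs f + ∑ ys f
  ∑-++ xs ys f = ≡.trans (cong sum (map-++ f xs ys)) (sum-++ (map f xs) (map f ys))

  ∑-map : (g : B → A) (xs : List B) (f : A → ℕ) → ∑ (map g xs) f ≡ ∑ xs (f ∘ g)
  ∑-map g xs f = cong sum (sym (map-∘ xs))

  ∑-swap : (xs : List A) (ys : List B) (f : A → B → ℕ) →
           ∑ xs (λ x → ∑ ys (f x)) ≡ ∑ ys (λ y → ∑ xs (λ x → f x y))
  ∑-swap []       ys f = sym (∑-zero ys)
  ∑-swap (x ∷ xs) ys f = ≡.trans (cong (∑ ys (f x) +_) (∑-swap xs ys f))
    (sym (∑-+ ys (f x) (λ y → ∑ xs (λ x′ → f x′ y))))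

  ∑-↭ : {xs ys : List A} (f : A → ℕ) → xs ↭ ys → ∑ xs f ≡ ∑ ys f
  ∑-↭ f refl         = refl
  ∑-↭ f (prep x p)   = cong (f x +_) (∑-↭ f p)
  ∑-↭ f (swap {xs} {ys} x y p) = ≡.trans (cong (λ s → f x + (f y + s)) (∑-↭ f p)) (lemma (f x) (f y) (∑ ys f))
    where
    lemma : ∀ a b c → a + (b + c) ≡ b + (a + c)
    lemma = solve-∀
  ∑-↭ f (trans p q)  = ≡.trans (∑-↭ f p) (∑-↭ f q)

  ∑-∈ : (xs : List A) (f : A → ℕ) {x : A} → x ∈ xs → f x ≤ ∑ xs f
  ∑-∈ (x ∷ xs) f (here refl) = m≤m+n (f x) (∑ xs f)
  ∑-∈ (x ∷ xs) f (there x∈)  = ≤-trans (∑-∈ xs f x∈) (m≤n+m (∑ xs f) (f x))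

  ∑-allFin : ∀ n (f : Fin (suc n) → ℕ) → ∑ (allFin (suc n)) f ≡ f zero + ∑ (allFin n) (f ∘ suc)
  ∑-allFin n f = cong (f zero +_)
    (cong sum (≡.trans (map-tabulate suc f) (sym (map-tabulate (λ i → i) (f ∘ suc)))))

  length-allFin : ∀ n → length (allFin n) ≡ n
  length-allFin n = length-tabulate {n = n} (λ i → i)

  𝟙 : Bool → ℕ
  𝟙 b = if b then 1 else 0

  ∑-filter : ∀ {P : A → Set} (P? : Decidable P) (xs : List A) (f : A → ℕ) →
             ∑ (filter P? xs) f ≡ ∑ xs (λ x → 𝟙 (does (P? x)) * f x)
  ∑-filter P? []       f = refl
  ∑-filter P? (x ∷ xs) f with does (P? x)
  ... | true  = cong₂ _+_ (sym (+-identityʳ (f x))) (∑-filter P? xs f)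
  ... | false = ∑-filter P? xs f

  length-filter-𝟙 : ∀ {P : A → Set} (P? : Decidable P) (xs : List A) →
                    length (filter P? xs) ≡ ∑ xs (λ x → 𝟙 (does (P? x)))
  length-filter-𝟙 P? []       = refl
  length-filter-𝟙 P? (x ∷ xs) with does (P? x)
  ... | true  = cong suc (length-filter-𝟙 P? xs)
  ... | false = length-filter-𝟙 P? xs

-- Certificates for polynomial inequalities over ℤ, and their transfer to ℕ.

module IntegerPolynomials where

  open import Data.Bool using (Bool; true; false; T; _∧_)
  open import Data.Bool.Properties using (T-∧)
  open import Data.Integer as ℤ using (ℤ; 0ℤ; -[1+_]; +≤+; +<+)
  import Data.Integer.Properties as ℤₚ
  open import Data.Integer.Tactic.RingSolver using (ring)
  open import Data.Nat as ℕ using (ℕ; z≤n; s≤s)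
  open import Data.Product using (_,_)
  open import Data.Sum using (_⊎_)
  import Data.Sum as Sum
  open import Data.Vec using (Vec; lookup; map)
  open import Data.Vec.Properties using (lookup-map)
  open import Function using (Equivalence)
  open import Relation.Binary.PropositionalEquality
  open import Tactic.RingSolver.NonReflective ring using (Expr; Κ; Ι; _⊕_; _⊗_; _⊛_; ⊝_; module Ops)
  open Ops using (⟦_⟧; norm; correct; homo)
  import Tactic.RingSolver.Core.Polynomial.Semantics homo as Semantics

  Poly : ℕ → Set
  Poly = Expr ℤ

  infixl 6 _⊖_
  _⊖_ : ∀ {n} → Poly n → Poly n → Poly n
  e ⊖ f = e ⊕ ⊝ f

  ♯ : ∀ {n} → ℕ → Poly n
  ♯ k = Κ (ℤ.+ k)

  norm-sound : ∀ {n} (e f : Poly n) → norm e ≡ norm f → ∀ ρ → ⟦ e ⟧ ρ ≡ ⟦ f ⟧ ρ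
  norm-sound e f eq ρ =
    trans (sym (correct e ρ)) (trans (cong (λ p → Semantics.⟦ p ⟧ ρ) eq) (correct f ρ))

  0≤-+ : ∀ {i j} → 0ℤ ℤ.≤ i → 0ℤ ℤ.≤ j → 0ℤ ℤ.≤ i ℤ.+ j
  0≤-+ = ℤₚ.+-mono-≤

  0≤-* : ∀ {i j} → 0ℤ ℤ.≤ i → 0ℤ ℤ.≤ j → 0ℤ ℤ.≤ i ℤ.* j
  0≤-* {ℤ.+ m} {ℤ.+ n} _ _ = subst (0ℤ ℤ.≤_) (ℤₚ.pos-* m n) (+≤+ z≤n)

  0≤-² : ∀ i → 0ℤ ℤ.≤ i ℤ.* i
  0≤-² (ℤ.+ n)  = subst (0ℤ ℤ.≤_) (ℤₚ.pos-* n n) (+≤+ z≤n)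
  0≤-² -[1+ n ] = +≤+ z≤n

  module Positivity {n} (ρ : Vec ℤ n) where

    infix 4 0≤_
    infixl 6 _+⁺_
    infixl 7 _*⁺_

    -- A record rather than the bare inequality, so that unification can recover the expression `e`
    -- from a proof; its value `⟦ e ⟧ ρ` does not determine it.
    record 0≤_ (e : Poly n) : Set where
      constructor ⟨_⟩
      field holds : 0ℤ ℤ.≤ ⟦ e ⟧ ρ

    open 0≤_ public

    _+⁺_ : ∀ {e f} → 0≤ e → 0≤ f → 0≤ e ⊕ f
    ⟨ p ⟩ +⁺ ⟨ q ⟩ = ⟨ 0≤-+ p q ⟩

    _*⁺_ : ∀ {e f} → 0≤ e → 0≤ f → 0≤ e ⊗ f
    ⟨ p ⟩ *⁺ ⟨ q ⟩ = ⟨ 0≤-* p q ⟩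

    sq : ∀ {e} → 0≤ e ⊗ e
    sq {e} = ⟨ 0≤-² (⟦ e ⟧ ρ) ⟩

    ♯⁺ : ∀ {k} → 0≤ ♯ k
    ♯⁺ = ⟨ +≤+ z≤n ⟩

    -- The certificate step: `f` is assembled from terms known to be nonnegative, and comparison of
    -- normal forms identifies it with `e`.
    by : ∀ {e f} → 0≤ f → norm e ≡ norm f → 0≤ e
    by {e} {f} ⟨ p ⟩ eq = ⟨ subst (0ℤ ℤ.≤_) (sym (norm-sound e f eq ρ)) p ⟩

    -- Lets a certificate speak of a positive multiple of the goal, which replaces rational
    -- coefficients and division. Over ℤ positivity of the factor is `e − 1 ≥ 0`.
    cancel : ∀ {e f} → 0≤ e ⊖ ♯ 1 → 0≤ e ⊗ f → 0≤ f
    cancel {e} {f} ⟨ 1≤e ⟩ ⟨ p ⟩ = ⟨ ℤₚ.*-cancelˡ-≤-pos 0ℤ (⟦ f ⟧ ρ) (⟦ e ⟧ ρ) {{ℤ.positive 0<e}}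
      (subst (ℤ._≤ ⟦ e ⟧ ρ ℤ.* ⟦ f ⟧ ρ) (sym (ℤₚ.*-zeroʳ (⟦ e ⟧ ρ))) p) ⟩
      where
      0<e : 0ℤ ℤ.< ⟦ e ⟧ ρ
      0<e = ℤₚ.<-≤-trans (+<+ (s≤s z≤n)) (ℤₚ.0≤i-j⇒j≤i 1≤e)

    cancel♯ : ∀ k {f} → 0≤ ♯ (ℕ.suc k) ⊗ f → 0≤ f
    cancel♯ k = cancel {♯ (ℕ.suc k)} ⟨ ℤₚ.i≤j⇒0≤j-i (+≤+ (s≤s z≤n)) ⟩

    total : ∀ e f → 0≤ e ⊖ f ⊎ 0≤ f ⊖ e
    total e f = Sum.map (λ le → ⟨ ℤₚ.i≤j⇒0≤j-i le ⟩) (λ le → ⟨ ℤₚ.i≤j⇒0≤j-i le ⟩)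
      (ℤₚ.≤-total (⟦ f ⟧ ρ) (⟦ e ⟧ ρ))

    square-mono : ∀ {e f} → 0≤ e → 0≤ f ⊖ e → 0≤ f ⊗ f ⊖ e ⊗ e
    square-mono {e} {f} 0≤e e≤f = ⟨ subst (0ℤ ℤ.≤_) (identity (⟦ e ⟧ ρ) (⟦ f ⟧ ρ))
      (0≤-* (holds e≤f) (0≤-+ (holds e≤f) (0≤-+ (holds 0≤e) (holds 0≤e)))) ⟩
      where
      open import Data.Integer.Tactic.RingSolver using (solve-∀)
      identity : ∀ x y → (y ℤ.+ ℤ.- x) ℤ.* ((y ℤ.+ ℤ.- x) ℤ.+ (x ℤ.+ x)) ≡ y ℤ.* y ℤ.+ ℤ.- (x ℤ.* x)
      identity = solve-∀

  subtractionFree : ∀ {n} → Poly n → Bool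
  subtractionFree (Κ (ℤ.+ _))   = true
  subtractionFree (Κ -[1+ _ ])  = false
  subtractionFree (Ι _)         = true
  subtractionFree (e ⊕ f)       = subtractionFree e ∧ subtractionFree f
  subtractionFree (e ⊗ f)       = subtractionFree e ∧ subtractionFree f
  subtractionFree (_ ⊛ _)       = false
  subtractionFree (⊝ _)         = false

  -- An opaque product keeps large numerals from being unfolded in unary.
  opaque
    infixl 7 _·_
    _·_ : ℕ → ℕ → ℕ
    _·_ = ℕ._*_

    ·≡* : ∀ m n → m · n ≡ m ℕ.* n
    ·≡* m n = refl

  -- The values at powers and negations and the absolute value at negative constants are
  -- placeholders: `subtractionFree` excludes these expressions.
  ⟦_⟧ₙ : ∀ {n} → Poly n → Vec ℕ n → ℕ
  ⟦ Κ k   ⟧ₙ ρ = ℤ.∣ k ∣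
  ⟦ Ι i   ⟧ₙ ρ = lookup ρ i
  ⟦ e ⊕ f ⟧ₙ ρ = ⟦ e ⟧ₙ ρ ℕ.+ ⟦ f ⟧ₙ ρ
  ⟦ e ⊗ f ⟧ₙ ρ = ⟦ e ⟧ₙ ρ · ⟦ f ⟧ₙ ρ
  ⟦ _ ⊛ _ ⟧ₙ ρ = 0
  ⟦ ⊝ _   ⟧ₙ ρ = 0

  ⟦⟧ₙ-sound : ∀ {n} (e : Poly n) → T (subtractionFree e) → ∀ ρ → ⟦ e ⟧ (map ℤ.+_ ρ) ≡ ℤ.+ ⟦ e ⟧ₙ ρ
  ⟦⟧ₙ-sound (Κ (ℤ.+ _)) _ ρ = refl
  ⟦⟧ₙ-sound (Ι i)       _ ρ = lookup-map i ℤ.+_ ρ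
  ⟦⟧ₙ-sound (e ⊕ f) t ρ with Equivalence.to T-∧ t
  ... | te , tf = cong₂ ℤ._+_ (⟦⟧ₙ-sound e te ρ) (⟦⟧ₙ-sound f tf ρ)
  ⟦⟧ₙ-sound (e ⊗ f) t ρ with Equivalence.to T-∧ t
  ... | te , tf = trans (cong₂ ℤ._*_ (⟦⟧ₙ-sound e te ρ) (⟦⟧ₙ-sound f tf ρ)) (sym (trans (cong ℤ.+_ (·≡* (⟦ e ⟧ₙ ρ) (⟦ f ⟧ₙ ρ))) (ℤₚ.pos-* (⟦ e ⟧ₙ ρ) (⟦ f ⟧ₙ ρ))))

  module NatPositivity {n} (ρ : Vec ℕ n) where

    open Positivity (map ℤ.+_ ρ) public

    fromℕ : ∀ e f {_ : T (subtractionFree e)} {_ : T (subtractionFree f)} →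
            ⟦ f ⟧ₙ ρ ℕ.≤ ⟦ e ⟧ₙ ρ → 0≤ e ⊖ f
    fromℕ e f {te} {tf} f≤e = ⟨ ℤₚ.i≤j⇒0≤j-i (subst₂ ℤ._≤_ (sym (⟦⟧ₙ-sound f tf ρ)) (sym (⟦⟧ₙ-sound e te ρ)) (+≤+ f≤e)) ⟩

    toℕ : ∀ e f {_ : T (subtractionFree e)} {_ : T (subtractionFree f)} →
          0≤ e ⊖ f → ⟦ f ⟧ₙ ρ ℕ.≤ ⟦ e ⟧ₙ ρ
    toℕ e f {te} {tf} ⟨ p ⟩ = ℤₚ.drop‿+≤+ (subst₂ ℤ._≤_ (⟦⟧ₙ-sound f tf ρ) (⟦⟧ₙ-sound e te ρ) (ℤₚ.0≤i-j⇒j≤i p))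

    var⁺ : ∀ i → 0≤ Ι i
    var⁺ i = ⟨ subst (0ℤ ℤ.≤_) (sym (lookup-map i ℤ.+_ ρ)) (+≤+ z≤n) ⟩

-- The bound 100 Q ≤ 29 Y s in terms of the largest weights.

module SparseInequality where

  open IntegerPolynomials
  open import Data.Fin.Patterns
  open import Data.Integer as ℤ using (ℤ)
  import Data.Integer.Properties as ℤₚ
  open import Data.Sum using (inj₁; inj₂)
  import Data.Sum as Sum
  open import Data.Vec using (Vec)
  open import Data.Integer.Tactic.RingSolver using (ring)
  open import Tactic.RingSolver.NonReflective ring using (Expr; Κ; Ι; _⊕_; _⊗_; _⊛_; ⊝_; module Ops)
  open Ops using (⟦_⟧; norm)
  open import Relation.Binary.PropositionalEquality

  module _ (ρ : Vec ℤ 7) where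
    open Positivity ρ
    private
      -- Intended reading: `p`, `q` are the two largest weights and `w` the fourth; `z` sums the
      -- smallest weights of the triples that contain two of the three heaviest classes; `z + A` is
      -- the weight outside the two heaviest classes and `σ` the sum of squares there.
      p q w z A σ Q Y E : Poly 7
      p = Ι 0F
      q = Ι 1F
      w = Ι 2F
      z = Ι 3F
      A = Ι 4F
      σ = Ι 5F
      Q = Ι 6F
      Y = z ⊕ A ⊕ p ⊕ q
      E = q ⊗ z ⊕ w ⊗ A

      _² : Poly 7 → Poly 7
      e ² = e ⊗ e

    module _ (0≤w : 0≤ w) (w≤q : 0≤ q ⊖ w) (q≤p : 0≤ p ⊖ q) (0≤z : 0≤ z) (0≤A : 0≤ A)
             (2w²≤σ : 0≤ σ ⊖ ♯ 2 ⊗ w ²) (z²≤24σ : 0≤ ♯ 24 ⊗ σ ⊖ z ²) where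
      private
        0≤q : 0≤ q
        0≤q = by (0≤w +⁺ w≤q) refl
        0≤p : 0≤ p
        0≤p = by (0≤q +⁺ q≤p) refl
        0≤Y : 0≤ Y
        0≤Y = 0≤z +⁺ 0≤A +⁺ 0≤p +⁺ 0≤q
        0≤E : 0≤ E
        0≤E = 0≤q *⁺ 0≤z +⁺ 0≤w *⁺ 0≤A
        0≤σ : 0≤ σ
        0≤σ = by (2w²≤σ +⁺ ♯⁺ {2} *⁺ sq {w}) refl

        -- The discriminant condition under which `29 Y (p² + q² + σ) − 100 p E`, read as a
        -- quadratic in `p` with `Y` and `E` fixed, is nonnegative. It is proved in four ranges of
        -- `z`, since the two lower bounds for `σ`, by `w` and by `z`, are useful for small and for
        -- large `z` respectively.
        Bound : Set
        Bound = 0≤ ♯ 841 ⊗ Y ² ⊗ (q ² ⊕ σ) ⊖ ♯ 2500 ⊗ E ²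

        -- `3 E ≤ Y (q + 2 w)` and, by Cauchy-Schwarz, `(q + 2 w)² ≤ 3 (q² + 2 w²) ≤ 3 (q² + σ)`;
        -- this suffices because 2500 / 3 < 841.
        z≤Y/3 : 0≤ Y ⊖ ♯ 3 ⊗ z → Bound
        z≤Y/3 h = cancel♯ 8 (by
          (♯⁺ {2500} *⁺ square-mono {♯ 3 ⊗ E} (♯⁺ *⁺ 0≤E) 3E≤
           +⁺ sq {Y} *⁺ (♯⁺ {69} *⁺ (sq {q} +⁺ 0≤σ) +⁺ ♯⁺ {2500} *⁺ (♯⁺ {3} *⁺ 2w²≤σ +⁺ ♯⁺ {2} *⁺ sq {q ⊖ w})))
          refl)
          where
          3E≤ : 0≤ Y ⊗ (q ⊕ ♯ 2 ⊗ w) ⊖ ♯ 3 ⊗ E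
          3E≤ = by (h *⁺ w≤q +⁺ ♯⁺ {3} *⁺ 0≤w *⁺ (0≤p +⁺ 0≤q)) refl

        -- Here `E ≤ q Y` is enough: `24 σ ≥ z² ≥ 49 q²` gives `q² + σ ≥ (73/24) q²`, and 841 · 73
        -- exceeds 2500 · 24 by 1393.
        7q≤z : 0≤ z ⊖ ♯ 7 ⊗ q → Bound
        7q≤z h = cancel♯ 23 (by
          (♯⁺ {60000} *⁺ square-mono 0≤E E≤
           +⁺ sq {Y} *⁺ (♯⁺ {841} *⁺ (z²≤24σ +⁺ square-mono {♯ 7 ⊗ q} (♯⁺ *⁺ 0≤q) h) +⁺ ♯⁺ {1393} *⁺ sq {q}))
          refl)
          where
          E≤ : 0≤ Y ⊗ q ⊖ E
          E≤ = by (w≤q *⁺ 0≤A +⁺ (0≤p +⁺ 0≤q) *⁺ 0≤q) refl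

        -- Cauchy–Schwarz: 2 E² ≤ (q² + 2 w²) (2 z² + A²), where A ≤ Y − (9/7) z.
        z-medium : 0≤ ♯ 3 ⊗ z ⊖ Y → 0≤ ♯ 7 ⊗ q ⊖ z → 0≤ ♯ 13 ⊗ Y ⊖ ♯ 25 ⊗ z → Bound
        z-medium Y≤3z z≤7q z≤ = cancel♯ 1 (by
          (♯⁺ {2500} *⁺ sq {q ⊗ A ⊖ ♯ 2 ⊗ w ⊗ z}
           +⁺ (sq {q} +⁺ ♯⁺ {2} *⁺ sq {w}) *⁺ K≤
           +⁺ ♯⁺ {1682} *⁺ sq {Y} *⁺ 2w²≤σ) refl)
          where
          A≤ : 0≤ ♯ 7 ⊗ Y ⊖ ♯ 9 ⊗ z ⊖ ♯ 7 ⊗ A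
          A≤ = by (z≤7q +⁺ z≤7q +⁺ ♯⁺ {7} *⁺ q≤p) refl
          K≤ : 0≤ ♯ 1682 ⊗ Y ² ⊖ ♯ 2500 ⊗ (♯ 2 ⊗ z ² ⊕ A ²)
          K≤ = cancel♯ 146 (by
            (♯⁺ {7500} *⁺ square-mono (♯⁺ {7} *⁺ 0≤A) A≤
             +⁺ ♯⁺ {17900} *⁺ (Y≤3z *⁺ z≤)
             +⁺ 0≤Y *⁺ (♯⁺ {8024} *⁺ z≤ +⁺ ♯⁺ {8142} *⁺ 0≤Y)) refl)

        -- E ≤ q (Y − 2q) ≤ Y N / 10⁴ for N = 0.8 · 5800 q + 0.6 · 610 Y, and
        -- N² ≤ (5800 q)² + (610 Y)².
        z-large : 0≤ ♯ 25 ⊗ z ⊖ ♯ 13 ⊗ Y → Bound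
        z-large h = cancel♯ 599999999 (by
          (♯⁺ {15000} *⁺ square-mono (♯⁺ {10000} *⁺ 0≤E) E≤
           +⁺ ♯⁺ {15000} *⁺ sq {Y} *⁺ sq {♯ 3480 ⊗ q ⊖ ♯ 488 ⊗ Y}
           +⁺ sq {Y} *⁺ (♯⁺ {21025000000} *⁺ z²≤24σ
                         +⁺ ♯⁺ {33640000} *⁺ square-mono (♯⁺ {13} *⁺ 0≤Y) h
                         +⁺ ♯⁺ {103660000} *⁺ sq {Y})) refl)
          where
          E≤ : 0≤ Y ⊗ (♯ 4640 ⊗ q ⊕ ♯ 366 ⊗ Y) ⊖ ♯ 10000 ⊗ E
          E≤ = cancel♯ 19999 (by
            (♯⁺ {200000000} *⁺ (w≤q *⁺ 0≤A +⁺ 0≤q *⁺ q≤p)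
             +⁺ sq {♯ 20000 ⊗ q ⊖ ♯ 2680 ⊗ Y} +⁺ ♯⁺ {137600} *⁺ sq {Y}) refl)

        bound : Bound
        bound with total Y (♯ 3 ⊗ z) | total z (♯ 7 ⊗ q) | total (♯ 13 ⊗ Y) (♯ 25 ⊗ z)
        ... | inj₁ h | _      | _      = z≤Y/3 h
        ... | inj₂ _ | inj₁ h | _      = 7q≤z h
        ... | inj₂ _ | inj₂ _ | inj₂ h = z-large h
        ... | inj₂ g | inj₂ h | inj₁ k = z-medium g h k

      Q-bound : 0≤ p ⊗ q ⊗ z ⊕ p ⊗ w ⊗ A ⊖ Q → 0≤ Y ⊖ ♯ 1 → 0≤ ♯ 29 ⊗ Y ⊗ (p ² ⊕ q ² ⊕ σ) ⊖ ♯ 100 ⊗ Q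
      Q-bound Q≤pE 1≤Y = by (pE-bound +⁺ ♯⁺ {100} *⁺ Q≤pE) refl
        where
        pE-bound : 0≤ ♯ 29 ⊗ Y ⊗ (p ² ⊕ q ² ⊕ σ) ⊖ ♯ 100 ⊗ p ⊗ E
        pE-bound = cancel {Y} 1≤Y (cancel♯ 28 (by (sq {♯ 29 ⊗ Y ⊗ p ⊖ ♯ 50 ⊗ E} +⁺ bound) refl))

-- The cubic inequality that bounds the density of weighted patterns by α.

module CubicInequality where

  open IntegerPolynomials
  open import Data.Fin.Patterns
  open import Data.Integer as ℤ using (ℤ)
  open import Data.Sum using (inj₁; inj₂; _⊎_)
  open import Data.Vec using (Vec)
  open import Data.Integer.Tactic.RingSolver using (ring)
  open import Tactic.RingSolver.NonReflective ring using (Expr; Κ; Ι; _⊕_; _⊗_; _⊛_; ⊝_; module Ops)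
  open Ops using (⟦_⟧; norm)
  open import Relation.Binary.PropositionalEquality

  module _ (ρ : Vec ℤ 8) where
    open Positivity ρ
    private
      u v X Y b π s Q : Poly 8
      u = Ι 0F
      v = Ι 1F
      X = Ι 2F
      Y = Ι 3F
      b = Ι 4F
      π = Ι 5F
      s = Ι 6F
      Q = Ι 7F

      _² _³ : Poly 8 → Poly 8
      e ² = e ⊗ e
      e ³ = e ⊗ e ⊗ e

    module _ (4≤v : 0≤ v ⊖ ♯ 4) (4u≤9v : 0≤ ♯ 9 ⊗ v ⊖ ♯ 4 ⊗ u) (2236v≤1000u : 0≤ ♯ 1000 ⊗ u ⊖ ♯ 2236 ⊗ v)
             (u²≤ : 0≤ ♯ 5 ⊗ v ² ⊕ ♯ 1 ⊖ u ²) (u²≥ : 0≤ u ² ⊖ ♯ 5 ⊗ v ²)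
             (0≤X : 0≤ X) (0≤Y : 0≤ Y) (0≤b : 0≤ b) where
      private
        0≤v : 0≤ v
        0≤v = by (4≤v +⁺ ♯⁺ {4}) refl
        0≤u : 0≤ u
        0≤u = cancel♯ 999 (by (2236v≤1000u +⁺ ♯⁺ {2236} *⁺ 0≤v) refl)
        1≤168v² : 0≤ ♯ 168 ⊗ v ² ⊖ ♯ 1
        1≤168v² = by (♯⁺ {168} *⁺ (4≤v *⁺ (4≤v +⁺ ♯⁺ {8})) +⁺ ♯⁺ {2687}) refl

        -- `W / (121 v²)` is α with √5 replaced by `u / v`, up to the slack 500 that pays for
        -- `u² − 5 v²` being only nearly 0. `P` is twice the density polynomial of the unsplit
        -- pattern with both parts x₀ and x₁ equal to `X / 2`.
        L M W S P : Poly 8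
        L = ♯ 2 ⊗ v ⊗ b ⊖ u ⊗ X
        M = v ⊗ (♯ 2 ⊗ Y ⊖ X ⊖ ♯ 2 ⊗ b)
        W = ♯ 30 ⊗ u ⊗ v ⊖ ♯ 12 ⊗ v ² ⊕ ♯ 500
        S = X ⊕ Y ⊕ b
        P = ♯ 3 ⊗ X ² ⊗ Y ⊕ ♯ 3 ⊗ b ⊗ X ² ⊕ ♯ 12 ⊗ b ⊗ X ⊗ Y ⊕ ♯ 6 ⊗ b ⊗ Y ²

      -- With c = u/v ≈ √5, the cubic form is maximal at X : Y : b = 2 : 1 + c : c, where
      -- L and M vanish; it is X q₁ + Y q₂ + b q₃ for quadratic forms q₁, q₂, q₃ ≥ 0 in L and M,
      -- up to multiples of u² − 5 v².
      P-bound : 0≤ ♯ 2 ⊗ W ⊗ S ³ ⊖ ♯ 121 ⊗ v ² ⊗ P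
      P-bound = cancel {♯ 168 ⊗ v ²} 1≤168v² (cancel♯ 3 (by
        ( ♯⁺ {168} *⁺ (u²≥ *⁺ (sq {X} *⁺ (♯⁺ {2} *⁺ 0≤b *⁺ (♯⁺ {360} *⁺ (0≤u *⁺ 0≤v) +⁺ ♯⁺ {573} *⁺ sq {v})
                                       +⁺ ♯⁺ {2} *⁺ 0≤Y *⁺ (♯⁺ {360} *⁺ (0≤u *⁺ 0≤v) +⁺ ♯⁺ {210} *⁺ sq {v}))))
        -- The error 1 in `u²≤` appears here with the factor `480 u² + 522 u v`, which the slack 500
        -- in `W` absorbs.
        +⁺ ♯⁺ {168} *⁺ (0≤X *⁺ sq {X} *⁺ (u²≤ *⁺ (♯⁺ {480} *⁺ sq {u} +⁺ ♯⁺ {522} *⁺ (0≤u *⁺ 0≤v)) +⁺ 4000v²))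
        +⁺ ♯⁺ {672000} *⁺ sq {v} *⁺ S³
        +⁺ ♯⁺ {84} *⁺ 0≤X *⁺ (qa₁ *⁺ sq {L ⊖ M} +⁺ qa₂ *⁺ sq {L} +⁺ qa₃ *⁺ sq {M})
        +⁺ ♯⁺ {2} *⁺ 0≤Y *⁺ (sq {v} *⁺ sq {♯ 84 ⊗ L ⊖ ♯ 95 ⊗ M} +⁺ qY *⁺ sq {M})
        +⁺ ♯⁺ {168} *⁺ 0≤b *⁺ (qb₁ *⁺ sq {L ⊖ M} +⁺ qb₂ *⁺ sq {L} +⁺ qb₃ *⁺ sq {M}))
        refl))
        where
        4000v² : 0≤ ♯ 4000 ⊗ v ² ⊖ ♯ 480 ⊗ u ² ⊖ ♯ 522 ⊗ u ⊗ v
        4000v² = cancel♯ 1 (by (♯⁺ {60} *⁺ (4u≤9v *⁺ (♯⁺ {9} *⁺ 0≤v +⁺ ♯⁺ {4} *⁺ 0≤u)) +⁺ ♯⁺ {261} *⁺ (0≤v *⁺ 4u≤9v) +⁺ ♯⁺ {791} *⁺ sq {v}) refl)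
        S³ : 0≤ S ³ ⊖ X ³
        S³ = by ((0≤Y +⁺ 0≤b) *⁺ (♯⁺ {3} *⁺ sq {X} +⁺ ♯⁺ {3} *⁺ (0≤X *⁺ (0≤Y +⁺ 0≤b)) +⁺ sq {Y ⊕ b})) refl
        qa₁ : 0≤ ♯ 2515 ⊗ v ² ⊖ ♯ 360 ⊗ u ² ⊖ ♯ 252 ⊗ u ⊗ v
        qa₁ = by (♯⁺ {360} *⁺ u²≤ +⁺ ♯⁺ {63} *⁺ (0≤v *⁺ 4u≤9v) +⁺ ♯⁺ {148} *⁺ (4≤v *⁺ (4≤v +⁺ ♯⁺ {8})) +⁺ ♯⁺ {2008}) refl
        qa₂ : 0≤ ♯ 1320 ⊗ u ² ⊕ ♯ 576 ⊗ u ⊗ v ⊖ ♯ 7819 ⊗ v ²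
        qa₂ = cancel♯ 999 (by (♯⁺ {1320000} *⁺ u²≥ +⁺ ♯⁺ {576} *⁺ (0≤v *⁺ 2236v≤1000u) +⁺ ♯⁺ {68936} *⁺ sq {v}) refl)
        qa₃ : 0≤ ♯ 360 ⊗ u ² ⊕ ♯ 542 ⊗ u ⊗ v ⊖ ♯ 2707 ⊗ v ²
        qa₃ = cancel♯ 999 (by (♯⁺ {360000} *⁺ u²≥ +⁺ ♯⁺ {542} *⁺ (0≤v *⁺ 2236v≤1000u) +⁺ ♯⁺ {304912} *⁺ sq {v}) refl)
        qY : 0≤ ♯ 5040 ⊗ u ⊗ v ⊖ ♯ 11041 ⊗ v ²
        qY = cancel♯ 999 (by (♯⁺ {5040} *⁺ (0≤v *⁺ 2236v≤1000u) +⁺ ♯⁺ {228440} *⁺ sq {v}) refl)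
        qb₁ : 0≤ ♯ 817 ⊗ v ² ⊖ ♯ 360 ⊗ u ⊗ v
        qb₁ = by (♯⁺ {90} *⁺ (0≤v *⁺ 4u≤9v) +⁺ ♯⁺ {7} *⁺ sq {v}) refl
        qb₂ : 0≤ ♯ 840 ⊗ u ⊗ v ⊖ ♯ 1819 ⊗ v ²
        qb₂ = cancel♯ 999 (by (♯⁺ {840} *⁺ (0≤v *⁺ 2236v≤1000u) +⁺ ♯⁺ {59240} *⁺ sq {v}) refl)
        qb₃ : 0≤ ♯ 660 ⊗ u ⊗ v ⊖ ♯ 1473 ⊗ v ²
        qb₃ = cancel♯ 999 (by (♯⁺ {660} *⁺ (0≤v *⁺ 2236v≤1000u) +⁺ ♯⁺ {2760} *⁺ sq {v}) refl)

      -- The last three hypotheses bound `Γ = 6 Q − 3 b s` at three values of `b`: by `(6/27) Y³` at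
      -- `b = 0`, by `0.055566 Y³` at `b = 0.37 Y` (this is `star`), and by 0 at `b = 0.58 Y`.
      module _ (4π≤X² : 0≤ X ² ⊖ ♯ 4 ⊗ π) (0≤s : 0≤ s) (27Q≤Y³ : 0≤ Y ³ ⊖ ♯ 27 ⊗ Q)
               (star : 0≤ ♯ 500094 ⊗ Y ³ ⊕ ♯ 9990000 ⊗ Y ⊗ s ⊖ ♯ 54000000 ⊗ Q)
               (100Q≤29Ys : 0≤ ♯ 29 ⊗ Y ⊗ s ⊖ ♯ 100 ⊗ Q) where
        private
          F Γ T : Poly 8
          F = ♯ 6 ⊗ π ⊗ Y ⊕ ♯ 3 ⊗ b ⊗ (♯ 2 ⊗ π ⊕ ♯ 2 ⊗ X ⊗ Y ⊕ Y ²) ⊕ ♯ 6 ⊗ Q ⊖ ♯ 3 ⊗ b ⊗ s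
          Γ = ♯ 6 ⊗ Q ⊖ ♯ 3 ⊗ b ⊗ s
          T = Y ⊕ b

          -- For `b ≥ 0.58 Y` the hypothesis on `Q` gives `6 Q ≤ 3 b s`: the added triples do not
          -- even make up for the lost ones, and `P-bound` suffices. The optimum, with `b / Y` about
          -- 0.69, lies in this range.
          large-b : 0≤ ♯ 50 ⊗ b ⊖ ♯ 29 ⊗ Y → 0≤ W ⊗ S ³ ⊖ ♯ 121 ⊗ v ² ⊗ F
          large-b h = cancel♯ 49 (by
            (♯⁺ {25} *⁺ P-bound
             +⁺ ♯⁺ {121} *⁺ sq {v} *⁺ (♯⁺ {75} *⁺ ((0≤Y +⁺ 0≤b) *⁺ 4π≤X²)
                                       +⁺ ♯⁺ {3} *⁺ (h *⁺ 0≤s) +⁺ ♯⁺ {3} *⁺ 100Q≤29Ys)) refl)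

          module _ (h : 0≤ ♯ 58 ⊗ Y ⊖ ♯ 100 ⊗ b) (1≤Y : 0≤ Y ⊖ ♯ 1) where

            -- Away from the optimum there is room to replace α by the rational 0.4552 below it, so
            -- `u` and `v` disappear. The factor 2 in 0.9104 comes from `2 F ≤ P + 2 Γ`, which uses
            -- `4 π ≤ X²`.
            Goal : Set
            Goal = 0≤ ♯ 9104 ⊗ S ³ ⊖ ♯ 10000 ⊗ P ⊖ ♯ 20000 ⊗ Γ

            -- Γ is linear in b: interpolate between the bounds at b = 0, 37/100 Y and 58/100 Y.
            Γ-small : 0≤ ♯ 37 ⊗ Y ⊖ ♯ 100 ⊗ b → 0≤ (♯ 740000 ⊗ Y ⊖ ♯ 1499906 ⊗ b) ⊗ Y ² ⊖ ♯ 3330000 ⊗ Γ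
            Γ-small k = cancel {Y} 1≤Y (by (♯⁺ {20000} *⁺ (k *⁺ 27Q≤Y³) +⁺ 0≤b *⁺ star) refl)

            Γ-large : 0≤ ♯ 100 ⊗ b ⊖ ♯ 37 ⊗ Y → 0≤ (♯ 58 ⊗ Y ⊖ ♯ 100 ⊗ b) ⊗ ♯ 500094 ⊗ Y ² ⊖ ♯ 189000000 ⊗ Γ
            Γ-large k = cancel {Y} 1≤Y (by (h *⁺ star +⁺ ♯⁺ {540000} *⁺ (k *⁺ 100Q≤29Ys)) refl)

            module _ (52≤ : 0≤ ♯ 52 ⊗ Y ⊖ ♯ 100 ⊗ b) where

              J⁺ : 0≤ ♯ 1694536624 ⊗ T ² ⊖ ♯ 7500000000 ⊗ b ⊗ Y
              J⁺ = cancel♯ 9999 (by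
                (♯⁺ {1694536624} *⁺ (52≤ *⁺ (52≤ +⁺ ♯⁺ {138} *⁺ 0≤Y))
                 +⁺ 0≤Y *⁺ (♯⁺ {1014812192} *⁺ 52≤ +⁺ ♯⁺ {150574160896} *⁺ 0≤Y)) refl)

              -- This is 62500 times the part of `9104 S³ − 10000 P` that is divisible by `X`.
              -- Completing the square near `X = 0.148 T` leaves the form of `J⁺`, which is
              -- nonnegative for `b ≤ 0.52 Y`.
              X-part : 0≤ X ⊗ (♯ 9104 ⊗ (♯ 250 ⊗ X ⊖ ♯ 37 ⊗ T) ² ⊕ ♯ 424000 ⊗ (X ⊗ T)
                               ⊕ (♯ 1694536624 ⊗ T ² ⊖ ♯ 7500000000 ⊗ b ⊗ Y))
              X-part = 0≤X *⁺ (♯⁺ {9104} *⁺ sq {♯ 250 ⊗ X ⊖ ♯ 37 ⊗ T}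
                               +⁺ ♯⁺ {424000} *⁺ (0≤X *⁺ (0≤Y +⁺ 0≤b)) +⁺ J⁺)

              small-b : 0≤ ♯ 37 ⊗ Y ⊖ ♯ 100 ⊗ b → Goal
              small-b k = cancel♯ 41624999999 (by
                (♯⁺ {666000} *⁺ X-part
                 -- By `t³ − 3 a² t + 2 a³ = (t − a)² (t + 2 a)` this replaces `T³` by its tangent
                 -- at `T = 1.366 Y`; with `Γ-small` everything left is linear in `b`. In `medium-b`
                 -- the tangent is taken at `1.415 Y`.
                 +⁺ ♯⁺ {3031632} *⁺ (sq {♯ 500 ⊗ T ⊖ ♯ 683 ⊗ Y} *⁺ (♯⁺ {500} *⁺ (0≤Y +⁺ 0≤b) +⁺ ♯⁺ {1366} *⁺ 0≤Y))
                 +⁺ sq {Y} *⁺ (♯⁺ {11890299280} *⁺ k +⁺ ♯⁺ {4065938253072} *⁺ 0≤Y)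
                 +⁺ ♯⁺ {250000000} *⁺ Γ-small k) refl)

              medium-b : 0≤ ♯ 100 ⊗ b ⊖ ♯ 37 ⊗ Y → Goal
              medium-b k = cancel♯ 75599999999 (by
                (♯⁺ {1209600} *⁺ X-part
                 +⁺ ♯⁺ {86032800} *⁺ (sq {♯ 200 ⊗ T ⊖ ♯ 283 ⊗ Y} *⁺ (♯⁺ {200} *⁺ (0≤Y +⁺ 0≤b) +⁺ ♯⁺ {566} *⁺ 0≤Y))
                 +⁺ sq {Y} *⁺ (♯⁺ {17562484800} *⁺ 52≤ +⁺ ♯⁺ {1312686043200} *⁺ 0≤Y)
                 +⁺ ♯⁺ {8000000} *⁺ Γ-large k) refl)

            -- Tangents of the cubes X³ at 0.43 Y and T³, T² at 1.55 Y leave a form that is linear in b.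
            fairly-large-b : 0≤ ♯ 100 ⊗ b ⊖ ♯ 52 ⊗ Y → Goal
            fairly-large-b k = cancel♯ 113399999999 (by
              (♯⁺ {516196800} *⁺ (sq {♯ 100 ⊗ X ⊖ ♯ 43 ⊗ Y} *⁺ (♯⁺ {200} *⁺ 0≤X +⁺ ♯⁺ {43} *⁺ 0≤Y))
               +⁺ ♯⁺ {129049200000} *⁺ (sq {♯ 20 ⊗ T ⊖ ♯ 31 ⊗ Y} *⁺ (♯⁺ {20} *⁺ (0≤Y +⁺ 0≤b) +⁺ ♯⁺ {62} *⁺ 0≤Y))
               +⁺ ♯⁺ {7742952000000} *⁺ (0≤X *⁺ sq {♯ 20 ⊗ T ⊖ ♯ 31 ⊗ Y})
               +⁺ h *⁺ (♯⁺ {33761448000000} *⁺ sq {X} +⁺ ♯⁺ {12796509600000} *⁺ (0≤X *⁺ 0≤Y) +⁺ ♯⁺ {1024564010400} *⁺ sq {Y})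
               +⁺ k *⁺ (♯⁺ {30000000} *⁺ sq {♯ 1000 ⊗ X ⊖ ♯ 455 ⊗ Y} +⁺ ♯⁺ {713256000000} *⁺ sq {X}
                        +⁺ ♯⁺ {29114400000} *⁺ (0≤X *⁺ 0≤Y) +⁺ ♯⁺ {7184710730400} *⁺ sq {Y})
               +⁺ ♯⁺ {12000000} *⁺ Γ-large (by (k +⁺ ♯⁺ {15} *⁺ 0≤Y) refl)) refl)

            goal : Goal
            goal with total (♯ 52 ⊗ Y) (♯ 100 ⊗ b) | total (♯ 37 ⊗ Y) (♯ 100 ⊗ b)
            ... | inj₂ k | _      = fairly-large-b k
            ... | inj₁ g | inj₁ k = small-b g k
            ... | inj₁ g | inj₂ k = medium-b g k

            -- 6 (5 √5 − 2) / 121 > 0.4552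
            not-large-b : 0≤ W ⊗ S ³ ⊖ ♯ 121 ⊗ v ² ⊗ F
            not-large-b = cancel♯ 19999 (by
              (♯⁺ {121} *⁺ sq {v} *⁺ (goal +⁺ ♯⁺ {30000} *⁺ ((0≤Y +⁺ 0≤b) *⁺ 4π≤X²))
               +⁺ (♯⁺ {600} *⁺ (0≤v *⁺ 2236v≤1000u) +⁺ ♯⁺ {16} *⁺ sq {v} +⁺ ♯⁺ {10000000})
                  *⁺ (((0≤X +⁺ 0≤Y +⁺ 0≤b) *⁺ (0≤X +⁺ 0≤Y +⁺ 0≤b)) *⁺ (0≤X +⁺ 0≤Y +⁺ 0≤b))) refl)

        -- The bounds on `Γ` divide by `Y`, hence the alternative; when `Y` is 0 its second half
        -- holds.
        F-bound : 0≤ Y ⊖ ♯ 1 ⊎ 0≤ ♯ 50 ⊗ b ⊖ ♯ 29 ⊗ Y → 0≤ W ⊗ S ³ ⊖ ♯ 121 ⊗ v ² ⊗ F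
        F-bound (inj₂ h) = large-b h
        F-bound (inj₁ 1≤Y) with total (♯ 50 ⊗ b) (♯ 29 ⊗ Y)
        ... | inj₁ h = large-b h
        ... | inj₂ h = not-large-b (by (h +⁺ h) refl) 1≤Y

-- Weighted sums over a sparse triple system.

module WeightedTriples where

  open FiniteSums
  open import Data.Bool using (Bool; true; false; if_then_else_)
  open import Data.List using (List; []; _∷_)
  open import Data.List.Membership.Propositional using (_∈_)
  open import Data.List.Relation.Unary.All as All using ([]; _∷_)
  open import Data.List.Relation.Unary.Any using (here; there)
  open import Data.Nat
  open import Data.Nat.Properties
  open import Data.Nat.Tactic.RingSolver using (solve-∀)
  open import Data.Product using (_×_; _,_; proj₁; proj₂)
  open import Data.Sum using (_⊎_; inj₁; inj₂)
  open import Function using (_∘_)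
  open import Relation.Binary.PropositionalEquality
  open import Relation.Binary.Definitions using (DecidableEquality)
  open import Relation.Nullary using (¬_; Dec; yes; no; does; contradiction)
  open import Relation.Nullary.Decidable using (_×-dec_; _⊎-dec_)

  -- Functions with value 0 at 0 are given by their increments `h`, so that they can be summed layer
  -- by layer: increments 1 give m, increments 1 + 2 j give m².
  partialSum : (ℕ → ℕ) → ℕ → ℕ
  partialSum h zero    = 0
  partialSum h (suc k) = h 0 + partialSum (h ∘ suc) k

  -- Splits off the bottom layer; `1 ⊓ k` records whether it is present.
  partialSum-pred : ∀ h k → partialSum h k ≡ h 0 * (1 ⊓ k) + partialSum (h ∘ suc) (pred k)
  partialSum-pred h zero    = sym (trans (+-identityʳ (h 0 * 0)) (*-zeroʳ (h 0)))
  partialSum-pred h (suc k) = cong (_+ partialSum (h ∘ suc) k) (sym (*-identityʳ (h 0)))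

  partialSum-1 : ∀ k → partialSum (λ _ → 1) k ≡ k
  partialSum-1 zero    = refl
  partialSum-1 (suc k) = cong suc (partialSum-1 k)

  partialSum-odd : ∀ k → partialSum (λ j → 1 + 2 * j) k ≡ k * k
  partialSum-odd k = trans (go 0 k) (+-identityʳ (k * k))
    where
    lemma : ∀ j k → 1 + 2 * j + (k * k + 2 * (suc j * k)) ≡ suc k * suc k + 2 * (j * suc k)
    lemma = solve-∀
    go : ∀ j k → partialSum (λ i → 1 + 2 * (j + i)) k ≡ k * k + 2 * (j * k)
    go j zero    = sym (cong (2 *_) (*-zeroʳ j))
    go j (suc k) = trans
      (cong₂ _+_ (cong (λ i → 1 + 2 * i) (+-identityʳ j))
        (trans (cong-partialSum k (λ i → cong (λ l → 1 + 2 * l) (+-suc j i))) (go (suc j) k)))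
      (lemma j k)
      where
      cong-partialSum : ∀ {g h} k → (∀ i → g i ≡ h i) → partialSum g k ≡ partialSum h k
      cong-partialSum zero    eq = refl
      cong-partialSum (suc k) eq = cong₂ _+_ (eq 0) (cong-partialSum k (eq ∘ suc))

  pred-⊓ : ∀ m n → pred (m ⊓ n) ≡ pred m ⊓ pred n
  pred-⊓ zero    n       = refl
  pred-⊓ (suc m) zero    = sym (⊓-zeroʳ m)
  pred-⊓ (suc m) (suc n) = refl

  module _ {V : Set} where

    Triple : Set
    Triple = V × V × V

    minₜ prodₜ : (V → ℕ) → Triple → ℕ
    minₜ  y (i , j , k) = y i ⊓ y j ⊓ y k
    prodₜ y (i , j , k) = y i * y j * y k

    Distinct : Triple → Set
    Distinct (i , j , k) = i ≢ j × i ≢ k × j ≢ k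

    _∈ₜ_ : V → Triple → Set
    v ∈ₜ (i , j , k) = v ≡ i ⊎ v ≡ j ⊎ v ≡ k

    -- Any v ≥ 2 vertices, at most n, span at most v − 2 edges; c is the characteristic function up to 1 ⊓ c.
    Sparse : ℕ → List V → List Triple → Set
    Sparse n vs es = ∀ (c : V → ℕ) → 2 ≤ ∑ vs (λ v → 1 ⊓ c v) → ∑ vs (λ v → 1 ⊓ c v) ≤ n →
                     ∑ es (λ e → 1 ⊓ minₜ c e) + 2 ≤ ∑ vs (λ v → 1 ⊓ c v)

    -- Summing e(S) ≤ |S| − 2 over the level sets S of y bounds the total of the smallest weights of the edges.
    module LayerCake {n} (a₁ a₂ : V) (rest : List V) (es : List Triple)
      (es⊆vs : ∀ {e} → e ∈ es → ∀ {v} → v ∈ₜ e → v ∈ a₁ ∷ a₂ ∷ rest)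
      (distinct : ∀ {e} → e ∈ es → Distinct e)
      (sparse : Sparse n (a₁ ∷ a₂ ∷ rest) es) where

      private
        vs : List V
        vs = a₁ ∷ a₂ ∷ rest

      record Ordered (y : V → ℕ) : Set where
        field
          y₂≤y₁ : y a₂ ≤ y a₁
          y≤y₂  : ∀ {v} → v ∈ rest → y v ≤ y a₂
          total : ∑ vs y ≤ n

        y≤y₁ : ∀ {v} → v ∈ vs → y v ≤ y a₁
        y≤y₁ (here refl)         = ≤-refl
        y≤y₁ (there (here refl)) = y₂≤y₁
        y≤y₁ (there (there v∈))  = ≤-trans (y≤y₂ v∈) y₂≤y₁

        one-below-y₂ : ∀ {u v} → u ∈ vs → v ∈ vs → u ≢ v → y u ≤ y a₂ ⊎ y v ≤ y a₂
        one-below-y₂ (here refl)         (here refl)         u≢v = contradiction refl u≢v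
        one-below-y₂ (here refl)         (there (here refl)) u≢v = inj₂ ≤-refl
        one-below-y₂ (here refl)         (there (there v∈))  u≢v = inj₂ (y≤y₂ v∈)
        one-below-y₂ (there (here refl)) v∈                  u≢v = inj₁ ≤-refl
        one-below-y₂ (there (there u∈))  v∈                  u≢v = inj₁ (y≤y₂ u∈)

        min≤y₂ : ∀ {e} → e ∈ es → minₜ y e ≤ y a₂
        min≤y₂ {e@(i , j , k)} e∈ with one-below-y₂ (es⊆vs e∈ (inj₁ refl)) (es⊆vs e∈ (inj₂ (inj₁ refl))) (proj₁ (distinct e∈))
        ... | inj₁ le = ≤-trans (≤-trans (m⊓n≤m (y i ⊓ y j) (y k)) (m⊓n≤m (y i) (y j))) le
        ... | inj₂ le = ≤-trans (≤-trans (m⊓n≤m (y i ⊓ y j) (y k)) (m⊓n≤n (y i) (y j))) le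

        -- If `y a₂` is positive, the support of `y` has at least two and at most `n` elements, and
        -- the 2 gained by sparsity accounts for `a₁` and `a₂`. If `y a₂` is 0, no edge lies in the
        -- support, since every edge contains a vertex other than `a₁`.
        layer : ∑ es (λ e → 1 ⊓ minₜ y e) + (1 ⊓ y a₁) + (1 ⊓ y a₂) ≤ ∑ vs (λ v → 1 ⊓ y v)
        layer with y a₂ in eq₂ | y a₁ in eq₁ | y₂≤y₁
        ... | suc q | suc p | _ = ≤-trans (≤-reflexive (+-assoc _ 1 1)) (subst (∑ es (λ e → 1 ⊓ minₜ y e) + 2 ≤_) count
                (sparse y (subst (2 ≤_) (sym count) (s≤s (s≤s z≤n)))
                  (≤-trans (∑-mono vs {λ v → 1 ⊓ y v} {y} (λ {v} _ → m⊓n≤n 1 (y v))) total)))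
          where
          count : ∑ vs (λ v → 1 ⊓ y v) ≡ 1 + (1 + ∑ rest (λ v → 1 ⊓ y v))
          count = cong₂ (λ s t → 1 ⊓ s + (1 ⊓ t + ∑ rest (λ v → 1 ⊓ y v))) eq₁ eq₂
        ... | zero | p | _ = ≤-trans (≤-reflexive (+-identityʳ _)) (≤-trans (+-monoˡ-≤ (1 ⊓ p) (≤-reflexive none))
                (m≤m+n (1 ⊓ p) _))
          where
          none : ∑ es (λ e → 1 ⊓ minₜ y e) ≡ 0
          none = n≤0⇒n≡0 (≤-trans (∑-mono es {g = λ _ → 0} λ {e} e∈ →
            ≤-trans (m⊓n≤n 1 (minₜ y e)) (subst (minₜ y e ≤_) eq₂ (min≤y₂ e∈))) (≤-reflexive (∑-zero es)))

      open Ordered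

      pred-Ordered : ∀ {y} → Ordered y → Ordered (pred ∘ y)
      pred-Ordered {y} o = record
        { y₂≤y₁ = pred-mono-≤ (y₂≤y₁ o)
        ; y≤y₂  = pred-mono-≤ ∘ y≤y₂ o
        ; total = ≤-trans (∑-mono vs {pred ∘ y} {y} (λ _ → pred[n]≤n)) (total o)
        }

      -- Induction on the largest weight: the bottom layer contributes `h 0` times the inequality
      -- `layer`, and what remains is the claim for `pred ∘ y` with shifted increments.
      layer-cake : ∀ h y → Ordered y →
        ∑ es (partialSum h ∘ minₜ y) + partialSum h (y a₁) + partialSum h (y a₂) ≤ ∑ vs (partialSum h ∘ y)
      layer-cake h y o = go (y a₁) h y o ≤-refl
        where
        shuffle : ∀ h a b c x y z → h * a + x + (h * b + y) + (h * c + z) ≡ h * (a + b + c) + (x + y + z)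
        shuffle = solve-∀
        go : ∀ k h y → Ordered y → y a₁ ≤ k →
          ∑ es (partialSum h ∘ minₜ y) + partialSum h (y a₁) + partialSum h (y a₂) ≤ ∑ vs (partialSum h ∘ y)
        go zero h y o y₁≤0 = ≤-trans (≤-reflexive (cong₂ _+_ (cong₂ _+_ none (zeroes (y≤y₁ o (here refl)))) (zeroes (y₂≤y₁ o)))) z≤n
          where
          zeroes : ∀ {m} → m ≤ y a₁ → partialSum h m ≡ 0
          zeroes m≤ = cong (partialSum h) (n≤0⇒n≡0 (≤-trans m≤ y₁≤0))
          none : ∑ es (partialSum h ∘ minₜ y) ≡ 0
          none = n≤0⇒n≡0 (≤-trans (∑-mono es {g = λ _ → 0} (λ e∈ → ≤-reflexive (zeroes (≤-trans (min≤y₂ o e∈) (y₂≤y₁ o)))))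
            (≤-reflexive (∑-zero es)))
        go (suc k) h y o y₁≤ = begin
          ∑ es (H ∘ minₜ y) + H (y a₁) + H (y a₂)
            ≡⟨ cong₂ _+_ (cong₂ _+_ split-es (partialSum-pred h (y a₁))) (partialSum-pred h (y a₂)) ⟩
          h 0 * ∑ es (λ e → 1 ⊓ minₜ y e) + ∑ es (H′ ∘ minₜ (pred ∘ y)) + (h 0 * (1 ⊓ y a₁) + H′ (pred (y a₁))) + (h 0 * (1 ⊓ y a₂) + H′ (pred (y a₂)))
            ≡⟨ shuffle (h 0) _ _ _ _ _ _ ⟩
          h 0 * (∑ es (λ e → 1 ⊓ minₜ y e) + (1 ⊓ y a₁) + (1 ⊓ y a₂)) + (∑ es (H′ ∘ minₜ (pred ∘ y)) + H′ (pred (y a₁)) + H′ (pred (y a₂)))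
            ≤⟨ +-mono-≤ (*-monoʳ-≤ (h 0) (layer o)) (go k (h ∘ suc) (pred ∘ y) (pred-Ordered o) (pred-mono-≤ y₁≤)) ⟩
          h 0 * ∑ vs (λ v → 1 ⊓ y v) + ∑ vs (H′ ∘ pred ∘ y)
            ≡⟨ cong (_+ ∑ vs (H′ ∘ pred ∘ y)) (∑-*ˡ vs (h 0) (λ v → 1 ⊓ y v)) ⟨
          ∑ vs (λ v → h 0 * (1 ⊓ y v)) + ∑ vs (H′ ∘ pred ∘ y)
            ≡⟨ ∑-+ vs (λ v → h 0 * (1 ⊓ y v)) (H′ ∘ pred ∘ y) ⟨
          ∑ vs (λ v → h 0 * (1 ⊓ y v) + H′ (pred (y v)))
            ≡⟨ ∑-cong vs (λ v → partialSum-pred h (y v)) ⟨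
          ∑ vs (H ∘ y) ∎
          where
          open ≤-Reasoning
          H = partialSum h
          H′ = partialSum (h ∘ suc)
          pred-min : ∀ e → pred (minₜ y e) ≡ minₜ (pred ∘ y) e
          pred-min (i , j , k) = trans (pred-⊓ (y i ⊓ y j) (y k)) (cong (_⊓ pred (y k)) (pred-⊓ (y i) (y j)))
          split-es : ∑ es (H ∘ minₜ y) ≡ h 0 * ∑ es (λ e → 1 ⊓ minₜ y e) + ∑ es (H′ ∘ minₜ (pred ∘ y))
          split-es = trans (∑-cong es (λ e → trans (partialSum-pred h (minₜ y e)) (cong (λ m → h 0 * (1 ⊓ minₜ y e) + H′ m) (pred-min e))))
            (trans (∑-+ es _ _) (cong (_+ ∑ es (H′ ∘ minₜ (pred ∘ y))) (∑-*ˡ es (h 0) _)))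

  product≤ : ∀ {B} x y z → x * y ≤ B → x * z ≤ B → y * z ≤ B → x * y * z ≤ B * (x ⊓ y ⊓ z)
  product≤ {B} x y z xy xz yz with ⊓-sel (x ⊓ y) z | ⊓-sel x y
  ... | inj₂ eq | _       = subst (λ m → x * y * z ≤ B * m) (sym eq) (*-monoˡ-≤ z xy)
  ... | inj₁ eq | inj₁ e₁ = subst (λ m → x * y * z ≤ B * m) (sym (trans eq e₁))
    (≤-trans (≤-reflexive (trans (*-assoc x y z) (*-comm x (y * z)))) (*-monoˡ-≤ x yz))
  ... | inj₁ eq | inj₂ e₂ = subst (λ m → x * y * z ≤ B * m) (sym (trans eq e₂))
    (≤-trans (≤-reflexive (lemma x y z)) (*-monoˡ-≤ y xz))
    where
    lemma : ∀ x y z → x * y * z ≡ x * z * y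
    lemma = solve-∀

  cauchy-schwarz : ∀ {A : Set} (xs : List A) (g : A → Bool) (f : A → ℕ) →
    let F = λ x → if g x then f x else 0 in
    ∑ xs F * ∑ xs F ≤ ∑ xs (𝟙 ∘ g) * ∑ xs (λ x → F x * F x)
  cauchy-schwarz []       g f = z≤n
  cauchy-schwarz (x ∷ xs) g f with g x
  ... | false = cauchy-schwarz xs g f
  ... | true  = begin
    (a + ∑ xs F) * (a + ∑ xs F)                      ≡⟨ expand a (∑ xs F) ⟩
    a * a + ∑ xs F * ∑ xs F + 2 * (a * ∑ xs F)
      ≤⟨ +-mono-≤ (+-monoʳ-≤ (a * a) (cauchy-schwarz xs g f)) (cross xs) ⟩
    a * a + ∑ xs (𝟙 ∘ g) * ∑ xs F² + (∑ xs (𝟙 ∘ g) * (a * a) + ∑ xs F²)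
      ≡⟨ collect (a * a) (∑ xs (𝟙 ∘ g)) (∑ xs F²) ⟩
    (1 + ∑ xs (𝟙 ∘ g)) * (a * a + ∑ xs F²) ∎
    where
    open ≤-Reasoning
    a = f x
    F = λ x → if g x then f x else 0
    F² = λ x → F x * F x
    expand : ∀ a b → (a + b) * (a + b) ≡ a * a + b * b + 2 * (a * b)
    expand = solve-∀
    collect : ∀ a b c → a + b * c + (b * a + c) ≡ (1 + b) * (a + c)
    collect = solve-∀
    2ab≤a²+b² : ∀ a b → 2 * (a * b) ≤ a * a + b * b
    2ab≤a²+b² zero    b       = z≤n
    2ab≤a²+b² (suc a) zero    = ≤-trans (≤-reflexive (cong (2 *_) (*-zeroʳ a))) z≤n
    2ab≤a²+b² (suc a) (suc b) = ≤-trans (≤-reflexive (e₁ a b)) (≤-trans (+-monoˡ-≤ _ (2ab≤a²+b² a b)) (≤-reflexive (e₂ a b)))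
      where
      e₁ : ∀ a b → 2 * (suc a * suc b) ≡ 2 * (a * b) + (2 * a + 2 * b + 2)
      e₁ = solve-∀
      e₂ : ∀ a b → a * a + b * b + (2 * a + 2 * b + 2) ≡ suc a * suc a + suc b * suc b
      e₂ = solve-∀
    cross : ∀ ys → 2 * (a * ∑ ys F) ≤ ∑ ys (𝟙 ∘ g) * (a * a) + ∑ ys F²
    cross []       = ≤-trans (≤-reflexive (cong (2 *_) (*-zeroʳ a))) z≤n
    cross (y ∷ ys) with g y
    ... | false = cross ys
    ... | true  = begin
      2 * (a * (f y + ∑ ys F))                                        ≡⟨ e₁ a (f y) (∑ ys F) ⟩
      2 * (a * f y) + 2 * (a * ∑ ys F)                                ≤⟨ +-mono-≤ (2ab≤a²+b² a (f y)) (cross ys) ⟩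
      a * a + f y * f y + (∑ ys (𝟙 ∘ g) * (a * a) + ∑ ys F²)          ≡⟨ e₂ (a * a) (f y * f y) (∑ ys (𝟙 ∘ g)) (∑ ys F²) ⟩
      (1 + ∑ ys (𝟙 ∘ g)) * (a * a) + (f y * f y + ∑ ys F²) ∎
      where
      e₁ : ∀ a b c → 2 * (a * (b + c)) ≡ 2 * (a * b) + 2 * (a * c)
      e₁ = solve-∀
      e₂ : ∀ a b c d → a + b + (c * a + d) ≡ (1 + c) * a + (b + d)
      e₂ = solve-∀

  module _ {V : Set} (_≟_ : DecidableEquality V) where

    _∈ₜ?_ : (v : V) (e : Triple) → Dec (v ∈ₜ e)
    v ∈ₜ? (i , j , k) = (v ≟ i) ⊎-dec ((v ≟ j) ⊎-dec (v ≟ k))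

    codegree : List Triple → V → V → ℕ
    codegree es u v = ∑ es (λ e → 𝟙 (does ((u ∈ₜ? e) ×-dec (v ∈ₜ? e))))

    module TopWeights {n} (a₁ a₂ a₃ a₄ : V) (rest : List V) (es : List Triple)
      (es⊆vs : ∀ {e} → e ∈ es → ∀ {v} → v ∈ₜ e → v ∈ a₁ ∷ a₂ ∷ a₃ ∷ a₄ ∷ rest)
      (distinct : ∀ {e} → e ∈ es → Distinct e)
      (sparse : Sparse n (a₁ ∷ a₂ ∷ a₃ ∷ a₄ ∷ rest) es)
      (codegree≤8 : ∀ {u v} → u ≢ v → codegree es u v ≤ 8)
      (a₁≢a₂ : a₁ ≢ a₂) (a₁≢a₃ : a₁ ≢ a₃) (a₂≢a₃ : a₂ ≢ a₃)
      (y : V → ℕ) (total : ∑ (a₁ ∷ a₂ ∷ a₃ ∷ a₄ ∷ rest) y ≤ n)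
      (y₂≤y₁ : y a₂ ≤ y a₁) (y₃≤y₂ : y a₃ ≤ y a₂) (y₄≤y₃ : y a₄ ≤ y a₃)
      (y≤y₄ : ∀ {v} → v ∈ rest → y v ≤ y a₄) where

      private
        vs : List V
        vs = a₁ ∷ a₂ ∷ a₃ ∷ a₄ ∷ rest

      open LayerCake a₁ a₂ (a₃ ∷ a₄ ∷ rest) es es⊆vs distinct sparse

      p q w : ℕ
      p = y a₁
      q = y a₂
      w = y a₄

      w≤q : w ≤ q
      w≤q = ≤-trans y₄≤y₃ y₃≤y₂

      ordered : Ordered y
      ordered = record
        { y₂≤y₁ = y₂≤y₁
        ; y≤y₂  = λ { (here refl) → y₃≤y₂ ; (there (here refl)) → w≤q ; (there (there v∈)) → ≤-trans (y≤y₄ v∈) w≤q }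
        ; total = total
        }

      open Ordered ordered using (one-below-y₂; y≤y₁)

      -- Two vertices of the same triple occur in at most 8 triples, so at most 3 · 8 = 24 triples
      -- are heavy. Of any two vertices of another triple one has weight at most `w`, so their
      -- product is at most `p * w`.
      Heavy : Triple → Set
      Heavy e = (a₁ ∈ₜ e × a₂ ∈ₜ e) ⊎ (a₁ ∈ₜ e × a₃ ∈ₜ e) ⊎ (a₂ ∈ₜ e × a₃ ∈ₜ e)

      heavy? : ∀ e → Dec (Heavy e)
      heavy? e = ((a₁ ∈ₜ? e) ×-dec (a₂ ∈ₜ? e)) ⊎-dec (((a₁ ∈ₜ? e) ×-dec (a₃ ∈ₜ? e)) ⊎-dec ((a₂ ∈ₜ? e) ×-dec (a₃ ∈ₜ? e)))

      heavy : Triple → Bool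
      heavy e = does (heavy? e)

      heavyMin lightMin : Triple → ℕ
      heavyMin e = if heavy e then minₜ y e else 0
      lightMin e = if heavy e then 0 else minₜ y e

      Q Z₁ Z₂ R σ : ℕ
      Q  = ∑ es (prodₜ y)
      Z₁ = ∑ es heavyMin
      Z₂ = ∑ es lightMin
      R  = ∑ (a₃ ∷ a₄ ∷ rest) y
      σ  = ∑ (a₃ ∷ a₄ ∷ rest) (λ v → y v * y v)

      heavies≤24 : ∑ es (𝟙 ∘ heavy) ≤ 24
      heavies≤24 = begin
        ∑ es (𝟙 ∘ heavy)
          ≤⟨ ∑-mono es (λ {e} _ → ∨-≤ ((a₁ ∈ₜ? e) ×-dec (a₂ ∈ₜ? e)) ((a₁ ∈ₜ? e) ×-dec (a₃ ∈ₜ? e)) ((a₂ ∈ₜ? e) ×-dec (a₃ ∈ₜ? e))) ⟩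
        ∑ es (λ e → c a₁ a₂ e + (c a₁ a₃ e + c a₂ a₃ e))
          ≡⟨ trans (∑-+ es (c a₁ a₂) _) (cong (codegree es a₁ a₂ +_) (∑-+ es (c a₁ a₃) (c a₂ a₃))) ⟩
        codegree es a₁ a₂ + (codegree es a₁ a₃ + codegree es a₂ a₃)
          ≤⟨ +-mono-≤ (codegree≤8 a₁≢a₂) (+-mono-≤ (codegree≤8 a₁≢a₃) (codegree≤8 a₂≢a₃)) ⟩
        24 ∎
        where
        open ≤-Reasoning
        c : V → V → Triple → ℕ
        c u v e = 𝟙 (does ((u ∈ₜ? e) ×-dec (v ∈ₜ? e)))
        ∨-≤ : ∀ {P Q R : Set} (p : Dec P) (q : Dec Q) (r : Dec R) →
              𝟙 (does (p ⊎-dec (q ⊎-dec r))) ≤ 𝟙 (does p) + (𝟙 (does q) + 𝟙 (does r))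
        ∨-≤ (yes _) _       _ = s≤s z≤n
        ∨-≤ (no _)  (yes _) _ = s≤s z≤n
        ∨-≤ (no _)  (no _)  r = ≤-refl

      min-split : ∀ e → heavyMin e + lightMin e ≡ minₜ y e
      min-split e with heavy e
      ... | true  = +-identityʳ _
      ... | false = refl

      evaluated : ∀ H h → (∀ m → partialSum h m ≡ H m) → ∑ es (H ∘ minₜ y) + H p + H q ≤ ∑ vs (H ∘ y)
      evaluated H h eq = subst₂ _≤_
        (cong₂ _+_ (cong₂ _+_ (∑-cong es (eq ∘ minₜ y)) (eq p)) (eq q)) (∑-cong vs (eq ∘ y)) (layer-cake h y ordered)

      Z≤R : Z₁ + Z₂ ≤ R
      Z≤R = +-cancelˡ-≤ (p + q) (Z₁ + Z₂) R (begin
        p + q + (Z₁ + Z₂)    ≡⟨ cong (p + q +_) (trans (sym (∑-+ es heavyMin lightMin)) (∑-cong es min-split)) ⟩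
        p + q + ∑ es (minₜ y) ≡⟨ rotate p q (∑ es (minₜ y)) ⟩
        ∑ es (minₜ y) + p + q ≤⟨ evaluated (λ m → m) (λ _ → 1) partialSum-1 ⟩
        p + (q + R)          ≡⟨ +-assoc p q R ⟨
        p + q + R            ∎)
        where
        open ≤-Reasoning
        rotate : ∀ a b c → a + b + c ≡ c + a + b
        rotate = solve-∀

      min²≤σ : ∑ es (λ e → minₜ y e * minₜ y e) ≤ σ
      min²≤σ = +-cancelˡ-≤ (p * p + q * q) _ σ (begin
        p * p + q * q + ∑ es (λ e → minₜ y e * minₜ y e) ≡⟨ rotate (p * p) (q * q) _ ⟩
        ∑ es (λ e → minₜ y e * minₜ y e) + p * p + q * q
          ≤⟨ evaluated (λ m → m * m) (λ j → 1 + 2 * j) partialSum-odd ⟩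
        p * p + (q * q + σ)                              ≡⟨ +-assoc (p * p) (q * q) σ ⟨
        p * p + q * q + σ                                ∎)
        where
        open ≤-Reasoning
        rotate : ∀ a b c → a + b + c ≡ c + a + b
        rotate = solve-∀

      -- Cauchy-Schwarz over the at most 24 heavy triples, whose squared minima sum to at most `σ`
      -- by the layer-cake bound for squares.
      Z₁²≤24σ : Z₁ * Z₁ ≤ 24 * σ
      Z₁²≤24σ = ≤-trans (cauchy-schwarz es heavy (minₜ y))
        (*-mono-≤ heavies≤24 (≤-trans (∑-mono es (λ {e} _ → *-mono-≤ (heavyMin≤ e) (heavyMin≤ e))) min²≤σ))
        where
        heavyMin≤ : ∀ e → heavyMin e ≤ minₜ y e
        heavyMin≤ e with heavy e
        ... | true  = ≤-refl
        ... | false = z≤n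

      2w²≤σ : 2 * (w * w) ≤ σ
      2w²≤σ = ≤-trans (+-monoʳ-≤ (w * w) (≤-reflexive (+-identityʳ (w * w))))
        (+-mono-≤ (*-mono-≤ y₄≤y₃ y₄≤y₃) (m≤m+n (w * w) _))

      prod≤pq : ∀ {e} → e ∈ es → prodₜ y e ≤ p * q * minₜ y e
      prod≤pq {i , j , k} e∈ = product≤ (y i) (y j) (y k) (two i∈ j∈ i≢j) (two i∈ k∈ i≢k) (two j∈ k∈ j≢k)
        where
        i∈ = es⊆vs e∈ (inj₁ refl)
        j∈ = es⊆vs e∈ (inj₂ (inj₁ refl))
        k∈ = es⊆vs e∈ (inj₂ (inj₂ refl))
        i≢j = proj₁ (distinct e∈)
        i≢k = proj₁ (proj₂ (distinct e∈))
        j≢k = proj₂ (proj₂ (distinct e∈))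
        two : ∀ {u v} → u ∈ vs → v ∈ vs → u ≢ v → y u * y v ≤ p * q
        two {u} {v} u∈ v∈ u≢v with one-below-y₂ u∈ v∈ u≢v
        ... | inj₁ le = ≤-trans (*-mono-≤ le (y≤y₁ v∈)) (≤-reflexive (*-comm q p))
        ... | inj₂ le = *-mono-≤ (y≤y₁ u∈) le

      prod≤pw : ∀ {e} → e ∈ es → ¬ Heavy e → prodₜ y e ≤ p * w * minₜ y e
      prod≤pw {e@(i , j , k)} e∈ light = product≤ (y i) (y j) (y k)
        (two (inj₁ refl) (inj₂ (inj₁ refl)) (proj₁ (distinct e∈)))
        (two (inj₁ refl) (inj₂ (inj₂ refl)) (proj₁ (proj₂ (distinct e∈))))
        (two (inj₂ (inj₁ refl)) (inj₂ (inj₂ refl)) (proj₂ (proj₂ (distinct e∈))))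
        where
        two : ∀ {u v} → u ∈ₜ e → v ∈ₜ e → u ≢ v → y u * y v ≤ p * w
        two {u} {v} ue ve u≢v with es⊆vs e∈ ue | es⊆vs e∈ ve
        ... | there (there (there (here refl))) | v∈ = ≤-trans (*-monoʳ-≤ w (y≤y₁ v∈)) (≤-reflexive (*-comm w p))
        ... | there (there (there (there u∈)))  | v∈ = ≤-trans (*-mono-≤ (y≤y₄ u∈) (y≤y₁ v∈)) (≤-reflexive (*-comm w p))
        ... | u∈ | there (there (there (here refl))) = *-monoˡ-≤ w (y≤y₁ u∈)
        ... | u∈ | there (there (there (there v∈)))  = *-mono-≤ (y≤y₁ u∈) (y≤y₄ v∈)
        ... | here refl                 | here refl                 = contradiction refl u≢v
        ... | here refl                 | there (here refl)         = contradiction (inj₁ (ue , ve)) light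
        ... | here refl                 | there (there (here refl)) = contradiction (inj₂ (inj₁ (ue , ve))) light
        ... | there (here refl)         | here refl                 = contradiction (inj₁ (ve , ue)) light
        ... | there (here refl)         | there (here refl)         = contradiction refl u≢v
        ... | there (here refl)         | there (there (here refl)) = contradiction (inj₂ (inj₂ (ue , ve))) light
        ... | there (there (here refl)) | here refl                 = contradiction (inj₂ (inj₁ (ve , ue))) light
        ... | there (there (here refl)) | there (here refl)         = contradiction (inj₂ (inj₂ (ve , ue))) light
        ... | there (there (here refl)) | there (there (here refl)) = contradiction refl u≢v

      Q≤ : Q ≤ p * q * Z₁ + p * w * Z₂
      Q≤ = begin
        Q ≤⟨ ∑-mono es pointwise ⟩
        ∑ es (λ e → p * q * heavyMin e + p * w * lightMin e)  ≡⟨ ∑-+ es _ _ ⟩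
        ∑ es (λ e → p * q * heavyMin e) + ∑ es (λ e → p * w * lightMin e)
          ≡⟨ cong₂ _+_ (∑-*ˡ es (p * q) heavyMin) (∑-*ˡ es (p * w) lightMin) ⟩
        p * q * Z₁ + p * w * Z₂ ∎
        where
        open ≤-Reasoning
        pointwise : ∀ {e} → e ∈ es → prodₜ y e ≤ p * q * heavyMin e + p * w * lightMin e
        pointwise {e} e∈ = either (heavy? e)
          where
          m = minₜ y e
          either : (d : Dec (Heavy e)) → prodₜ y e ≤ p * q * (if does d then m else 0) + p * w * (if does d then 0 else m)
          either (yes _) = ≤-trans (prod≤pq e∈) (m≤m+n _ _)
          either (no ¬h) = ≤-trans (prod≤pw e∈ ¬h) (m≤n+m _ (p * q * 0))

-- The two inequalities for natural weights.

module WeightBounds where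

  open IntegerPolynomials
  open SparseInequality
  open CubicInequality
  open FiniteSums
  open WeightedTriples
  open import Data.Fin using (Fin; _≟_)
  open import Data.Fin.Patterns
  open import Data.List using (List; []; _∷_; length; allFin)
  open import Data.List.Properties using (length-tabulate)
  open import Data.List.Membership.Propositional using (_∈_)
  open import Data.List.Membership.Propositional.Properties using (∈-allFin)
  open import Data.List.Relation.Unary.All as All using (All; []; _∷_)
  open import Data.List.Relation.Unary.AllPairs using (AllPairs; []; _∷_; head; tail)
  open import Data.List.Relation.Unary.Unique.Propositional using (Unique)
  open import Data.List.Relation.Unary.Unique.Propositional.Properties using (allFin⁺)
  open import Data.List.Relation.Binary.Permutation.Propositional using (_↭_; prep; swap; ↭-refl; ↭-sym; ↭-trans; ↭⇒↭ₛ)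
  open import Data.List.Relation.Binary.Permutation.Setoid.Properties using (Unique-resp-↭)
  open import Data.List.Relation.Binary.Permutation.Propositional.Properties using (∈-resp-↭; ↭-length)
  open import Data.Nat hiding (_≟_)
  open import Data.Nat.Properties hiding (_≟_)
  open import Data.Product using (_×_; _,_; ∃-syntax; proj₁; proj₂)
  open import Data.Sum using (_⊎_; inj₁; inj₂)
  open import Data.Vec using ([]; _∷_)
  open import Data.Integer.Tactic.RingSolver using (ring)
  open import Tactic.RingSolver.NonReflective ring using (Ι; _⊕_; _⊗_)
  open import Relation.Binary.PropositionalEquality hiding ([_])

  module _ {V : Set} (y : V → ℕ) where

    Decreasing : List V → Set
    Decreasing = AllPairs (λ u v → y v ≤ y u)

    insert-decreasing : ∀ v {vs} → Decreasing vs → ∃[ ws ] (ws ↭ v ∷ vs × Decreasing ws)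
    insert-decreasing v []             = v ∷ [] , ↭-refl , [] ∷ []
    insert-decreasing v {u ∷ vs} (u≥ ∷ d) with ≤-total (y u) (y v)
    ... | inj₁ u≤v = v ∷ u ∷ vs , ↭-refl , (u≤v ∷ All.map (λ le → ≤-trans le u≤v) u≥) ∷ u≥ ∷ d
    ... | inj₂ v≤u = let ws , ws↭ , dw = insert-decreasing v d in
      u ∷ ws , ↭-trans (prep u ws↭) (swap u v ↭-refl) ,
      All.tabulate (λ x∈ → All.lookup (v≤u ∷ u≥) (∈-resp-↭ ws↭ x∈)) ∷ dw

    sort-decreasing : ∀ vs → ∃[ ws ] (ws ↭ vs × Decreasing ws)
    sort-decreasing []       = [] , ↭-refl , []
    sort-decreasing (v ∷ vs) = let ws , ws↭ , d = sort-decreasing vs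
                                   xs , xs↭ , dx = insert-decreasing v d
                               in xs , ↭-trans xs↭ (prep v ws↭) , dx


  -- The first bound is AM-GM. For the second, `s ≥ p² + q² ≥ 2 p q` reduces `Q − 0.185 Y s` to at
  -- most `p q (R − 0.37 Y)`; if the last factor is positive, AM-GM for three factors with sum
  -- `0.63 Y` gives `(0.21 Y)³`. Multiplied by 54000000 this yields 500094 = 54 · 21³ and 9990000.
  star-bounds : ∀ p q R σ Q → Q ≤ p · q · R → let Y = p + q + R ; s = p · p + q · q + σ in
    27 · Q ≤ Y · Y · Y × 54000000 · Q ≤ 500094 · (Y · Y · Y) + 9990000 · (Y · s)
  star-bounds p q R σ Q Q≤ =
    toℕ (Yₑ ⊗ Yₑ ⊗ Yₑ) (♯ 27 ⊗ Qₑ) cubic ,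
    toℕ (♯ 500094 ⊗ (Yₑ ⊗ Yₑ ⊗ Yₑ) ⊕ ♯ 9990000 ⊗ (Yₑ ⊗ sₑ)) (♯ 54000000 ⊗ Qₑ) star
    where
    open NatPositivity (p ∷ q ∷ R ∷ σ ∷ Q ∷ [])
    pₑ qₑ Rₑ σₑ Qₑ Yₑ sₑ : Poly 5
    pₑ = Ι 0F
    qₑ = Ι 1F
    Rₑ = Ι 2F
    σₑ = Ι 3F
    Qₑ = Ι 4F
    Yₑ = pₑ ⊕ qₑ ⊕ Rₑ
    sₑ = pₑ ⊗ pₑ ⊕ qₑ ⊗ qₑ ⊕ σₑ
    p⁺ = var⁺ 0F
    q⁺ = var⁺ 1F
    R⁺ = var⁺ 2F
    σ⁺ = var⁺ 3F
    Q≤pqR : 0≤ pₑ ⊗ qₑ ⊗ Rₑ ⊖ Qₑ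
    Q≤pqR = fromℕ (pₑ ⊗ qₑ ⊗ Rₑ) Qₑ Q≤
    cubic : 0≤ Yₑ ⊗ Yₑ ⊗ Yₑ ⊖ ♯ 27 ⊗ Qₑ
    cubic = cancel♯ 1 (by
      ((p⁺ +⁺ q⁺ +⁺ R⁺) *⁺ (sq {pₑ ⊖ qₑ} +⁺ sq {qₑ ⊖ Rₑ} +⁺ sq {pₑ ⊖ Rₑ})
       +⁺ ♯⁺ {6} *⁺ (p⁺ *⁺ sq {qₑ ⊖ Rₑ} +⁺ q⁺ *⁺ sq {pₑ ⊖ Rₑ} +⁺ R⁺ *⁺ sq {pₑ ⊖ qₑ})
       +⁺ ♯⁺ {54} *⁺ Q≤pqR) refl)
    r : Poly 5
    r = ♯ 100 ⊗ Rₑ ⊖ ♯ 37 ⊗ Yₑ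
    star : 0≤ ♯ 500094 ⊗ (Yₑ ⊗ Yₑ ⊗ Yₑ) ⊕ ♯ 9990000 ⊗ (Yₑ ⊗ sₑ) ⊖ ♯ 54000000 ⊗ Qₑ
    star with total (♯ 100 ⊗ Rₑ) (♯ 37 ⊗ Yₑ)
    ... | inj₂ r≤0 = by
      (♯⁺ {500094} *⁺ ((p⁺ +⁺ q⁺ +⁺ R⁺) *⁺ (p⁺ +⁺ q⁺ +⁺ R⁺) *⁺ (p⁺ +⁺ q⁺ +⁺ R⁺))
       +⁺ ♯⁺ {9990000} *⁺ ((p⁺ +⁺ q⁺ +⁺ R⁺) *⁺ (σ⁺ +⁺ sq {pₑ ⊖ qₑ}))
       +⁺ ♯⁺ {540000} *⁺ (p⁺ *⁺ q⁺ *⁺ r≤0)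
       +⁺ ♯⁺ {54000000} *⁺ Q≤pqR) refl
    ... | inj₁ 0≤r = by
      ((♯⁺ {100} *⁺ p⁺ +⁺ ♯⁺ {100} *⁺ q⁺ +⁺ 0≤r) *⁺
         (sq {♯ 100 ⊗ pₑ ⊖ ♯ 100 ⊗ qₑ} +⁺ sq {♯ 100 ⊗ qₑ ⊖ r} +⁺ sq {♯ 100 ⊗ pₑ ⊖ r})
       +⁺ ♯⁺ {6} *⁺ (♯⁺ {100} *⁺ p⁺ *⁺ sq {♯ 100 ⊗ qₑ ⊖ r} +⁺ ♯⁺ {100} *⁺ q⁺ *⁺ sq {♯ 100 ⊗ pₑ ⊖ r}
                     +⁺ 0≤r *⁺ sq {♯ 100 ⊗ pₑ ⊖ ♯ 100 ⊗ qₑ})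
       +⁺ ♯⁺ {9990000} *⁺ ((p⁺ +⁺ q⁺ +⁺ R⁺) *⁺ (σ⁺ +⁺ sq {pₑ ⊖ qₑ}))
       +⁺ ♯⁺ {54000000} *⁺ Q≤pqR) refl

  -- The case `p = 0`, where `Q` vanishes, is separate because the polynomial argument divides by
  -- the total weight.
  heavy-bound : ∀ p q w z A σ Q → w ≤ q → q ≤ p → 2 · (w · w) ≤ σ → z · z ≤ 24 · σ →
    Q ≤ p · q · z + p · w · A → 100 · Q ≤ 29 · (z + A + p + q) · (p · p + q · q + σ)
  heavy-bound zero q w z A σ Q _ _ _ _ Q≤ = subst (λ m → 100 · m ≤ _) (sym Q≡0) (≤-trans (≤-reflexive (·≡* 100 0)) z≤n)
    where
    Q≡0 : Q ≡ 0
    Q≡0 = n≤0⇒n≡0 (≤-trans Q≤ (≤-reflexive (cong₂ _+_ (0· q z) (0· w A))))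
      where
      0· : ∀ m n → 0 · m · n ≡ 0
      0· m n = trans (·≡* (0 · m) n) (cong (_* n) (·≡* 0 m))
  heavy-bound p@(suc p′) q w z A σ Q w≤q q≤p 2w²≤σ z²≤24σ Q≤ =
    toℕ (♯ 29 ⊗ Yₑ ⊗ (pₑ ⊗ pₑ ⊕ qₑ ⊗ qₑ ⊕ σₑ)) (♯ 100 ⊗ Qₑ)
      (Q-bound _ (var⁺ 2F) (fromℕ qₑ wₑ w≤q) (fromℕ pₑ qₑ q≤p) (var⁺ 3F) (var⁺ 4F)
        (fromℕ σₑ (♯ 2 ⊗ (wₑ ⊗ wₑ)) 2w²≤σ) (fromℕ (♯ 24 ⊗ σₑ) (zₑ ⊗ zₑ) z²≤24σ)
        (fromℕ (pₑ ⊗ qₑ ⊗ zₑ ⊕ pₑ ⊗ wₑ ⊗ Aₑ) Qₑ Q≤)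
        (fromℕ Yₑ (♯ 1) (≤-trans (s≤s z≤n) (≤-trans (m≤n+m p (z + A)) (m≤m+n _ q)))))
    where
    open NatPositivity (p ∷ q ∷ w ∷ z ∷ A ∷ σ ∷ Q ∷ [])
    pₑ qₑ wₑ zₑ Aₑ σₑ Qₑ Yₑ : Poly 7
    pₑ = Ι 0F
    qₑ = Ι 1F
    wₑ = Ι 2F
    zₑ = Ι 3F
    Aₑ = Ι 4F
    σₑ = Ι 5F
    Qₑ = Ι 6F
    Yₑ = zₑ ⊕ Aₑ ⊕ pₑ ⊕ qₑ

  module _ {T n} (es : List (Triple {Fin T}))
    (distinct : ∀ {e} → e ∈ es → Distinct e)
    (sparse : Sparse n (allFin T) es)
    (codegree≤8 : ∀ {u v} → u ≢ v → codegree _≟_ es u v ≤ 8)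
    (4≤T : 4 ≤ T)
    (y : Fin T → ℕ) (y≤n : ∑ (allFin T) y ≤ n) where

    private
      Y s Q : ℕ
      Y = ∑ (allFin T) y
      s = ∑ (allFin T) (λ v → y v * y v)
      Q = ∑ es (prodₜ y)

      Bounds : Set
      Bounds = 27 · Q ≤ Y · Y · Y × 54000000 · Q ≤ 500094 · (Y · Y · Y) + 9990000 · (Y · s) × 100 · Q ≤ 29 · Y · s

      from-sorted : ∀ vs → 4 ≤ length vs → vs ↭ allFin T → Decreasing y vs → Bounds
      from-sorted (a₁ ∷ a₂ ∷ a₃ ∷ a₄ ∷ rest) _ vs↭ ((y₂≤ ∷ _) ∷ (y₃≤ ∷ _) ∷ (y₄≤ ∷ _) ∷ y≤ ∷ _) =
        subst₂ (λ Y s → 27 · Q ≤ Y · Y · Y × 54000000 · Q ≤ 500094 · (Y · Y · Y) + 9990000 · (Y · s) × 100 · Q ≤ 29 · Y · s)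
          (trans (+-assoc p q R) (∑-↭ y vs↭)) (trans s-eq (∑-↭ (λ v → y v * y v) vs↭))
          (proj₁ stars , proj₂ stars , third)
        where
        unique : Unique (a₁ ∷ a₂ ∷ a₃ ∷ a₄ ∷ rest)
        unique = Unique-resp-↭ (setoid (Fin T)) (↭⇒↭ₛ (↭-sym vs↭)) (allFin⁺ T)
        vs : List (Fin T)
        vs = a₁ ∷ a₂ ∷ a₃ ∷ a₄ ∷ rest
        es⊆vs : ∀ {e} → e ∈ es → ∀ {v} → v ∈ₜ e → v ∈ vs
        es⊆vs _ {v} _ = ∈-resp-↭ (↭-sym vs↭) (∈-allFin v)
        sparse′ : Sparse n vs es
        sparse′ c 2≤ ≤n = subst (∑ es (λ e → 1 ⊓ minₜ c e) + 2 ≤_) (sym (∑-↭ (λ v → 1 ⊓ c v) vs↭))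
          (sparse c (subst (2 ≤_) (∑-↭ (λ v → 1 ⊓ c v) vs↭) 2≤) (subst (_≤ n) (∑-↭ (λ v → 1 ⊓ c v) vs↭) ≤n))
        total≤n : ∑ vs y ≤ n
        total≤n = subst (_≤ n) (sym (∑-↭ y vs↭)) y≤n
        open TopWeights _≟_ a₁ a₂ a₃ a₄ rest es es⊆vs distinct sparse′ codegree≤8
          (All.head (head unique)) (All.head (All.tail (head unique))) (All.head (head (tail unique)))
          y total≤n y₂≤ y₃≤ y₄≤ (All.lookup y≤)
          hiding (Q)
        s-eq : p · p + q · q + σ ≡ p * p + (q * q + σ)
        s-eq = trans (cong₂ (λ a b → a + b + σ) (·≡* p p) (·≡* q q)) (+-assoc (p * p) (q * q) σ)
        -- `Z₂` is enlarged to `R ∸ Z₁`, so that `Z₁ + A` is all the weight outside the two heaviest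
        -- classes.
        A : ℕ
        A = R ∸ Z₁
        Z₁+A≡R : Z₁ + A ≡ R
        Z₁+A≡R = m+[n∸m]≡n (≤-trans (m≤m+n Z₁ Z₂) Z≤R)
        ·≡*₂ : ∀ a b c → a · b · c ≡ a * b * c
        ·≡*₂ a b c = trans (·≡* (a · b) c) (cong (_* c) (·≡* a b))
        Q≤pE : Q ≤ p * q * Z₁ + p * w * A
        Q≤pE = ≤-trans Q≤ (+-monoʳ-≤ (p * q * Z₁) (*-monoʳ-≤ (p * w)
          (≤-trans (≤-reflexive (sym (m+n∸m≡n Z₁ Z₂))) (∸-monoˡ-≤ Z₁ Z≤R))))
        Q≤pqR : Q ≤ p * q * R
        Q≤pqR = ≤-trans Q≤pE (≤-trans (+-monoʳ-≤ (p * q * Z₁) (*-monoˡ-≤ A (*-monoʳ-≤ p w≤q)))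
          (≤-reflexive (trans (sym (*-distribˡ-+ (p * q) Z₁ A)) (cong (p * q *_) Z₁+A≡R))))
        stars = star-bounds p q R σ Q (≤-trans Q≤pqR (≤-reflexive (sym (·≡*₂ p q R))))
        rotate : Z₁ + A + p + q ≡ p + q + R
        rotate = trans (+-assoc (Z₁ + A) p q) (trans (+-comm (Z₁ + A) (p + q)) (cong (p + q +_) Z₁+A≡R))
        third : 100 · Q ≤ 29 · (p + q + R) · (p · p + q · q + σ)
        third = subst (λ Y → 100 · Q ≤ 29 · Y · (p · p + q · q + σ)) rotate
          (heavy-bound p q w Z₁ A σ Q w≤q y₂≤
            (subst (_≤ σ) (sym (trans (·≡* 2 (w · w)) (cong (2 *_) (·≡* w w)))) 2w²≤σ)
            (subst₂ _≤_ (sym (·≡* Z₁ Z₁)) (sym (·≡* 24 σ)) Z₁²≤24σ)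
            (≤-trans Q≤pE (≤-reflexive (sym (cong₂ _+_ (·≡*₂ p q Z₁) (·≡*₂ p w A))))))
      from-sorted []               ()
      from-sorted (_ ∷ [])         (s≤s ())
      from-sorted (_ ∷ _ ∷ [])     (s≤s (s≤s ()))
      from-sorted (_ ∷ _ ∷ _ ∷ []) (s≤s (s≤s (s≤s ())))

    Q-bounds : Bounds
    Q-bounds = let vs , vs↭ , d = sort-decreasing y (allFin T) in
      from-sorted vs (subst (4 ≤_) (sym (trans (↭-length vs↭) (length-tabulate (λ i → i)))) 4≤T) vs↭ d

  -- `81 v² − 16 u² = v² − 16`, which is nonnegative for `v ≥ 4`.
  pell-ratio : ∀ u v → u · u ≡ 5 · (v · v) + 1 → 4 ≤ v → 4 · u ≤ 9 · v
  pell-ratio u v pell 4≤v = toℕ (♯ 9 ⊗ vₑ) (♯ 4 ⊗ uₑ)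
    (cancel {♯ 9 ⊗ vₑ ⊕ ♯ 4 ⊗ uₑ} (by (♯⁺ {9} *⁺ 4≤v⁺ +⁺ ♯⁺ {4} *⁺ var⁺ 0F +⁺ ♯⁺ {35}) refl)
      (by (♯⁺ {16} *⁺ fromℕ (♯ 5 ⊗ (vₑ ⊗ vₑ) ⊕ ♯ 1) (uₑ ⊗ uₑ) (≤-reflexive pell) +⁺ 4≤v⁺ *⁺ (var⁺ 1F +⁺ ♯⁺ {4})) refl))
    where
    open NatPositivity (u ∷ v ∷ [])
    uₑ vₑ : Poly 2
    uₑ = Ι 0F
    vₑ = Ι 1F
    4≤v⁺ : 0≤ vₑ ⊖ ♯ 4
    4≤v⁺ = fromℕ vₑ (♯ 4) 4≤v

  -- `F-bound` for natural numbers, with every subtracted term moved to the other side. `X` becomes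
  -- `x₀ + x₁` and `π` becomes `x₀ · x₁`.
  cubic-bound : ∀ u v x₀ x₁ b Y s Q → u · u ≡ 5 · (v · v) + 1 → 4 ≤ v →
    27 · Q ≤ Y · Y · Y → 54000000 · Q ≤ 500094 · (Y · Y · Y) + 9990000 · (Y · s) → 100 · Q ≤ 29 · Y · s →
    let S = x₀ + x₁ + Y + b in
    12 · (v · v) · (S · S · S)
      + 121 · (v · v) · (6 · (x₀ · x₁) · Y + 3 · b · (2 · (x₀ · x₁) + 2 · (x₀ + x₁) · Y + Y · Y) + 6 · Q)
    ≤ (30 · u · v + 500) · (S · S · S) + 121 · (v · v) · (3 · b · s)
  cubic-bound u v x₀ x₁ b Y s Q pell 4≤v 27Q≤ star 100Q≤ =
    toℕ ((♯ 30 ⊗ uₑ ⊗ vₑ ⊕ ♯ 500) ⊗ (Sₑ ⊗ Sₑ ⊗ Sₑ) ⊕ ♯ 121 ⊗ (vₑ ⊗ vₑ) ⊗ (♯ 3 ⊗ bₑ ⊗ sₑ))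
        (♯ 12 ⊗ (vₑ ⊗ vₑ) ⊗ (Sₑ ⊗ Sₑ ⊗ Sₑ)
          ⊕ ♯ 121 ⊗ (vₑ ⊗ vₑ) ⊗ (♯ 6 ⊗ πₑ ⊗ Yₑ ⊕ ♯ 3 ⊗ bₑ ⊗ (♯ 2 ⊗ πₑ ⊕ ♯ 2 ⊗ Xₑ ⊗ Yₑ ⊕ Yₑ ⊗ Yₑ) ⊕ ♯ 6 ⊗ Qₑ))
        (by (F-bound _ 4≤v⁺ 4u≤9v 2236v≤1000u u²≤ (by (u²≥ +⁺ ♯⁺ {1}) refl)
              (var⁺ 2F) (var⁺ 3F) (var⁺ 4F) 4π≤X² (var⁺ 6F)
              (fromℕ (Yₑ ⊗ Yₑ ⊗ Yₑ) (♯ 27 ⊗ Qₑ) 27Q≤)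
              (by (fromℕ (♯ 500094 ⊗ (Yₑ ⊗ Yₑ ⊗ Yₑ) ⊕ ♯ 9990000 ⊗ (Yₑ ⊗ sₑ)) (♯ 54000000 ⊗ Qₑ) star) refl)
              (fromℕ (♯ 29 ⊗ Yₑ ⊗ sₑ) (♯ 100 ⊗ Qₑ) 100Q≤) (Y-case Y refl)) refl)
    where
    open NatPositivity (u ∷ v ∷ x₀ + x₁ ∷ Y ∷ b ∷ x₀ · x₁ ∷ s ∷ Q ∷ [])
    uₑ vₑ Xₑ Yₑ bₑ πₑ sₑ Qₑ Sₑ : Poly 8
    uₑ = Ι 0F
    vₑ = Ι 1F
    Xₑ = Ι 2F
    Yₑ = Ι 3F
    bₑ = Ι 4F
    πₑ = Ι 5F
    sₑ = Ι 6F
    Qₑ = Ι 7F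
    Sₑ = Xₑ ⊕ Yₑ ⊕ bₑ
    4≤v⁺ : 0≤ vₑ ⊖ ♯ 4
    4≤v⁺ = fromℕ vₑ (♯ 4) 4≤v
    u²≤ : 0≤ ♯ 5 ⊗ (vₑ ⊗ vₑ) ⊕ ♯ 1 ⊖ uₑ ⊗ uₑ
    u²≤ = fromℕ (♯ 5 ⊗ (vₑ ⊗ vₑ) ⊕ ♯ 1) (uₑ ⊗ uₑ) (≤-reflexive pell)
    u²≥ : 0≤ uₑ ⊗ uₑ ⊖ (♯ 5 ⊗ (vₑ ⊗ vₑ) ⊕ ♯ 1)
    u²≥ = fromℕ (uₑ ⊗ uₑ) (♯ 5 ⊗ (vₑ ⊗ vₑ) ⊕ ♯ 1) (≤-reflexive (sym pell))
    4u≤9v : 0≤ ♯ 9 ⊗ vₑ ⊖ ♯ 4 ⊗ uₑ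
    4u≤9v = fromℕ (♯ 9 ⊗ vₑ) (♯ 4 ⊗ uₑ) (pell-ratio u v pell 4≤v)
    2236v≤1000u : 0≤ ♯ 1000 ⊗ uₑ ⊖ ♯ 2236 ⊗ vₑ
    2236v≤1000u = cancel {♯ 1000 ⊗ uₑ ⊕ ♯ 2236 ⊗ vₑ}
      (by (♯⁺ {2236} *⁺ 4≤v⁺ +⁺ ♯⁺ {1000} *⁺ var⁺ 0F +⁺ ♯⁺ {8943}) refl)
      (by (♯⁺ {1000000} *⁺ u²≥ +⁺ ♯⁺ {304} *⁺ sq {vₑ} +⁺ ♯⁺ {1000000}) refl)
    4π≤X² : 0≤ Xₑ ⊗ Xₑ ⊖ ♯ 4 ⊗ πₑ
    4π≤X² = fromℕ (Xₑ ⊗ Xₑ) (♯ 4 ⊗ πₑ)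
      (toℕ₂ ((Ι 0F ⊕ Ι 1F) ⊗ (Ι 0F ⊕ Ι 1F)) (♯ 4 ⊗ (Ι 0F ⊗ Ι 1F)) (by₂ (sq₂ {Ι 0F ⊖ Ι 1F}) refl))
      where
      open NatPositivity (x₀ ∷ x₁ ∷ []) using () renaming (toℕ to toℕ₂; by to by₂; sq to sq₂)
    Y-case : ∀ m → m ≡ Y → 0≤ Yₑ ⊖ ♯ 1 ⊎ 0≤ ♯ 50 ⊗ bₑ ⊖ ♯ 29 ⊗ Yₑ
    Y-case zero    0≡Y = inj₂ (fromℕ (♯ 50 ⊗ bₑ) (♯ 29 ⊗ Yₑ)
      (≤-trans (≤-reflexive (trans (cong (29 ·_) (sym 0≡Y)) (·≡* 29 0))) z≤n))
    Y-case (suc m) eq  = inj₁ (fromℕ Yₑ (♯ 1) (≤-trans (s≤s z≤n) (≤-reflexive eq)))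

-- Sums over increasing pairs and triples.

module SortedTriples where

  open FiniteSums
  open import Data.Bool using (Bool; true; false)
  open import Data.Fin as Fin using (Fin; zero; suc; _<_)
  open import Data.Fin.Subset using (Subset; inside; outside; ∣_∣; _∩_)
  open import Data.List using (List; []; _∷_; _++_; map; length; allFin)
  open import Data.List.Membership.Propositional using (_∈_)
  open import Data.List.Membership.Propositional.Properties using (∈-map⁻; ∈-++⁻)
  open import Data.List.Relation.Unary.All as All using (All; []; _∷_)
  import Data.List.Relation.Unary.All.Properties as All
  open import Data.List.Relation.Unary.Any using (here; there)
  open import Data.List.Relation.Unary.AllPairs using ([]; _∷_)
  open import Data.List.Relation.Unary.Unique.Propositional using (Unique)
  open import Data.List.Relation.Unary.Unique.Propositional.Properties using (allFin⁺; map⁺; ++⁺)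
  open import Data.List.Properties using (length-map; length-++)
  open import Data.Nat as ℕ using (ℕ; zero; suc; _+_; _*_; _≤_; z≤n; s≤s)
  open import Data.Nat.Properties hiding (suc-injective)
  open import Data.Nat.Tactic.RingSolver using (solve-∀)
  open import Data.Product using (_×_; _,_; proj₁; proj₂; ∃-syntax)
  open import Data.Sum using (inj₁; inj₂)
  open import Data.Vec using ([]; _∷_)
  open import Function using (_∘_)
  open import Relation.Binary.PropositionalEquality
  open import Relation.Nullary using (¬_)

  pairs : ∀ n → List (Fin n × Fin n)
  pairs zero    = []
  pairs (suc n) = map (λ j → zero , suc j) (allFin n) ++ map (λ (i , j) → suc i , suc j) (pairs n)

  triples : ∀ n → List (Fin n × Fin n × Fin n)
  triples zero    = []
  triples (suc n) = map (λ (j , k) → zero , suc j , suc k) (pairs n)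
                 ++ map (λ (i , j , k) → suc i , suc j , suc k) (triples n)

  length-pairs : ∀ n → 2 * length (pairs n) + n ≡ n * n
  length-pairs zero    = refl
  length-pairs (suc n) = trans
    (cong (λ l → 2 * l + suc n) (trans (length-++ (map _ (allFin n)))
      (cong₂ _+_ (trans (length-map _ (allFin n)) (length-allFin n)) (length-map _ (pairs n)))))
    (trans (e₁ n (length (pairs n))) (trans (cong (2 * n + 1 +_) (length-pairs n)) (e₂ n)))
    where
    e₁ : ∀ n l → 2 * (n + l) + suc n ≡ 2 * n + 1 + (2 * l + n)
    e₁ = solve-∀
    e₂ : ∀ n → 2 * n + 1 + n * n ≡ suc n * suc n
    e₂ = solve-∀

  length-triples : ∀ n → 6 * length (triples n) + 3 * (n * n) ≡ n * n * n + 2 * n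
  length-triples zero    = refl
  length-triples (suc n) = trans
    (cong (λ l → 6 * l + 3 * (suc n * suc n)) (trans (length-++ (map _ (pairs n)))
      (cong₂ _+_ (length-map _ (pairs n)) (length-map _ (triples n)))))
    (+-cancelʳ-≡ (3 * n) _ _ (trans (e₁ n (length (pairs n)) (length (triples n)))
      (trans (cong₂ (λ a b → 3 * a + b + 6 * n + 3) (length-pairs n) (length-triples n)) (e₂ n))))
    where
    e₁ : ∀ n p t → 6 * (p + t) + 3 * (suc n * suc n) + 3 * n ≡ 3 * (2 * p + n) + (6 * t + 3 * (n * n)) + 6 * n + 3
    e₁ = solve-∀
    e₂ : ∀ n → 3 * (n * n) + (n * n * n + 2 * n) + 6 * n + 3 ≡ suc n * suc n * suc n + 2 * suc n + 3 * n
    e₂ = solve-∀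

  SortedTriple : ∀ {n} → Fin n × Fin n × Fin n → Set
  SortedTriple (i , j , k) = i < j × j < k

  pairs-sorted : ∀ n {e} → e ∈ pairs n → proj₁ e < proj₂ e
  pairs-sorted (suc n) e∈ with ∈-++⁻ (map _ (allFin n)) e∈
  ... | inj₁ m with ∈-map⁻ _ m
  ...   | _ , _ , refl = s≤s z≤n
  pairs-sorted (suc n) e∈ | inj₂ m with ∈-map⁻ _ m
  ...   | _ , e∈′ , refl = s≤s (pairs-sorted n e∈′)

  triples-sorted : ∀ n {e} → e ∈ triples n → SortedTriple e
  triples-sorted (suc n) e∈ with ∈-++⁻ (map _ (pairs n)) e∈
  ... | inj₁ m with ∈-map⁻ _ m
  ...   | _ , e∈′ , refl = s≤s z≤n , s≤s (pairs-sorted n e∈′)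
  triples-sorted (suc n) e∈ | inj₂ m with ∈-map⁻ _ m
  ...   | _ , e∈′ , refl = let i<j , j<k = triples-sorted n e∈′ in s≤s i<j , s≤s j<k

  pairs-unique : ∀ n → Unique (pairs n)
  pairs-unique zero    = []
  pairs-unique (suc n) = ++⁺
    (map⁺ (λ { refl → refl }) (allFin⁺ n))
    (map⁺ (λ { refl → refl }) (pairs-unique n))
    λ (m₁ , m₂) → disjoint (∈-map⁻ _ m₁) (∈-map⁻ _ m₂)
    where
    disjoint : ∀ {e} → ∃[ j ] (j ∈ allFin n × e ≡ (zero , suc j)) →
               ¬ (∃[ f ] (f ∈ pairs n × e ≡ (suc (proj₁ f) , suc (proj₂ f))))
    disjoint (_ , _ , refl) (_ , _ , ())

  triples-unique : ∀ n → Unique (triples n)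
  triples-unique zero    = []
  triples-unique (suc n) = ++⁺
    (map⁺ (λ { refl → refl }) (pairs-unique n))
    (map⁺ (λ { refl → refl }) (triples-unique n))
    λ (m₁ , m₂) → disjoint (∈-map⁻ _ m₁) (∈-map⁻ _ m₂)
    where
    disjoint : ∀ {e} → ∃[ f ] (f ∈ pairs n × e ≡ (zero , suc (proj₁ f) , suc (proj₂ f))) →
               ¬ (∃[ g ] (g ∈ triples n × e ≡ (suc (proj₁ g) , suc (proj₁ (proj₂ g)) , suc (proj₂ (proj₂ g)))))
    disjoint (_ , _ , refl) (_ , _ , ())

  ∑-pairs : ∀ n (f : Fin (suc n) × Fin (suc n) → ℕ) → ∑ (pairs (suc n)) f ≡
            ∑ (allFin n) (λ j → f (zero , suc j)) + ∑ (pairs n) (λ (i , j) → f (suc i , suc j))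
  ∑-pairs n f = trans (∑-++ (map _ (allFin n)) _ f) (cong₂ _+_ (∑-map _ (allFin n) f) (∑-map _ (pairs n) f))

  ∑-triples : ∀ n (f : Fin (suc n) × Fin (suc n) × Fin (suc n) → ℕ) → ∑ (triples (suc n)) f ≡
              ∑ (pairs n) (λ (j , k) → f (zero , suc j , suc k)) + ∑ (triples n) (λ (i , j , k) → f (suc i , suc j , suc k))
  ∑-triples n f = trans (∑-++ (map _ (pairs n)) _ f) (cong₂ _+_ (∑-map _ (pairs n) f) (∑-map _ (triples n) f))

  ∑² : ∀ n → (Fin n × Fin n → ℕ) → ℕ
  ∑² n f = ∑ (allFin n) (λ i → ∑ (allFin n) (λ j → f (i , j)))

  -- Sums over all ordered triples split into products of simple sums; sums over increasing triples
  -- are compared with them in both directions.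
  ∑³ : ∀ n → (Fin n × Fin n × Fin n → ℕ) → ℕ
  ∑³ n f = ∑ (allFin n) (λ i → ∑² n (λ (j , k) → f (i , j , k)))

  ∑²-suc : ∀ n f → ∑² (suc n) f ≡
    f (zero , zero) + ∑ (allFin n) (λ j → f (zero , suc j))
    + (∑ (allFin n) (λ i → f (suc i , zero)) + ∑² n (λ (i , j) → f (suc i , suc j)))
  ∑²-suc n f = trans (∑-allFin n (λ i → ∑ (allFin (suc n)) (λ j → f (i , j))))
    (cong₂ _+_ (∑-allFin n (λ j → f (zero , j)))
      (trans (∑-cong (allFin n) (λ i → ∑-allFin n (λ j → f (suc i , j)))) (∑-+ (allFin n) _ _)))

  ∑³-suc : ∀ n f → ∑³ (suc n) f ≡
    ∑² (suc n) (λ (j , k) → f (zero , j , k))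
    + (∑ (allFin n) (λ i → f (suc i , zero , zero) + ∑ (allFin n) (λ k → f (suc i , zero , suc k)) + ∑ (allFin n) (λ j → f (suc i , suc j , zero)))
       + ∑³ n (λ (i , j , k) → f (suc i , suc j , suc k)))
  ∑³-suc n f = trans (∑-allFin n (λ i → ∑² (suc n) (λ (j , k) → f (i , j , k))))
    (cong (∑² (suc n) (λ (j , k) → f (zero , j , k)) +_)
      (trans (∑-cong (allFin n) (λ i → trans (∑²-suc n (λ (j , k) → f (suc i , j , k)))
        (sym (+-assoc (f (suc i , zero , zero) + ∑ (allFin n) (λ k → f (suc i , zero , suc k))) _ _))))
        (∑-+ (allFin n) _ _)))

  ∑-pairs≤∑² : ∀ n f → ∑ (pairs n) f ≤ ∑² n f
  ∑-pairs≤∑² zero    f = z≤n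
  ∑-pairs≤∑² (suc n) f = begin
    ∑ (pairs (suc n)) f ≡⟨ ∑-pairs n f ⟩
    _ ≤⟨ +-mono-≤ (m≤n+m _ (f (zero , zero))) (≤-trans (∑-pairs≤∑² n _) (m≤n+m _ _)) ⟩
    _ ≡⟨ ∑²-suc n f ⟨
    ∑² (suc n) f ∎
    where open ≤-Reasoning

  ∑-triples≤∑³ : ∀ n f → ∑ (triples n) f ≤ ∑³ n f
  ∑-triples≤∑³ zero    f = z≤n
  ∑-triples≤∑³ (suc n) f = begin
    ∑ (triples (suc n)) f ≡⟨ ∑-triples n f ⟩
    _ ≤⟨ +-mono-≤ (≤-trans (∑-pairs≤∑² n _) (≤-trans (m≤n+m _ (∑ (allFin n) (λ i → f₀ (suc i , zero)))) (≤-trans (m≤n+m _ (f₀ (zero , zero) + ∑ (allFin n) (λ j → f₀ (zero , suc j)))) (≤-reflexive (sym (∑²-suc n f₀))))))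
          (≤-trans (∑-triples≤∑³ n _) (m≤n+m _ (∑ (allFin n) (λ i → f (suc i , zero , zero) + ∑ (allFin n) (λ k → f (suc i , zero , suc k)) + ∑ (allFin n) (λ j → f (suc i , suc j , zero)))))) ⟩
    _ ≡⟨ ∑³-suc n f ⟨
    ∑³ (suc n) f ∎
    where
    open ≤-Reasoning
    f₀ : Fin (suc n) × Fin (suc n) → ℕ
    f₀ (j , k) = f (zero , j , k)

  ∑²≤∑-pairs : ∀ n f → (∀ i j → ¬ i < j → f (i , j) ≡ 0) → ∑² n f ≤ ∑ (pairs n) f
  ∑²≤∑-pairs zero    f off = z≤n
  ∑²≤∑-pairs (suc n) f off = begin
    ∑² (suc n) f ≡⟨ ∑²-suc n f ⟩
    _ ≡⟨ cong₂ (λ a b → a + ∑ (allFin n) (λ j → f (zero , suc j)) + (b + ∑² n (λ (i , j) → f (suc i , suc j))))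
          (off zero zero (λ ())) (trans (∑-cong (allFin n) (λ i → off (suc i) zero (λ ()))) (∑-zero (allFin n))) ⟩
    _ ≤⟨ +-monoʳ-≤ _ (∑²≤∑-pairs n _ (λ i j i≮j → off (suc i) (suc j) (i≮j ∘ ℕ.s≤s⁻¹))) ⟩
    _ ≡⟨ ∑-pairs n f ⟨
    ∑ (pairs (suc n)) f ∎
    where open ≤-Reasoning

  ∑³≤∑-triples : ∀ n f → (∀ e → ¬ SortedTriple e → f e ≡ 0) → ∑³ n f ≤ ∑ (triples n) f
  ∑³≤∑-triples zero    f off = z≤n
  ∑³≤∑-triples (suc n) f off = begin
    ∑³ (suc n) f ≡⟨ ∑³-suc n f ⟩
    _ ≡⟨ cong₂ (λ a b → a + (b + ∑³ n (λ (i , j , k) → f (suc i , suc j , suc k)))) first vanish ⟩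
    _ ≤⟨ +-mono-≤ (∑²≤∑-pairs n _ (λ j k j≮k → off _ (λ (_ , j<k) → j≮k (ℕ.s≤s⁻¹ j<k))))
          (∑³≤∑-triples n _ (λ e unsorted → off _ (λ (i<j , j<k) → unsorted (ℕ.s≤s⁻¹ i<j , ℕ.s≤s⁻¹ j<k)))) ⟩
    _ ≡⟨ ∑-triples n f ⟨
    ∑ (triples (suc n)) f ∎
    where
    open ≤-Reasoning
    zeros : ∀ {A : Set} (xs : List A) {g : A → ℕ} → (∀ x → g x ≡ 0) → ∑ xs g ≡ 0
    zeros xs eq = trans (∑-cong xs eq) (∑-zero xs)
    first : ∑² (suc n) (λ (j , k) → f (zero , j , k)) ≡ ∑² n (λ (j , k) → f (zero , suc j , suc k))
    first = trans (∑²-suc n _) (cong₂ _+_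
      (cong₂ _+_ (off _ (λ { (() , _) })) (zeros (allFin n) (λ k → off _ (λ { (() , _) }))))
      (cong (_+ ∑² n (λ (j , k) → f (zero , suc j , suc k))) (zeros (allFin n) (λ j → off _ (λ { (_ , ()) })))))
    vanish : ∑ (allFin n) (λ i → f (suc i , zero , zero) + ∑ (allFin n) (λ k → f (suc i , zero , suc k)) + ∑ (allFin n) (λ j → f (suc i , suc j , zero))) ≡ 0
    vanish = zeros (allFin n) (λ i → cong₂ _+_ (cong₂ _+_ (off _ (λ { (() , _) })) (zeros (allFin n) (λ k → off _ (λ { (() , _) }))))
      (zeros (allFin n) (λ j → off _ (λ { (_ , ()) }))))

  module _ {A : Set} where

    -- A set of triples is encoded as a `Subset` of the positions in a list of all triples, so that
    -- random subsets can be treated without reference to triples.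
    select : (as : List A) → Subset (length as) → List A
    select []       []            = []
    select (a ∷ as) (inside ∷ x)  = a ∷ select as x
    select (a ∷ as) (outside ∷ x) = select as x

    region : (as : List A) → (A → Bool) → Subset (length as)
    region []       B = []
    region (a ∷ as) B = B a ∷ region as B

    length-select : ∀ as x → length (select as x) ≡ ∣ x ∣
    length-select []       []            = refl
    length-select (a ∷ as) (inside ∷ x)  = cong suc (length-select as x)
    length-select (a ∷ as) (outside ∷ x) = length-select as x

    ∈-select : ∀ as x {e} → e ∈ select as x → e ∈ as
    ∈-select []       []            ()
    ∈-select (a ∷ as) (inside ∷ x)  (here eq)  = here eq
    ∈-select (a ∷ as) (inside ∷ x)  (there e∈) = there (∈-select as x e∈)
    ∈-select (a ∷ as) (outside ∷ x) e∈         = there (∈-select as x e∈)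

    select-unique : ∀ as x → Unique as → Unique (select as x)
    select-unique []       []            u        = u
    select-unique (a ∷ as) (inside ∷ x)  (a∉ ∷ u) = All.tabulate (λ e∈ → All.lookup a∉ (∈-select as x e∈)) ∷ select-unique as x u
    select-unique (a ∷ as) (outside ∷ x) (_ ∷ u)  = select-unique as x u

    ∣region∣ : ∀ as B → ∣ region as B ∣ ≡ ∑ as (𝟙 ∘ B)
    ∣region∣ []       B = refl
    ∣region∣ (a ∷ as) B with B a
    ... | true  = cong suc (∣region∣ as B)
    ... | false = ∣region∣ as B

    ∑-select : ∀ as x B → ∑ (select as x) (𝟙 ∘ B) ≡ ∣ x ∩ region as B ∣
    ∑-select []       []            B = refl
    ∑-select (a ∷ as) (outside ∷ x) B = ∑-select as x B
    ∑-select (a ∷ as) (inside ∷ x)  B with B a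
    ... | true  = cong suc (∑-select as x B)
    ... | false = ∑-select as x B

-- Random subsets and the deletion method.

module RandomSubsets where

  open import Defs using (subsets; _⁽_⁾; ⁽⁾-nonZero)
  open FiniteSums
  open import Data.Empty using (⊥-elim)
  open import Data.Fin using (Fin; zero; suc)
  open import Data.Fin.Subset using (Subset; inside; outside; ∣_∣; _∩_; _⊆_) renaming (_∈_ to _∈ˢ_)
  open import Data.Fin.Subset.Properties using (_⊆?_; drop-∷-⊆; out⊆; s⊆s; p∩q⊆p; p∩q⊆q; ⊆-trans; ⊆-refl; nonempty?; Empty-unique; ∣⊥∣≡0)
  open import Data.List using (List; []; _∷_; map; length)
  open import Data.List.Membership.Propositional using (_∈_)
  open import Data.List.Membership.Propositional.Properties using (∈-filter⁺; ∈-filter⁻)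
  open import Data.List.Relation.Unary.Any using (here; there)
  open import Data.Nat hiding (_/_)
  open import Data.Nat.Properties
  open import Data.Nat.Tactic.RingSolver using (solve-∀)
  open import Data.Product using (_×_; _,_; proj₂; ∃-syntax)
  open import Data.Sum using (inj₁; inj₂)
  open import Data.Vec using ([]; _∷_; here; there)
  open import Function using (_∘_)
  open import Relation.Binary.PropositionalEquality
  open import Relation.Nullary using (¬_; Dec; yes; no; does; contradiction)
  open import Relation.Nullary.Decidable using (_×-dec_)

  𝟙-cong : ∀ {P Q : Set} (p : Dec P) (q : Dec Q) → (P → Q) → (Q → P) → 𝟙 (does p) ≡ 𝟙 (does q)
  𝟙-cong (yes _) (yes _) _ _ = refl
  𝟙-cong (no _)  (no _)  _ _ = refl
  𝟙-cong (yes p) (no ¬q) f _ = contradiction (f p) ¬q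
  𝟙-cong (no ¬p) (yes q) _ g = contradiction (g q) ¬p

  𝟙-yes : ∀ {P : Set} (p : Dec P) → P → 𝟙 (does p) ≡ 1
  𝟙-yes (yes _) _ = refl
  𝟙-yes (no ¬p) p = contradiction p ¬p

  𝟙-no : ∀ {P : Set} (p : Dec P) → ¬ P → 𝟙 (does p) ≡ 0
  𝟙-no (yes p) ¬p = contradiction p ¬p
  𝟙-no (no _)  _  = refl

  binomial : ℕ → ℕ → ℕ
  binomial n       zero    = 1
  binomial zero    (suc k) = 0
  binomial (suc n) (suc k) = binomial n k + binomial n (suc k)

  binomial-! : ∀ n k → k ! * binomial n k ≤ n ^ k
  binomial-! n       zero    = ≤-refl
  binomial-! zero    (suc k) = ≤-trans (≤-reflexive (*-zeroʳ (suc k !))) z≤n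
  binomial-! (suc n) (suc k) = begin
    suc k ! * (binomial n k + binomial n (suc k))                        ≡⟨ e₁ (suc k) (k !) (binomial n k) (binomial n (suc k)) ⟩
    suc k * (k ! * binomial n k) + suc k ! * binomial n (suc k)
      ≤⟨ +-mono-≤ (*-monoʳ-≤ (suc k) (binomial-! n k)) (binomial-! n (suc k)) ⟩
    suc k * n ^ k + n ^ suc k                                            ≤⟨ bernoulli k ⟩
    suc n ^ suc k                                                        ∎
    where
    open ≤-Reasoning
    e₁ : ∀ a b c d → a * b * (c + d) ≡ a * (b * c) + a * b * d
    e₁ = solve-∀
    e₂ : ∀ n k x → suc (suc k) * (n * x) + n * (n * x) + suc k * x ≡ suc n * (suc k * x + n * x)
    e₂ = solve-∀
    bernoulli : ∀ k → suc k * n ^ k + n ^ suc k ≤ suc n ^ suc k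
    bernoulli zero    = ≤-refl
    bernoulli (suc k) = ≤-trans (m≤m+n _ (suc k * n ^ k))
      (≤-trans (≤-reflexive (e₂ n k (n ^ k))) (*-monoʳ-≤ (suc n) (bernoulli k)))

  binomial-^ : ∀ n k → binomial n k ≤ n ^ k
  binomial-^ n k = ≤-trans (m≤n*m (binomial n k) (k !) {{k !≢0}}) (binomial-! n k)

  binomial-2 : ∀ n → 2 * binomial n 2 + n ≡ n * n
  binomial-2 zero    = refl
  binomial-2 (suc n) = trans (cong (λ a → 2 * (a + binomial n 2) + suc n) (binomial-1 n))
    (trans (e₁ n (binomial n 2)) (trans (cong (_+ (2 * n + 1)) (binomial-2 n)) (e₂ n)))
    where
    binomial-1 : ∀ n → binomial n 1 ≡ n
    binomial-1 zero    = refl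
    binomial-1 (suc n) = cong suc (binomial-1 n)
    e₁ : ∀ n b → 2 * (n + b) + suc n ≡ 2 * b + n + (2 * n + 1)
    e₁ = solve-∀
    e₂ : ∀ n → n * n + (2 * n + 1) ≡ suc n * suc n
    e₂ = solve-∀

  binomial-3 : ∀ n → 6 * binomial n 3 + 3 * (n * n) ≡ n * n * n + 2 * n
  binomial-3 zero    = refl
  binomial-3 (suc n) = +-cancelʳ-≡ (3 * n) _ _ (trans (e₁ n (binomial n 2) (binomial n 3))
    (trans (cong₂ (λ a b → 3 * a + b + (6 * n + 3)) (binomial-2 n) (binomial-3 n)) (e₂ n)))
    where
    e₁ : ∀ n a b → 6 * (a + b) + 3 * (suc n * suc n) + 3 * n ≡ 3 * (2 * a + n) + (6 * b + 3 * (n * n)) + (6 * n + 3)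
    e₁ = solve-∀
    e₂ : ∀ n → 3 * (n * n) + (n * n * n + 2 * n) + (6 * n + 3) ≡ suc n * suc n * suc n + 2 * suc n + 3 * n
    e₂ = solve-∀

  ∑-subsets : ∀ m (f : Subset (suc m) → ℕ) →
              ∑ (subsets (suc m)) f ≡ ∑ (subsets m) (f ∘ (outside ∷_)) + ∑ (subsets m) (f ∘ (inside ∷_))
  ∑-subsets m f = trans (∑-++ (map (outside ∷_) (subsets m)) _ f)
    (cong₂ _+_ (∑-map _ (subsets m) f) (∑-map _ (subsets m) f))

  length-⁽⁾ : ∀ {m} (R : Subset m) r → length (R ⁽ r ⁾) ≡ binomial ∣ R ∣ r
  length-⁽⁾ {m} R r = trans (length-filter-𝟙 (test R r) (subsets m)) (go R r)
    where
    test : ∀ {m} (R : Subset m) r (s : Subset m) → Dec (s ⊆ R × ∣ s ∣ ≡ r)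
    test R r s = s ⊆? R ×-dec ∣ s ∣ ≟ r
    zeros : ∀ {m} (R : Subset (suc m)) r (f : Subset m → Subset (suc m)) →
            (∀ s → ¬ (f s ⊆ R × ∣ f s ∣ ≡ r)) → ∑ (subsets m) (λ s → 𝟙 (does (test R r (f s)))) ≡ 0
    zeros {m} R′ r f ¬p = trans (∑-cong (subsets m) (λ s → 𝟙-no (test R′ r (f s)) (¬p s))) (∑-zero (subsets m))
    go : ∀ {m} (R : Subset m) r → ∑ (subsets m) (λ s → 𝟙 (does (test R r s))) ≡ binomial ∣ R ∣ r
    go []            zero    = cong (_+ 0) (𝟙-yes (test [] 0 []) ((λ ()) , refl))
    go []            (suc r) = cong (_+ 0) (𝟙-no (test [] (suc r) []) (λ ()))
    go (outside ∷ R) r       = trans (∑-subsets _ (λ s → 𝟙 (does (test (outside ∷ R) r s)))) (trans (cong₂ _+_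
      (trans (∑-cong (subsets _) (λ s → 𝟙-cong (test (outside ∷ R) r (outside ∷ s)) (test R r s)
        (λ (s⊆ , eq) → drop-∷-⊆ s⊆ , eq) (λ (s⊆ , eq) → out⊆ s⊆ , eq))) (go R r))
      (zeros (outside ∷ R) r (inside ∷_) (λ s (s⊆ , _) → contradiction (s⊆ here) λ ())))
      (+-identityʳ _))
    go (inside ∷ R)  zero    = trans (∑-subsets _ (λ s → 𝟙 (does (test (inside ∷ R) 0 s)))) (cong₂ _+_
      (trans (∑-cong (subsets _) (λ s → 𝟙-cong (test (inside ∷ R) 0 (outside ∷ s)) (test R 0 s)
        (λ (s⊆ , eq) → drop-∷-⊆ s⊆ , eq) (λ (s⊆ , eq) → out⊆ s⊆ , eq))) (go R 0))
      (zeros (inside ∷ R) 0 (inside ∷_) (λ s ())))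
    go (inside ∷ R)  (suc r) = trans (∑-subsets _ (λ s → 𝟙 (does (test (inside ∷ R) (suc r) s)))) (trans (cong₂ _+_
      (trans (∑-cong (subsets _) (λ s → 𝟙-cong (test (inside ∷ R) (suc r) (outside ∷ s)) (test R (suc r) s)
        (λ (s⊆ , eq) → drop-∷-⊆ s⊆ , eq) (λ (s⊆ , eq) → out⊆ s⊆ , eq))) (go R (suc r)))
      (trans (∑-cong (subsets _) (λ s → 𝟙-cong (test (inside ∷ R) (suc r) (inside ∷ s)) (test R r s)
        (λ (s⊆ , eq) → drop-∷-⊆ s⊆ , cong pred eq) (λ (s⊆ , eq) → s⊆s s⊆ , cong suc eq))) (go R r)))
      (+-comm _ (binomial ∣ R ∣ r)))

  ∈-subsets : ∀ {m} (s : Subset m) → s ∈ subsets m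
  ∈-subsets []            = here refl
  ∈-subsets (outside ∷ s) = ∈-++⁺ˡ (∈-map⁺ (outside ∷_) (∈-subsets s))
    where open import Data.List.Membership.Propositional.Properties using (∈-++⁺ˡ; ∈-map⁺)
  ∈-subsets (inside ∷ s)  = ∈-++⁺ʳ (map (outside ∷_) (subsets _)) (∈-map⁺ (inside ∷_) (∈-subsets s))
    where open import Data.List.Membership.Propositional.Properties using (∈-++⁺ʳ; ∈-map⁺)

  ∈-⁽⁾⁺ : ∀ {m r} {R s : Subset m} → s ⊆ R → ∣ s ∣ ≡ r → s ∈ R ⁽ r ⁾
  ∈-⁽⁾⁺ {r = r} {R} {s} s⊆R eq = ∈-filter⁺ (λ s → s ⊆? R ×-dec ∣ s ∣ ≟ r) (∈-subsets s) (s⊆R , eq)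

  ∈-⁽⁾⁻ : ∀ {m r} {R s : Subset m} → s ∈ R ⁽ r ⁾ → s ⊆ R × ∣ s ∣ ≡ r
  ∈-⁽⁾⁻ {r = r} {R} s∈ = proj₂ (∈-filter⁻ (λ s → s ⊆? R ×-dec ∣ s ∣ ≟ r) {xs = subsets _} s∈)

  -- Turns an upper bound on the intersection with a region into forbidden subsets, so that all
  -- requirements on the random set have the same form.
  avoid-⁽⁾ : ∀ {m} (x R : Subset m) f → (∀ {F} → F ∈ R ⁽ f ⁾ → ¬ F ⊆ x) → ∣ x ∩ R ∣ < f
  avoid-⁽⁾ x R f avoid with ∣ x ∩ R ∣ <? f
  ... | yes lt = lt
  ... | no ¬lt with (x ∩ R) ⁽ f ⁾ in eq | ⁽⁾-nonZero (x ∩ R) (≮⇒≥ ¬lt)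
  ...   | F ∷ _ | _ with ∈-⁽⁾⁻ {R = x ∩ R} {s = F} (subst (F ∈_) (sym eq) (here refl))
  ...     | F⊆ , ∣F∣≡f = ⊥-elim (avoid (∈-⁽⁾⁺ {R = R} {F} (λ {i} i∈ → p∩q⊆q x R (F⊆ i∈)) ∣F∣≡f) (λ {i} i∈ → p∩q⊆p x R (F⊆ i∈)))

  -- Each point is chosen with weight 1 and left out with weight k: up to the factor (1 + k)ᵐ
  -- this is the expectation for independent choices with probability 1 / (1 + k).
  module Expectation (k : ℕ) .{{_ : NonZero k}} where

    E : ∀ m → (Subset m → ℕ) → ℕ
    E zero    φ = φ []
    E (suc m) φ = E m (φ ∘ (inside ∷_)) + k * E m (φ ∘ (outside ∷_))

    E-cong : ∀ m {φ ψ} → (∀ x → φ x ≡ ψ x) → E m φ ≡ E m ψ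
    E-cong zero    eq = eq []
    E-cong (suc m) eq = cong₂ (λ a b → a + k * b) (E-cong m (eq ∘ (inside ∷_))) (E-cong m (eq ∘ (outside ∷_)))

    E-+ : ∀ m φ ψ → E m (λ x → φ x + ψ x) ≡ E m φ + E m ψ
    E-+ zero    φ ψ = refl
    E-+ (suc m) φ ψ = trans (cong₂ (λ a b → a + k * b) (E-+ m _ _) (E-+ m _ _))
      (lemma k (E m (φ ∘ (inside ∷_))) _ _ _)
      where
      lemma : ∀ k a b c d → a + b + k * (c + d) ≡ a + k * c + (b + k * d)
      lemma = solve-∀

    E-const : ∀ m c → E m (λ _ → c) ≡ suc k ^ m * c
    E-const zero    c = sym (+-identityʳ c)
    E-const (suc m) c = trans (cong₂ (λ a b → a + k * b) (E-const m c) (E-const m c)) (lemma k (suc k ^ m) c)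
      where
      lemma : ∀ k a c → a * c + k * (a * c) ≡ suc k * a * c
      lemma = solve-∀

    E-∑ : ∀ {A : Set} m (xs : List A) (φ : A → Subset m → ℕ) →
          E m (λ x → ∑ xs (λ a → φ a x)) ≡ ∑ xs (λ a → E m (φ a))
    E-∑ m []       φ = trans (E-const m 0) (*-zeroʳ (suc k ^ m))
    E-∑ m (a ∷ xs) φ = trans (E-+ m (φ a) _) (cong (E m (φ a) +_) (E-∑ m xs φ))

    -- Independence: each point of `F` contributes the probability `1 / (1 + k)`, and the total
    -- weight is `(1 + k)ᵐ`.
    E-⊆ : ∀ {m} (F : Subset m) → suc k ^ ∣ F ∣ * E m (λ x → 𝟙 (does (F ⊆? x))) ≡ suc k ^ m
    E-⊆ {zero}  []            = trans (+-identityʳ _) (𝟙-yes ([] ⊆? []) (λ ()))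
    E-⊆ {suc m} (inside ∷ F)  = trans (cong (suc k * suc k ^ ∣ F ∣ *_) (cong₂ (λ a b → a + k * b)
      (E-cong m (λ x → 𝟙-cong ((inside ∷ F) ⊆? (inside ∷ x)) (F ⊆? x) (λ s⊆ → drop-∷-⊆ s⊆) (λ s⊆ → s⊆s s⊆)))
      (trans (E-cong m (λ x → 𝟙-no ((inside ∷ F) ⊆? (outside ∷ x)) (λ F⊆ → contradiction (F⊆ here) λ ())))
             (trans (E-const m 0) (*-zeroʳ (suc k ^ m))))))
      (trans (lemma (suc k) (suc k ^ ∣ F ∣) _ k) (cong (suc k *_) (E-⊆ F)))
      where
      lemma : ∀ M a e k → M * a * (e + k * 0) ≡ M * (a * e)
      lemma = solve-∀
    E-⊆ {suc m} (outside ∷ F) = trans (cong (suc k ^ ∣ F ∣ *_) (cong₂ (λ a b → a + k * b) (same {inside}) (same {outside})))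
      (trans (lemma (suc k ^ ∣ F ∣) _ k) (cong (suc k *_) (E-⊆ F)))
      where
      same : ∀ {b} → E m (λ x → 𝟙 (does ((outside ∷ F) ⊆? (b ∷ x)))) ≡ E m (λ x → 𝟙 (does (F ⊆? x)))
      same {b} = E-cong m (λ x → 𝟙-cong ((outside ∷ F) ⊆? (b ∷ x)) (F ⊆? x) (λ s⊆ → drop-∷-⊆ s⊆) (λ s⊆ → out⊆ s⊆))
      lemma : ∀ a e k → a * (e + k * e) ≡ suc k * (a * e)
      lemma = solve-∀

    E-size : ∀ m → suc k * E m ∣_∣ ≡ m * suc k ^ m
    E-size zero    = *-zeroʳ (suc k)
    E-size (suc m) = trans (cong (λ a → suc k * (a + k * E m ∣_∣))
        (trans (E-+ m (λ _ → 1) ∣_∣) (cong (_+ E m ∣_∣) (trans (E-const m 1) (*-identityʳ _)))))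
      (trans (lemma (suc k ^ m) (E m ∣_∣) k) (trans (cong (λ a → suc k * (suc k ^ m + a)) (E-size m)) (lemma₂ (suc k) m (suc k ^ m))))
      where
      lemma : ∀ a e k → suc k * (a + e + k * e) ≡ suc k * (a + suc k * e)
      lemma = solve-∀
      lemma₂ : ∀ M m a → M * (a + m * a) ≡ suc m * (M * a)
      lemma₂ = solve-∀

    -- Conditional expectations: the points are decided one after another, always keeping a branch
    -- on which the inequality between the expectations persists.
    E-≤⇒∃ : ∀ m {φ ψ} → E m φ ≤ E m ψ → ∃[ x ] φ x ≤ ψ x
    E-≤⇒∃ zero    le = [] , le
    E-≤⇒∃ (suc m) {φ} {ψ} le with ≤-total (E m (φ ∘ (inside ∷_))) (E m (ψ ∘ (inside ∷_)))
    ... | inj₁ le₁ = let x , φ≤ψ = E-≤⇒∃ m le₁ in inside ∷ x , φ≤ψ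
    ... | inj₂ ge₁ = let x , φ≤ψ = E-≤⇒∃ m (*-cancelˡ-≤ k (+-cancelˡ-≤ _ _ _ (≤-trans le (+-monoˡ-≤ _ ge₁)))) in
                     outside ∷ x , φ≤ψ

  remove : ∀ {m} → Subset m → Fin m → Subset m
  remove (_ ∷ p) zero    = outside ∷ p
  remove (b ∷ p) (suc i) = b ∷ remove p i

  remove-⊆ : ∀ {m} (p : Subset m) i → remove p i ⊆ p
  remove-⊆ (_ ∷ p) zero    (there j∈) = there j∈
  remove-⊆ (_ ∷ p) (suc i) here       = here
  remove-⊆ (_ ∷ p) (suc i) (there j∈) = there (remove-⊆ p i j∈)

  remove-∉ : ∀ {m} (p : Subset m) i → ¬ i ∈ˢ remove p i
  remove-∉ (_ ∷ p) (suc i) (there i∈) = remove-∉ p i i∈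

  ∣remove∣ : ∀ {m} (p : Subset m) i → ∣ p ∣ ≤ suc ∣ remove p i ∣
  ∣remove∣ (inside ∷ p)  zero    = ≤-refl
  ∣remove∣ (outside ∷ p) zero    = n≤1+n ∣ p ∣
  ∣remove∣ (inside ∷ p)  (suc i) = s≤s (∣remove∣ p i)
  ∣remove∣ (outside ∷ p) (suc i) = ∣remove∣ p i

  -- One point is removed for each forbidden set that is still contained in the current set; such a
  -- set is also contained in `x`, so the loss is at most the number of forbidden sets inside `x`.
  delete : ∀ {m} (B : List (Subset m)) (x : Subset m) → (∀ {F} → F ∈ B → 0 < ∣ F ∣) →
    ∃[ x′ ] ((∀ {F} → F ∈ B → ¬ F ⊆ x′) × x′ ⊆ x × ∣ x ∣ ≤ ∣ x′ ∣ + ∑ B (λ F → 𝟙 (does (F ⊆? x))))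
  delete []      x _ = x , (λ ()) , ⊆-refl , ≤-reflexive (sym (+-identityʳ ∣ x ∣))
  delete {m} (F ∷ B) x 0<∣B∣ with delete B x (0<∣B∣ ∘ there)
  ... | x′ , avoid , x′⊆x , large with F ⊆? x′
  ...   | no F⊈x′ = x′ , (λ { (here refl) → F⊈x′ ; (there F∈) → avoid F∈ }) , x′⊆x ,
                    ≤-trans large (+-monoʳ-≤ ∣ x′ ∣ (m≤n+m _ (𝟙 (does (F ⊆? x)))))
  ...   | yes F⊆x′ with nonempty? F
  ...     | no empty = contradiction (0<∣B∣ (here refl)) (≤⇒≯ (≤-reflexive (trans (cong ∣_∣ (Empty-unique empty)) (∣⊥∣≡0 m))))
  ...     | yes (i , i∈F) = remove x′ i ,
      (λ { (here refl) F⊆ → remove-∉ x′ i (F⊆ i∈F) ; (there G∈) G⊆ → avoid G∈ (⊆-trans G⊆ (remove-⊆ x′ i)) }) ,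
      ⊆-trans (remove-⊆ x′ i) x′⊆x ,
      ≤-trans large (≤-trans (+-monoˡ-≤ _ (∣remove∣ x′ i))
        (≤-reflexive (trans (sym (+-suc ∣ remove x′ i ∣ _)) (cong (λ b → ∣ remove x′ i ∣ + (b + ∑ B (λ F → 𝟙 (does (F ⊆? x)))))
          (sym (𝟙-yes (F ⊆? x) (λ {i} i∈ → x′⊆x (F⊆x′ i∈))))))))

-- Existence of a large sparse triple system with bounded codegrees.

module SparseTripleSystems where

  open import Defs using (_⁽_⁾)
  open IntegerPolynomials
  open FiniteSums
  open WeightedTriples
  open SortedTriples
  open RandomSubsets
  open import Data.Bool using (Bool; true; false; _∧_)
  open import Data.Fin as Fin using (Fin; zero; suc)
  open import Data.Fin.Patterns
  import Data.Fin.Properties as Fin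
  open import Data.Fin.Subset using (Subset; inside; outside; ∣_∣; _∩_; _⊆_; ⊤)
  open import Data.Fin.Subset.Properties using (_⊆?_; ⊆-max; ∣⊤∣≡n)
  open import Data.List using (List; []; _∷_; _++_; length; allFin; upTo; concatMap)
  open import Data.List.Membership.Propositional using (_∈_; lose)
  open import Data.List.Membership.Propositional.Properties using (∈-concatMap⁺; ∈-concatMap⁻; ∈-++⁺ˡ; ∈-++⁺ʳ; ∈-++⁻; ∈-allFin; ∈-upTo⁺)
  open import Data.List.Relation.Unary.Any as Any using (here; there)
  open import Data.List.Relation.Unary.Unique.Propositional using (Unique)
  open import Data.Nat as ℕ hiding (_/_)
  open import Data.Nat.Properties
  open import Data.Nat.Tactic.RingSolver using (solve-∀)
  open import Data.Product using (_×_; _,_; proj₁; proj₂; ∃-syntax)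
  open import Data.Sum using (inj₁; inj₂)
  open import Data.Vec as Vec using ([]; _∷_; lookup; tabulate)
  open import Data.Vec.Properties using (lookup∘tabulate)
  open import Data.Integer.Tactic.RingSolver using (ring)
  open import Tactic.RingSolver.NonReflective ring using (Ι; _⊕_; _⊗_)
  open import Function using (_∘_)
  open import Relation.Binary.PropositionalEquality
  open import Relation.Binary.Definitions using (tri<; tri≈; tri>)
  open import Relation.Nullary using (¬_; Dec; yes; no; does; contradiction)
  open import Relation.Nullary.Decidable using (_×-dec_)

  ∑-concatMap : ∀ {A B : Set} (g : A → List B) (xs : List A) (f : B → ℕ) → ∑ (concatMap g xs) f ≡ ∑ xs (λ x → ∑ (g x) f)
  ∑-concatMap g []       f = refl
  ∑-concatMap g (x ∷ xs) f = trans (∑-++ (g x) (concatMap g xs) f) (cong (∑ (g x) f +_) (∑-concatMap g xs f))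

  ∑-δ : ∀ {n} (a : Fin n) (f : Fin n → ℕ) → ∑ (allFin n) (λ i → 𝟙 (does (i Fin.≟ a)) * f i) ≡ f a
  ∑-δ {suc n} zero f = trans (∑-allFin n (λ i → 𝟙 (does (i Fin.≟ zero)) * f i))
    (trans (cong₂ _+_ (+-identityʳ (f zero)) (∑-zero (allFin n))) (+-identityʳ (f zero)))
  ∑-δ {suc n} (suc a) f = trans (∑-allFin n (λ i → 𝟙 (does (i Fin.≟ suc a)) * f i)) (∑-δ a (f ∘ suc))

  contains? : ∀ {n} (a b : Fin n) e → Dec (a ∈ₜ e × b ∈ₜ e)
  contains? a b e = _∈ₜ?_ Fin._≟_ a e ×-dec _∈ₜ?_ Fin._≟_ b e

  both? : ∀ {n} (a b : Fin n) e → Dec (a Fin.< b × a ∈ₜ e × b ∈ₜ e)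
  both? a b e = a Fin.<? b ×-dec contains? a b e

  both : ∀ {n} → Fin n → Fin n → Fin n × Fin n × Fin n → Bool
  both a b e = does (both? a b e)

  𝟙≤1 : ∀ b → 𝟙 b ≤ 1
  𝟙≤1 true  = ≤-refl
  𝟙≤1 false = z≤n

  𝟙-≤ : ∀ {P : Set} {n} (d : Dec P) → (P → 1 ≤ n) → 𝟙 (does d) ≤ n
  𝟙-≤ (yes p) f = f p
  𝟙-≤ (no _)  f = z≤n

  -- The third vertex of a sorted triple through a < b lies above b, between a and b, or below a.
  ∑-both≤ : ∀ n (a b : Fin n) → ∑ (triples n) (𝟙 ∘ both a b) ≤ n
  ∑-both≤ n a b with a Fin.<? b
  ... | no a≮b = ≤-trans (≤-reflexive (trans (∑-cong (triples n) (λ e → 𝟙-no (both? a b e) (a≮b ∘ proj₁)))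
                   (∑-zero (triples n)))) z≤n
  ... | yes a<b = begin
    ∑ (triples n) (𝟙 ∘ both a b)   ≤⟨ ∑-mono (triples n) (λ {e} e∈ →
      𝟙-≤ (both? a b e) (split (triples-sorted n e∈) ∘ proj₂)) ⟩
    ∑ (triples n) g                ≤⟨ ∑-triples≤∑³ n g ⟩
    ∑³ n g                         ≡⟨ collapse ⟩
    ∑ (allFin n) (λ c → above c + (between c + below c)) ≤⟨ ∑-mono (allFin n) {g = λ _ → 1} (λ {c} _ → exclusive c) ⟩
    ∑ (allFin n) (λ _ → 1)         ≡⟨ trans (∑-const (allFin n) 1) (trans (*-identityʳ _) (length-allFin n)) ⟩
    n                              ∎
    where
    open ≤-Reasoning
    above between below : Fin n → ℕ
    above c   = 𝟙 (does (b Fin.<? c))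
    between c = 𝟙 (does (a Fin.<? c ×-dec c Fin.<? b))
    below c   = 𝟙 (does (c Fin.<? a))
    g₁ g₂ g₃ g : Fin n × Fin n × Fin n → ℕ
    g₁ (i , j , k) = 𝟙 (does (i Fin.≟ a)) * (𝟙 (does (j Fin.≟ b)) * above k)
    g₂ (i , j , k) = 𝟙 (does (i Fin.≟ a)) * (𝟙 (does (k Fin.≟ b)) * between j)
    g₃ (i , j , k) = 𝟙 (does (j Fin.≟ a)) * (𝟙 (does (k Fin.≟ b)) * below i)
    g e = g₁ e + (g₂ e + g₃ e)
    unit : ∀ {P Q R : Set} (p : Dec P) (q : Dec Q) (r : Dec R) → P → Q → R → 1 ≤ 𝟙 (does p) * (𝟙 (does q) * 𝟙 (does r))
    unit p q r x y z = ≤-reflexive (sym (cong₂ _*_ (𝟙-yes p x) (cong₂ _*_ (𝟙-yes q y) (𝟙-yes r z))))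
    split : ∀ {e} → SortedTriple e → a ∈ₜ e × b ∈ₜ e → 1 ≤ g e
    split {i , j , k} (i<j , j<k) (inj₁ refl , inj₁ refl) = contradiction a<b (Fin.<-irrefl refl)
    split {i , j , k} (i<j , j<k) (inj₁ refl , inj₂ (inj₁ refl)) =
      ≤-trans (unit (i Fin.≟ a) (j Fin.≟ b) (b Fin.<? k) refl refl j<k) (m≤m+n _ _)
    split {i , j , k} (i<j , j<k) (inj₁ refl , inj₂ (inj₂ refl)) =
      ≤-trans (unit (i Fin.≟ a) (k Fin.≟ b) (a Fin.<? j ×-dec j Fin.<? b) refl refl (i<j , j<k)) (≤-trans (m≤m+n _ _) (m≤n+m _ (g₁ (i , j , k))))
    split {i , j , k} (i<j , j<k) (inj₂ (inj₁ refl) , inj₁ refl) = contradiction (Fin.<-trans a<b i<j) (Fin.<-irrefl refl)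
    split {i , j , k} (i<j , j<k) (inj₂ (inj₁ refl) , inj₂ (inj₁ refl)) = contradiction a<b (Fin.<-irrefl refl)
    split {i , j , k} (i<j , j<k) (inj₂ (inj₁ refl) , inj₂ (inj₂ refl)) =
      ≤-trans (unit (j Fin.≟ a) (k Fin.≟ b) (i Fin.<? a) refl refl i<j) (≤-trans (m≤n+m _ (g₂ (i , j , k))) (m≤n+m _ (g₁ (i , j , k))))
    split {i , j , k} (i<j , j<k) (inj₂ (inj₂ refl) , inj₁ refl) = contradiction (Fin.<-trans a<b (Fin.<-trans i<j j<k)) (Fin.<-irrefl refl)
    split {i , j , k} (i<j , j<k) (inj₂ (inj₂ refl) , inj₂ (inj₁ refl)) = contradiction (Fin.<-trans a<b j<k) (Fin.<-irrefl refl)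
    split {i , j , k} (i<j , j<k) (inj₂ (inj₂ refl) , inj₂ (inj₂ refl)) = contradiction a<b (Fin.<-irrefl refl)
    exclusive : ∀ c → above c + (between c + below c) ≤ 1
    exclusive c with c Fin.<? a | b Fin.<? c
    ... | yes c<a | _       = ≤-trans (≤-reflexive (cong₂ _+_ (𝟙-no (b Fin.<? c) (λ b<c → Fin.<-asym c<a (Fin.<-trans a<b b<c)))
                                (cong (_+ below c) (𝟙-no (a Fin.<? c ×-dec c Fin.<? b) (λ (a<c , _) → Fin.<-asym c<a a<c))))) (𝟙≤1 _)
    ... | no c≮a  | yes b<c = ≤-trans (≤-reflexive (trans (cong (above c +_) (cong₂ _+_
                                (𝟙-no (a Fin.<? c ×-dec c Fin.<? b) (λ (_ , c<b) → Fin.<-asym b<c c<b)) (𝟙-no (c Fin.<? a) c≮a)))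
                                (+-identityʳ (above c)))) (𝟙≤1 _)
    ... | no c≮a  | no b≮c  = ≤-trans (≤-reflexive (trans (cong₂ _+_ (𝟙-no (b Fin.<? c) b≮c)
                                (cong (between c +_) (𝟙-no (c Fin.<? a) c≮a))) (+-identityʳ (between c)))) (𝟙≤1 _)
    collapse : ∑³ n g ≡ ∑ (allFin n) (λ c → above c + (between c + below c))
    collapse = trans (∑³-+ g₁ (λ e → g₂ e + g₃ e)) (trans (cong₂ _+_ c₁ (trans (∑³-+ g₂ g₃) (cong₂ _+_ c₂ c₃)))
      (sym (trans (∑-+ (allFin n) above _) (cong (∑ (allFin n) above +_) (∑-+ (allFin n) between below)))))
      where
      ∑³-+ : ∀ f h → ∑³ n (λ e → f e + h e) ≡ ∑³ n f + ∑³ n h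
      ∑³-+ f h = trans (∑-cong (allFin n) (λ i → trans (∑-cong (allFin n) (λ j → ∑-+ (allFin n) _ _)) (∑-+ (allFin n) _ _))) (∑-+ (allFin n) _ _)
      ∑²-*ˡ : ∀ c (f : Fin n × Fin n → ℕ) → ∑² n (λ e → c * f e) ≡ c * ∑² n f
      ∑²-*ˡ c f = trans (∑-cong (allFin n) (λ i → ∑-*ˡ (allFin n) c _)) (∑-*ˡ (allFin n) c _)
      c₁ : ∑³ n g₁ ≡ ∑ (allFin n) above
      c₁ = trans (∑-cong (allFin n) (λ i → ∑²-*ˡ (𝟙 (does (i Fin.≟ a))) (λ (j , k) → 𝟙 (does (j Fin.≟ b)) * above k)))
        (trans (∑-δ a _) (trans (∑-cong (allFin n) (λ j → ∑-*ˡ (allFin n) (𝟙 (does (j Fin.≟ b))) above)) (∑-δ b _)))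
      c₂ : ∑³ n g₂ ≡ ∑ (allFin n) between
      c₂ = trans (∑-cong (allFin n) (λ i → ∑²-*ˡ (𝟙 (does (i Fin.≟ a))) (λ (j , k) → 𝟙 (does (k Fin.≟ b)) * between j)))
        (trans (∑-δ a _) (∑-cong (allFin n) (λ j → ∑-δ b (λ _ → between j))))
      c₃ : ∑³ n g₃ ≡ ∑ (allFin n) below
      c₃ = ∑-cong (allFin n) (λ i → trans (∑-cong (allFin n) (λ j → ∑-*ˡ (allFin n) (𝟙 (does (j Fin.≟ a))) (λ k → 𝟙 (does (k Fin.≟ b)) * below i)))
        (trans (∑-δ a _) (∑-δ b (λ _ → below i))))

  within : ∀ {n} → Subset n → Fin n × Fin n × Fin n → Bool
  within s (i , j , k) = lookup s i ∧ (lookup s j ∧ lookup s k)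

  ∑-lookup : ∀ {n} (s : Subset n) → ∑ (allFin n) (λ i → 𝟙 (lookup s i)) ≡ ∣ s ∣
  ∑-lookup []            = refl
  ∑-lookup (inside ∷ s)  = trans (∑-allFin _ (λ i → 𝟙 (lookup (inside ∷ s) i))) (cong suc (∑-lookup s))
  ∑-lookup (outside ∷ s) = trans (∑-allFin _ (λ i → 𝟙 (lookup (outside ∷ s) i))) (∑-lookup s)

  ∑-within≤ : ∀ n (s : Subset n) → ∑ (triples n) (𝟙 ∘ within s) ≤ ∣ s ∣ ^ 3
  ∑-within≤ n s = ≤-trans (∑-triples≤∑³ n (𝟙 ∘ within s)) (≤-reflexive (begin
    ∑³ n (𝟙 ∘ within s)
      ≡⟨ ∑-cong (allFin n) (λ i → ∑-cong (allFin n) (λ j → trans (∑-cong (allFin n) (λ k →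
           trans (𝟙-∧ (lookup s i) _) (cong (𝟙 (lookup s i) *_) (𝟙-∧ (lookup s j) (lookup s k)))))
           (trans (∑-*ˡ (allFin n) (𝟙 (lookup s i)) _) (cong (𝟙 (lookup s i) *_)
             (trans (∑-*ˡ (allFin n) (𝟙 (lookup s j)) _) (cong (𝟙 (lookup s j) *_) (∑-lookup s))))))) ⟩
    ∑ (allFin n) (λ i → ∑ (allFin n) (λ j → 𝟙 (lookup s i) * (𝟙 (lookup s j) * ∣ s ∣)))
      ≡⟨ ∑-cong (allFin n) (λ i → trans (∑-*ˡ (allFin n) (𝟙 (lookup s i)) _) (cong (𝟙 (lookup s i) *_)
           (trans (∑-*ʳ (allFin n) ∣ s ∣ _) (cong (_* ∣ s ∣) (∑-lookup s))))) ⟩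
    ∑ (allFin n) (λ i → 𝟙 (lookup s i) * (∣ s ∣ * ∣ s ∣))
      ≡⟨ trans (∑-*ʳ (allFin n) (∣ s ∣ * ∣ s ∣) _) (cong (_* (∣ s ∣ * ∣ s ∣)) (∑-lookup s)) ⟩
    ∣ s ∣ * (∣ s ∣ * ∣ s ∣)
      ≡⟨ cong (λ t → ∣ s ∣ * (∣ s ∣ * t)) (*-identityʳ ∣ s ∣) ⟨
    ∣ s ∣ ^ 3 ∎))
    where
    open ≡-Reasoning
    𝟙-∧ : ∀ a b → 𝟙 (a ∧ b) ≡ 𝟙 a * 𝟙 b
    𝟙-∧ true  b = sym (+-identityʳ (𝟙 b))
    𝟙-∧ false b = refl


  -- p = 1/M with M = 5 μ and T = 3 M: the numbers of pair and sparse constraints are x and y up to the factor e.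
  expectation-bound : ∀ K e x y s P → let μ = 2 * K + 3 ; T = 15 * μ in
    18 * x ≤ T * T * e → y ≤ T * K * e → 5 * μ * s ≡ P * e → T * T * T ≤ 6 * P + 3 * (T * T) →
    x + y + 90 * (μ * μ) * e ≤ s
  expectation-bound = unfolded
    where
    opaque-version : ∀ K e x y s P → let μ = 2 · K + 3 ; T = 15 · μ in
      18 · x ≤ T · T · e → y ≤ T · K · e → 5 · μ · s ≡ P · e → T · T · T ≤ 6 · P + 3 · (T · T) →
      x + y + 90 · (μ · μ) · e ≤ s
    opaque-version K e x y s P hx hy hs hP = toℕ sₑ (xₑ ⊕ yₑ ⊕ ♯ 90 ⊗ (μ ⊗ μ) ⊗ eₑ)
      -- Divided by `e`, the expected size is at least T²/2 - 3T/2 = 112.5 μ² - 22.5 μ, and the pair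
      -- constraints cost T²/18 = 12.5 μ². The 10 μ² left above 90 μ² cover 22.5 μ and the cost T K
      -- = 15 μ K of the sparse constraints, because μ = 2 K + 3.
      (cancel {♯ 540 ⊗ μ} (by (♯⁺ {1080} *⁺ var⁺ 0F +⁺ ♯⁺ {1619}) refl) (by
        (♯⁺ {30} *⁺ μ⁺ *⁺ fromℕ (T ⊗ T ⊗ eₑ) (♯ 18 ⊗ xₑ) hx
         +⁺ ♯⁺ {540} *⁺ μ⁺ *⁺ fromℕ (T ⊗ Kₑ ⊗ eₑ) yₑ hy
         +⁺ ♯⁺ {108} *⁺ fromℕ (♯ 5 ⊗ μ ⊗ sₑ) (Pₑ ⊗ eₑ) (≤-reflexive (sym hs))
         +⁺ ♯⁺ {18} *⁺ var⁺ 1F *⁺ fromℕ (♯ 6 ⊗ Pₑ ⊕ ♯ 3 ⊗ (T ⊗ T)) (T ⊗ T ⊗ T) hP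
         +⁺ var⁺ 1F *⁺ (μ⁺ *⁺ μ⁺) *⁺ (♯⁺ {2700} *⁺ var⁺ 0F +⁺ ♯⁺ {4050})) refl))
      where
      open NatPositivity (K ∷ e ∷ x ∷ y ∷ s ∷ P ∷ [])
      Kₑ eₑ xₑ yₑ sₑ Pₑ μ T : Poly 6
      Kₑ = Ι 0F
      eₑ = Ι 1F
      xₑ = Ι 2F
      yₑ = Ι 3F
      sₑ = Ι 4F
      Pₑ = Ι 5F
      μ = ♯ 2 ⊗ Kₑ ⊕ ♯ 3
      T = ♯ 15 ⊗ μ
      μ⁺ : 0≤ μ
      μ⁺ = ♯⁺ {2} *⁺ var⁺ 0F +⁺ ♯⁺ {3}
    opaque
      unfolding _·_
      unfolded : ∀ K e x y s P → let μ = 2 * K + 3 ; T = 15 * μ in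
        18 * x ≤ T * T * e → y ≤ T * K * e → 5 * μ * s ≡ P * e → T * T * T ≤ 6 * P + 3 * (T * T) →
        x + y + 90 * (μ * μ) * e ≤ s
      unfolded = opaque-version

  ^-distrib-* : ∀ a b n → (a * b) ^ n ≡ a ^ n * b ^ n
  ^-distrib-* a b zero    = refl
  ^-distrib-* a b (suc n) = trans (cong (a * b *_) (^-distrib-* a b n)) (lemma a b (a ^ n) (b ^ n))
    where
    lemma : ∀ a b c d → a * b * (c * d) ≡ a * c * (b * d)
    lemma = solve-∀

  -- `T * κ w` bounds the expected number of sets of w + 1 chosen triples within w + 2 classes: at
  -- most T to the power w + 2 choices of the classes, at most (2 + w)³ triples among them, and
  -- probability 1/M for each triple, where T = 3 M. It is linear in T, whereas the number of chosen
  -- triples is quadratic.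
  κ : ℕ → ℕ
  κ w = 3 ^ suc w * ((2 + w) ^ 3) ^ suc w

  -- The arithmetic of a pair constraint, used with `f = 9 !`, `a = 3 ^ 9` and `p = M ^ 9`.
  cancel-scale : ∀ f a p β τ c e .{{_ : NonZero a}} .{{_ : NonZero p}} →
    p * c ≡ β * e → f * β ≤ τ → τ ≡ a * p → a * 18 ≤ f → 18 * c ≤ e
  cancel-scale f a p β τ c e pc fβ τ≡ a18 = *-cancelˡ-≤ a (*-cancelˡ-≤ p (begin
    p * (a * (18 * c)) ≡⟨ e₁ p a c ⟩
    a * 18 * (p * c)   ≤⟨ *-monoˡ-≤ (p * c) a18 ⟩
    f * (p * c)        ≡⟨ trans (cong (f *_) pc) (sym (*-assoc f β e)) ⟩
    f * β * e          ≤⟨ *-monoˡ-≤ e fβ ⟩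
    τ * e              ≡⟨ cong (_* e) τ≡ ⟩
    a * p * e          ≡⟨ e₂ a p e ⟩
    p * (a * e)        ∎))
    where
    open ≤-Reasoning
    e₁ : ∀ p a c → p * (a * (18 * c)) ≡ a * 18 * (p * c)
    e₁ = solve-∀
    e₂ : ∀ a p e → a * p * e ≡ p * (a * e)
    e₂ = solve-∀

  module Families (n k M T : ℕ) .{{k≢0 : NonZero k}} .{{M≢0 : NonZero M}} (M≡ : M ≡ suc k) (T≡3M : T ≡ 3 * M) where

    open Expectation k

    K : ℕ
    K = ∑ (upTo (n ∸ 1)) κ

    m e : ℕ
    m = length (triples T)
    e = suc k ^ m

    cost : List (Subset m) → ℕ
    cost B = ∑ B (λ F → E m (λ x → 𝟙 (does (F ⊆? x))))

    cost-⁽⁾ : ∀ (R : Subset m) f → M ^ f * cost (R ⁽ f ⁾) ≡ binomial ∣ R ∣ f * e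
    cost-⁽⁾ R f = trans (go (R ⁽ f ⁾) (λ F∈ → proj₂ (∈-⁽⁾⁻ {R = R} F∈))) (cong (_* e) (length-⁽⁾ R f))
      where
      go : ∀ B → (∀ {F} → F ∈ B → ∣ F ∣ ≡ f) → M ^ f * cost B ≡ length B * e
      go []      _  = *-zeroʳ (M ^ f)
      go (F ∷ B) eq = trans (*-distribˡ-+ (M ^ f) _ (cost B))
        (cong₂ _+_ (trans (cong₂ (λ M f → M ^ f * E m (λ x → 𝟙 (does (F ⊆? x)))) M≡ (sym (eq (here refl)))) (E-⊆ F)) (go B (eq ∘ there)))

    pairRegion : Fin T → Fin T → Subset m
    pairRegion a b = region (triples T) (both a b)

    sparseRegion : Subset T → Subset m
    sparseRegion s = region (triples T) (within s)

    -- Forbidden are 9 triples through the same pair, and w + 1 triples within w + 2 classes; the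
    -- range of w makes the number w + 2 of classes run from 2 to n.
    pairFamily sparseFamily : List (Subset m)
    pairFamily   = concatMap (λ a → concatMap (λ b → pairRegion a b ⁽ 9 ⁾) (allFin T)) (allFin T)
    sparseFamily = concatMap (λ w → concatMap (λ s → sparseRegion s ⁽ suc w ⁾) (⊤ ⁽ 2 + w ⁾)) (upTo (n ∸ 1))

    pair-cost : ∀ a b → 18 * cost (pairRegion a b ⁽ 9 ⁾) ≤ e
    pair-cost a b = cancel-scale (9 !) (3 ^ 9) (M ^ 9) (binomial ∣ R ∣ 9) (T ^ 9) (cost (R ⁽ 9 ⁾)) e {{_}} {{m^n≢0 M 9}}
      (cost-⁽⁾ R 9) (≤-trans (binomial-! ∣ R ∣ 9) (^-monoˡ-≤ 9 R≤T))
      -- 18 · 3⁹ = 354294 is below 9! = 362880. With 8 forbidden triples in place of 9 the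
      -- corresponding inequality fails, hence the codegree bound 8.
      (trans (cong (_^ 9) T≡3M) (^-distrib-* 3 M 9)) (≤ᵇ⇒≤ (3 ^ 9 * 18) (9 !) _)
      where
      R = pairRegion a b
      R≤T : ∣ R ∣ ≤ T
      R≤T = ≤-trans (≤-reflexive (∣region∣ (triples T) (both a b))) (∑-both≤ T a b)

    pairFamily-cost : 18 * cost pairFamily ≤ T * T * e
    pairFamily-cost = begin
      18 * cost pairFamily ≡⟨ cong (18 *_) (trans (∑-concatMap _ (allFin T) _) (∑-cong (allFin T) (λ a → ∑-concatMap _ (allFin T) _))) ⟩
      18 * ∑ (allFin T) (λ a → ∑ (allFin T) (λ b → cost (pairRegion a b ⁽ 9 ⁾)))
        ≡⟨ trans (∑-cong (allFin T) (λ a → ∑-*ˡ (allFin T) 18 _)) (∑-*ˡ (allFin T) 18 _) ⟨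
      ∑ (allFin T) (λ a → ∑ (allFin T) (λ b → 18 * cost (pairRegion a b ⁽ 9 ⁾)))
        ≤⟨ ∑-mono (allFin T) (λ {a} _ → ∑-mono (allFin T) (λ {b} _ → pair-cost a b)) ⟩
      ∑ (allFin T) (λ a → ∑ (allFin T) (λ b → e))
        ≡⟨ trans (∑-cong (allFin T) (λ _ → ∑-const (allFin T) e)) (∑-const (allFin T) _) ⟩
      length (allFin T) * (length (allFin T) * e) ≡⟨ cong (λ t → t * (t * e)) (length-allFin T) ⟩
      T * (T * e) ≡⟨ *-assoc T T e ⟨
      T * T * e ∎
      where open ≤-Reasoning

    size-cost : ∀ w → cost (concatMap (λ s → sparseRegion s ⁽ suc w ⁾) (⊤ ⁽ 2 + w ⁾)) ≤ T * κ w * e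
    size-cost w = *-cancelˡ-≤ (M ^ suc w) {{m^n≢0 M (suc w)}} (begin
      M ^ suc w * cost (concatMap (λ s → sparseRegion s ⁽ suc w ⁾) S)
        ≡⟨ cong (M ^ suc w *_) (∑-concatMap _ S _) ⟩
      M ^ suc w * ∑ S (λ s → cost (sparseRegion s ⁽ suc w ⁾))
        ≡⟨ ∑-*ˡ S (M ^ suc w) _ ⟨
      ∑ S (λ s → M ^ suc w * cost (sparseRegion s ⁽ suc w ⁾))
        ≤⟨ ∑-mono S {g = λ _ → ((2 + w) ^ 3) ^ suc w * e} (λ {s} s∈ → ≤-trans (≤-reflexive (cost-⁽⁾ (sparseRegion s) (suc w)))
             (*-monoˡ-≤ e (≤-trans (binomial-^ ∣ sparseRegion s ∣ (suc w)) (^-monoˡ-≤ (suc w) (region≤ s∈))))) ⟩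
      ∑ S (λ _ → ((2 + w) ^ 3) ^ suc w * e)
        ≡⟨ trans (∑-const S _) (cong (_* (((2 + w) ^ 3) ^ suc w * e)) (trans (length-⁽⁾ {T} ⊤ (2 + w)) (cong (λ t → binomial t (2 + w)) (∣⊤∣≡n T)))) ⟩
      binomial T (2 + w) * (((2 + w) ^ 3) ^ suc w * e)
        ≤⟨ *-monoˡ-≤ _ (binomial-^ T (2 + w)) ⟩
      T * T ^ suc w * (((2 + w) ^ 3) ^ suc w * e)
        ≡⟨ cong (λ t → T * t * (((2 + w) ^ 3) ^ suc w * e)) (trans (cong (_^ suc w) T≡3M) (^-distrib-* 3 M (suc w))) ⟩
      T * (3 ^ suc w * M ^ suc w) * (((2 + w) ^ 3) ^ suc w * e)
        ≡⟨ rotate T (3 ^ suc w) (M ^ suc w) (((2 + w) ^ 3) ^ suc w) e ⟩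
      M ^ suc w * (T * κ w * e) ∎)
      where
      open ≤-Reasoning
      S = ⊤ ⁽ 2 + w ⁾
      rotate : ∀ t a b c e → t * (a * b) * (c * e) ≡ b * (t * (a * c) * e)
      rotate = solve-∀
      region≤ : ∀ {s} → s ∈ S → ∣ sparseRegion s ∣ ≤ (2 + w) ^ 3
      region≤ {s} s∈ = ≤-trans (≤-reflexive (∣region∣ (triples T) (within s)))
        (subst (λ v → ∑ (triples T) (𝟙 ∘ within s) ≤ v ^ 3) (proj₂ (∈-⁽⁾⁻ {R = ⊤} s∈)) (∑-within≤ T s))

    sparseFamily-cost : cost sparseFamily ≤ T * K * e
    sparseFamily-cost = begin
      cost sparseFamily ≡⟨ ∑-concatMap _ (upTo (n ∸ 1)) _ ⟩
      ∑ (upTo (n ∸ 1)) (λ w → cost (concatMap (λ s → sparseRegion s ⁽ suc w ⁾) (⊤ ⁽ 2 + w ⁾)))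
        ≤⟨ ∑-mono (upTo (n ∸ 1)) (λ {w} _ → size-cost w) ⟩
      ∑ (upTo (n ∸ 1)) (λ w → T * κ w * e) ≡⟨ trans (∑-*ʳ (upTo (n ∸ 1)) e _) (cong (_* e) (∑-*ˡ (upTo (n ∸ 1)) T κ)) ⟩
      T * K * e ∎
      where open ≤-Reasoning

    family : List (Subset m)
    family = pairFamily ++ sparseFamily

    Avoids : Subset m → Set
    Avoids x = ∀ {F} → F ∈ family → ¬ F ⊆ x

    family-nonempty : ∀ {F} → F ∈ family → 0 < ∣ F ∣
    family-nonempty F∈ with ∈-++⁻ pairFamily F∈
    ... | inj₁ F∈₁ with Any.satisfied (∈-concatMap⁻ _ {xs = allFin T} F∈₁)
    ...   | a , F∈₂ with Any.satisfied (∈-concatMap⁻ _ {xs = allFin T} F∈₂)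
    ...     | b , F∈₃ = subst (0 <_) (sym (proj₂ (∈-⁽⁾⁻ {R = pairRegion a b} F∈₃))) (s≤s z≤n)
    family-nonempty F∈ | inj₂ F∈₁ with Any.satisfied (∈-concatMap⁻ _ {xs = upTo (n ∸ 1)} F∈₁)
    ...   | w , F∈₂ with Any.satisfied (∈-concatMap⁻ _ {xs = ⊤ ⁽ 2 + w ⁾} F∈₂)
    ...     | s , F∈₃ = subst (0 <_) (sym (proj₂ (∈-⁽⁾⁻ {R = sparseRegion s} F∈₃))) (s≤s z≤n)

    module Chosen (x : Subset m) (avoids : Avoids x) where

      es : List (Fin T × Fin T × Fin T)
      es = select (triples T) x

      es-sorted : ∀ {t} → t ∈ es → SortedTriple t
      es-sorted t∈ = triples-sorted T (∈-select (triples T) x t∈)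

      es-unique : Unique es
      es-unique = select-unique (triples T) x (triples-unique T)

      codegree-< : ∀ {a b} → a Fin.< b → codegree Fin._≟_ es a b ≤ 8
      codegree-< {a} {b} a<b = s≤s⁻¹ (≤-trans (s≤s (≤-reflexive (trans
          (∑-cong es (λ t → 𝟙-cong (contains? a b t) (both? a b t) (a<b ,_) proj₂))
          (∑-select (triples T) x (both a b)))))
        (avoid-⁽⁾ x (pairRegion a b) 9 (λ {F} F∈ → avoids (∈-++⁺ˡ (∈-concatMap⁺ _ {xs = allFin T} (lose (∈-allFin a)
          (∈-concatMap⁺ _ {xs = allFin T} (lose (∈-allFin b) F∈))))))))

      codegree-comm : ∀ a b → codegree Fin._≟_ es a b ≡ codegree Fin._≟_ es b a
      codegree-comm a b = ∑-cong es (λ t → 𝟙-cong (contains? a b t) (contains? b a t)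
        (λ (p , q) → q , p) (λ (p , q) → q , p))

      codegree≤8 : ∀ {a b} → a ≢ b → codegree Fin._≟_ es a b ≤ 8
      codegree≤8 {a} {b} a≢b with Fin.<-cmp a b
      ... | tri< a<b _ _ = codegree-< a<b
      ... | tri≈ _ a≡b _ = contradiction a≡b a≢b
      ... | tri> _ _ b<a = ≤-trans (≤-reflexive (codegree-comm a b)) (codegree-< b<a)

      sparse : Sparse n (allFin T) es
      sparse c 2≤ ≤n = begin
        ∑ es (λ t → 1 ⊓ minₜ c t) + 2 ≡⟨ cong (_+ 2) (trans (∑-cong es inside-s) (∑-select (triples T) x (within s))) ⟩
        ∣ x ∩ sparseRegion s ∣ + 2    ≤⟨ +-monoˡ-≤ 2 (s≤s⁻¹ (avoid-⁽⁾ x (sparseRegion s) (suc w) (λ {F} F∈ →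
          avoids (∈-++⁺ʳ pairFamily (∈-concatMap⁺ _ {xs = upTo (n ∸ 1)} (lose (∈-upTo⁺ w<n-1)
            (∈-concatMap⁺ _ {xs = ⊤ ⁽ 2 + w ⁾} (lose (∈-⁽⁾⁺ (⊆-max s) (sym 2+w≡)) F∈)))))))) ⟩
        w + 2                         ≡⟨ trans (+-comm w 2) (trans 2+w≡ (sym size)) ⟩
        ∑ (allFin T) (λ v → 1 ⊓ c v)  ∎
        where
        open ≤-Reasoning
        s : Subset T
        s = tabulate (λ v → 0 <ᵇ c v)
        w : ℕ
        w = ∣ s ∣ ∸ 2
        𝟙-<ᵇ : ∀ a → 𝟙 (0 <ᵇ a) ≡ 1 ⊓ a
        𝟙-<ᵇ zero    = refl
        𝟙-<ᵇ (suc a) = refl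
        size : ∑ (allFin T) (λ v → 1 ⊓ c v) ≡ ∣ s ∣
        size = trans (∑-cong (allFin T) (λ v → trans (sym (𝟙-<ᵇ (c v))) (cong 𝟙 (sym (lookup∘tabulate (λ v → 0 <ᵇ c v) v))))) (∑-lookup s)
        2+w≡ : 2 + w ≡ ∣ s ∣
        2+w≡ = m+[n∸m]≡n (subst (2 ≤_) size 2≤)
        w<n-1 : w < n ∸ 1
        w<n-1 = ∸-monoˡ-≤ 1 (subst (_≤ n) (trans size (sym 2+w≡)) ≤n)
        min-∧ : ∀ a b c → 1 ⊓ (a ⊓ b ⊓ c) ≡ 𝟙 ((0 <ᵇ a) ∧ ((0 <ᵇ b) ∧ (0 <ᵇ c)))
        min-∧ zero    b       c       = refl
        min-∧ (suc a) zero    c       = refl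
        min-∧ (suc a) (suc b) zero    = refl
        min-∧ (suc a) (suc b) (suc c) = refl
        inside-s : ∀ t → 1 ⊓ minₜ c t ≡ 𝟙 (within s t)
        inside-s (i , j , k) = trans (min-∧ (c i) (c j) (c k)) (sym (cong 𝟙 (cong₂ _∧_ (at i) (cong₂ _∧_ (at j) (at k)))))
          where
          at : ∀ v → lookup s v ≡ (0 <ᵇ c v)
          at = lookup∘tabulate (λ v → 0 <ᵇ c v)

  record SparseSystem (n : ℕ) : Set where
    field
      T          : ℕ
      es         : List (Fin T × Fin T × Fin T)
      4≤T        : 4 ≤ T
      sorted     : ∀ {t} → t ∈ es → SortedTriple t
      unique     : Unique es
      sparse     : Sparse n (allFin T) es
      codegree≤8 : ∀ {a b} → a ≢ b → codegree Fin._≟_ es a b ≤ 8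
      large      : 2 * (T * T) ≤ 5 * length es

  -- Choice with probability 1/M for M = 5 μ, followed by deletion. `K` depends on `n` only, so μ
  -- can be taken large compared with it; T = 15 μ makes 2T²/5 the integer 90 μ².
  sparse-system : ∀ n → SparseSystem n
  sparse-system n = construct (15 * μ) (pred (5 * μ)) refl (sym (suc-pred (5 * μ) {{>-nonZero (≤-trans (s≤s z≤n) 2≤5μ)}})) (T≡3M μ)
    where
    K μ : ℕ
    K = ∑ (upTo (n ∸ 1)) κ
    μ = 2 * K + 3
    0<μ : 0 < μ
    0<μ = ≤-trans (s≤s z≤n) (m≤n+m 3 (2 * K))
    2≤5μ : 2 ≤ 5 * μ
    2≤5μ = *-mono-≤ {2} {5} (s≤s (s≤s z≤n)) 0<μ
    T≡3M : ∀ μ → 15 * μ ≡ 3 * (5 * μ)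
    T≡3M = solve-∀
    2T² : ∀ μ → 2 * (15 * μ * (15 * μ)) ≡ 5 * (90 * (μ * μ))
    2T² = solve-∀
    construct : ∀ T k → T ≡ 15 * μ → 5 * μ ≡ suc k → 15 * μ ≡ 3 * (5 * μ) → SparseSystem n
    construct T k T≡ M≡ T≡3M = record
      { T = T ; es = es ; 4≤T = ≤-trans (*-mono-≤ {4} {15} (s≤s (s≤s (s≤s (s≤s z≤n)))) 0<μ) (≤-reflexive (sym T≡))
      ; sorted = es-sorted ; unique = es-unique ; sparse = sparse ; codegree≤8 = codegree≤8 ; large = large }
      where
      instance
        k≢0 : NonZero k
        k≢0 = >-nonZero (s≤s⁻¹ (subst (2 ≤_) M≡ 2≤5μ))
        M≢0 : NonZero (5 * μ)
        M≢0 = >-nonZero (≤-trans (s≤s z≤n) 2≤5μ)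
      open Families n k (5 * μ) T M≡ (trans T≡ T≡3M) hiding (K)
      open Expectation k
      chosen : ∃[ x ] ∑ family (λ F → 𝟙 (does (F ⊆? x))) + 90 * (μ * μ) ≤ ∣ x ∣
      chosen = E-≤⇒∃ m (begin
        E m (λ x → ∑ family (λ F → 𝟙 (does (F ⊆? x))) + 90 * (μ * μ))
          ≡⟨ trans (E-+ m _ _) (cong₂ _+_ (trans (E-∑ m family _) (∑-++ pairFamily sparseFamily _)) (trans (E-const m (90 * (μ * μ))) (*-comm e _))) ⟩
        cost pairFamily + cost sparseFamily + 90 * (μ * μ) * e
          ≤⟨ expectation-bound K e (cost pairFamily) (cost sparseFamily) (E m ∣_∣) m
               (subst (λ T → 18 * cost pairFamily ≤ T * T * e) T≡ pairFamily-cost)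
               (subst (λ T → cost sparseFamily ≤ T * K * e) T≡ sparseFamily-cost)
               (trans (cong (_* E m ∣_∣) M≡) (E-size m))
               (subst (λ T → T * T * T ≤ 6 * m + 3 * (T * T)) T≡ (≤-trans (m≤m+n _ (2 * T)) (≤-reflexive (sym (length-triples T))))) ⟩
        E m ∣_∣ ∎)
        where open ≤-Reasoning
      x = proj₁ chosen
      deleted = delete family x family-nonempty
      x′ = proj₁ deleted
      open Chosen x′ (λ {F} → proj₁ (proj₂ deleted) {F})
      large : 2 * (T * T) ≤ 5 * length es
      large = begin
        2 * (T * T)          ≡⟨ trans (cong (λ T → 2 * (T * T)) T≡) (2T² μ) ⟩
        5 * (90 * (μ * μ))   ≤⟨ *-monoʳ-≤ 5 (+-cancelˡ-≤ N (90 * (μ * μ)) ∣ x′ ∣ (begin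
          N + 90 * (μ * μ)     ≤⟨ proj₂ chosen ⟩
          ∣ x ∣                ≤⟨ proj₂ (proj₂ (proj₂ deleted)) ⟩
          ∣ x′ ∣ + N           ≡⟨ +-comm ∣ x′ ∣ N ⟩
          N + ∣ x′ ∣           ∎)) ⟩
        5 * ∣ x′ ∣           ≡⟨ cong (5 *_) (length-select (triples T) x′) ⟨
        5 * length es        ∎
        where
        open ≤-Reasoning
        N = ∑ family (λ F → 𝟙 (does (F ⊆? x)))

-- 3-graphs given by the classes of their vertices, and their edge counts.

module ClassGraphs where

  open import Defs using (subsets; Hypergraph; _IsSubgraphOf_)
  open FiniteSums
  open WeightedTriples using (prodₜ)
  open SortedTriples
  open RandomSubsets using (𝟙-yes; 𝟙-no; ∑-subsets)
  open SparseTripleSystems using (𝟙-≤)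
  open import Data.Bool using (Bool; true; false; T)
  open import Data.Bool.Properties using (T?)
  open import Data.Fin as Fin using (Fin; zero; suc; splitAt; _↑ˡ_; _↑ʳ_)
  import Data.Fin.Properties as Fin
  open import Data.Fin.Subset using (Subset; inside; outside; ∣_∣; ⊤)
  open import Data.Fin.Subset.Properties using (⊆-max)
  open import Data.List using (List; []; _∷_; map; length; allFin)
  open import Data.List.Properties using (length-map)
  open import Data.List.Membership.Propositional using (_∈_)
  open import Data.List.Membership.Propositional.Properties using (∈-map⁻)
  open import Data.List.Relation.Unary.All as All using (All; []; _∷_)
  open import Data.List.Relation.Unary.Any using (here; there)
  open import Data.List.Relation.Unary.AllPairs using ([]; _∷_)
  open import Data.List.Relation.Unary.Unique.Propositional using (Unique)
  open import Data.Nat as ℕ hiding (_/_; _≟_)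
  open import Data.Nat.Properties hiding (_≟_)
  open import Data.Product using (_×_; _,_; proj₁; proj₂)
  open import Data.Product.Properties using (≡-dec)
  open import Data.Sum using (inj₁; inj₂; [_,_]′)
  open import Data.Vec using ([]; _∷_; lookup)
  open import Data.Vec.Properties using (lookup⇒[]=; []=⇒lookup)
  open import Function using (_∘_)
  open import Relation.Binary.PropositionalEquality
  open import Relation.Binary.Definitions using (DecidableEquality)
  open import Relation.Nullary using (¬_; Dec; yes; no; does; contradiction)

  elements : ∀ {n} → Subset n → List (Fin n)
  elements []            = []
  elements (inside ∷ s)  = zero ∷ map suc (elements s)
  elements (outside ∷ s) = map suc (elements s)

  length-elements : ∀ {n} (s : Subset n) → length (elements s) ≡ ∣ s ∣
  length-elements []            = refl
  length-elements (inside ∷ s)  = cong suc (trans (length-map suc (elements s)) (length-elements s))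
  length-elements (outside ∷ s) = trans (length-map suc (elements s)) (length-elements s)

  ∈-elements : ∀ {n} (s : Subset n) {i} → i ∈ elements s → lookup s i ≡ inside
  ∈-elements (inside ∷ s)  (here refl) = refl
  ∈-elements (inside ∷ s)  (there i∈) with ∈-map⁻ suc i∈
  ... | _ , j∈ , refl = ∈-elements s j∈
  ∈-elements (outside ∷ s) i∈ with ∈-map⁻ suc i∈
  ... | _ , j∈ , refl = ∈-elements s j∈

  module _ {A : Set} where

    -- Each of the four functions vanishes on lists of any other length than its index, so that a
    -- sum over all subsets reduces to the subsets of that size.
    on₀ : ℕ → List A → ℕ
    on₀ z []      = z
    on₀ z (_ ∷ _) = 0

    on₁ : (A → ℕ) → List A → ℕ
    on₁ g []      = 0
    on₁ g (a ∷ l) = on₀ (g a) l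

    on₂ : (A × A → ℕ) → List A → ℕ
    on₂ g []      = 0
    on₂ g (a ∷ l) = on₁ (λ b → g (a , b)) l

    on₃ : (A × A × A → ℕ) → List A → ℕ
    on₃ g []      = 0
    on₃ g (a ∷ l) = on₂ (λ e → g (a , e)) l

  module _ {A B : Set} (f : A → B) where

    on₀-map : ∀ z l → on₀ z (map f l) ≡ on₀ z l
    on₀-map z []      = refl
    on₀-map z (_ ∷ _) = refl

    on₁-map : ∀ g l → on₁ g (map f l) ≡ on₁ (g ∘ f) l
    on₁-map g []      = refl
    on₁-map g (a ∷ l) = on₀-map (g (f a)) l

    on₂-map : ∀ g l → on₂ g (map f l) ≡ on₂ (λ (a , b) → g (f a , f b)) l
    on₂-map g []      = refl
    on₂-map g (a ∷ l) = on₁-map (λ b → g (f a , b)) l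

    on₃-map : ∀ g l → on₃ g (map f l) ≡ on₃ (λ (a , b , c) → g (f a , f b , f c)) l
    on₃-map g []      = refl
    on₃-map g (a ∷ l) = on₂-map (λ e → g (f a , e)) l

  ∑-on₀ : ∀ n z → ∑ (subsets n) (on₀ z ∘ elements) ≡ z
  ∑-on₀ zero    z = +-identityʳ z
  ∑-on₀ (suc n) z = trans (∑-subsets n (on₀ z ∘ elements)) (trans (cong₂ _+_
    (trans (∑-cong (subsets n) (λ s → on₀-map suc z (elements s))) (∑-on₀ n z)) (∑-zero (subsets n))) (+-identityʳ z))

  ∑-on₁ : ∀ n g → ∑ (subsets n) (on₁ g ∘ elements) ≡ ∑ (allFin n) g
  ∑-on₁ zero    g = refl
  ∑-on₁ (suc n) g = trans (∑-subsets n (on₁ g ∘ elements)) (trans (cong₂ _+_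
    (trans (∑-cong (subsets n) (λ s → on₁-map suc g (elements s))) (∑-on₁ n (g ∘ suc)))
    (trans (∑-cong (subsets n) (λ s → on₀-map suc (g zero) (elements s))) (∑-on₀ n (g zero))))
    (trans (+-comm _ (g zero)) (sym (∑-allFin n g))))

  ∑-on₂ : ∀ n g → ∑ (subsets n) (on₂ g ∘ elements) ≡ ∑ (pairs n) g
  ∑-on₂ zero    g = refl
  ∑-on₂ (suc n) g = trans (∑-subsets n (on₂ g ∘ elements)) (trans (cong₂ _+_
    (trans (∑-cong (subsets n) (λ s → on₂-map suc g (elements s))) (∑-on₂ n (λ (i , j) → g (suc i , suc j))))
    (trans (∑-cong (subsets n) (λ s → on₁-map suc (λ j → g (zero , j)) (elements s))) (∑-on₁ n (λ j → g (zero , suc j)))))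
    (trans (+-comm (∑ (pairs n) (λ (i , j) → g (suc i , suc j))) _) (sym (∑-pairs n g))))

  ∑-on₃ : ∀ n g → ∑ (subsets n) (on₃ g ∘ elements) ≡ ∑ (triples n) g
  ∑-on₃ zero    g = refl
  ∑-on₃ (suc n) g = trans (∑-subsets n (on₃ g ∘ elements)) (trans (cong₂ _+_
    (trans (∑-cong (subsets n) (λ s → on₃-map suc g (elements s))) (∑-on₃ n (λ (i , j , k) → g (suc i , suc j , suc k))))
    (trans (∑-cong (subsets n) (λ s → on₂-map suc (λ e → g (zero , e)) (elements s))) (∑-on₂ n (λ (j , k) → g (zero , suc j , suc k)))))
    (trans (+-comm (∑ (triples n) (λ (i , j , k) → g (suc i , suc j , suc k))) _) (sym (∑-triples n g))))

  ∑³-prod : ∀ n (f g h : Fin n → ℕ) → ∑³ n (λ (i , j , k) → f i * g j * h k) ≡ ∑ (allFin n) f * ∑ (allFin n) g * ∑ (allFin n) h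
  ∑³-prod n f g h = trans (∑-cong (allFin n) (λ i → trans (∑-cong (allFin n) (λ j → ∑-*ˡ (allFin n) (f i * g j) h))
      (trans (∑-*ʳ (allFin n) (∑ (allFin n) h) (λ j → f i * g j)) (cong (_* ∑ (allFin n) h) (∑-*ˡ (allFin n) (f i) g)))))
    (trans (∑-*ʳ (allFin n) (∑ (allFin n) h) (λ i → f i * ∑ (allFin n) g)) (cong (_* ∑ (allFin n) h) (∑-*ʳ (allFin n) (∑ (allFin n) g) f)))

  module ClassGraph {k N} (ℰ : List (Fin k × Fin k × Fin k)) (cl : Fin N → Fin k) where

    _≟ₜ_ : DecidableEquality (Fin k × Fin k × Fin k)
    _≟ₜ_ = ≡-dec Fin._≟_ (≡-dec Fin._≟_ Fin._≟_)

    open import Data.List.Membership.DecPropositional _≟ₜ_ using (_∈?_)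

    classes : Fin N × Fin N × Fin N → Fin k × Fin k × Fin k
    classes (α , β , γ) = cl α , cl β , cl γ

    -- The vertices of a subset are listed in increasing order. For a monotone `cl` and sorted
    -- triples in `ℰ` this avoids permutations of the classes.
    test : List (Fin N) → Bool
    test (α ∷ β ∷ γ ∷ []) = does (classes (α , β , γ) ∈? ℰ)
    test _                = false

    test-length : ∀ l → T (test l) → length l ≡ 3
    test-length (_ ∷ _ ∷ _ ∷ []) _ = refl

    graph : Hypergraph 3 N
    graph = record
      { V       = ⊤
      ; edge    = test ∘ elements
      ; uniform = λ {s} t → ⊆-max s , trans (sym (length-elements s)) (test-length (elements s) t)
      }

    δ : Fin k → Fin k → ℕ
    δ c d = 𝟙 (does (c Fin.≟ d))

    match : Fin k × Fin k × Fin k → Fin N × Fin N × Fin N → ℕ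
    match (c , d , e) (α , β , γ) = δ (cl α) c * δ (cl β) d * δ (cl γ) e

    match-refl : ∀ t → match (classes t) t ≡ 1
    match-refl (α , β , γ) = cong₂ _*_ (cong₂ _*_ (𝟙-yes (cl α Fin.≟ cl α) refl) (𝟙-yes (cl β Fin.≟ cl β) refl)) (𝟙-yes (cl γ Fin.≟ cl γ) refl)

    match-≢ : ∀ e t → e ≢ classes t → match e t ≡ 0
    match-≢ (c , d , e) (α , β , γ) e≢ with cl α Fin.≟ c | cl β Fin.≟ d | cl γ Fin.≟ e
    ... | no _     | _        | _        = refl
    ... | yes _    | no _     | _        = refl
    ... | yes _    | yes _    | no _     = refl
    ... | yes refl | yes refl | yes refl = contradiction refl e≢

    module _ (H : Hypergraph 3 N) (H⊆G : H IsSubgraphOf graph) where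
      open Hypergraph H

      h : Fin N → ℕ
      h α = 𝟙 (lookup V α)

      count : Fin k → ℕ
      count c = ∑ (allFin N) (λ α → h α * δ (cl α) c)

      -- An edge of `H` takes one vertex of `H` from each class of some triple of `ℰ`; counting all
      -- ordered choices of such vertices gives the products.
      E≤∑ : length E ≤ ∑ ℰ (prodₜ count)
      E≤∑ = begin
        length E
          ≡⟨ length-filter-𝟙 (T? ∘ edge) (subsets N) ⟩
        ∑ (subsets N) (𝟙 ∘ edge)
          ≤⟨ ∑-mono (subsets N) (λ {s} _ → pointwise s) ⟩
        ∑ (subsets N) (on₃ weight ∘ elements)
          ≡⟨ ∑-on₃ N weight ⟩
        ∑ (triples N) weight
          ≤⟨ ∑-triples≤∑³ N weight ⟩
        ∑³ N weight
          ≤⟨ ∑-mono (allFin N) (λ {α} _ → ∑-mono (allFin N) (λ {β} _ → ∑-mono (allFin N) (λ {γ} _ → weight≤ (α , β , γ)))) ⟩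
        ∑³ N (λ t → ∑ ℰ (λ e → hhh t * match e t))
          ≡⟨ trans (∑-cong (allFin N) (λ α → trans (∑-cong (allFin N) (λ β → ∑-swap (allFin N) ℰ _)) (∑-swap (allFin N) ℰ _))) (∑-swap (allFin N) ℰ _) ⟩
        ∑ ℰ (λ e → ∑³ N (λ t → hhh t * match e t))
          ≡⟨ ∑-cong ℰ (λ (c , d , e) → trans (∑-cong (allFin N) (λ α → ∑-cong (allFin N) (λ β → ∑-cong (allFin N) (λ γ →
               shuffle (h α) (h β) (h γ) (δ (cl α) c) (δ (cl β) d) (δ (cl γ) e)))))
               (∑³-prod N (λ α → h α * δ (cl α) c) (λ β → h β * δ (cl β) d) (λ γ → h γ * δ (cl γ) e))) ⟩
        ∑ ℰ (prodₜ count) ∎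
        where
        open ≤-Reasoning
        open import Data.Nat.Tactic.RingSolver using (solve-∀)
        shuffle : ∀ a b c x y z → a * b * c * (x * y * z) ≡ a * x * (b * y) * (c * z)
        shuffle = solve-∀
        hhh weight : Fin N × Fin N × Fin N → ℕ
        hhh (α , β , γ) = h α * h β * h γ
        weight t = hhh t * 𝟙 (does (classes t ∈? ℰ))
        weight≤ : ∀ t → weight t ≤ ∑ ℰ (λ e → hhh t * match e t)
        weight≤ t = ≤-trans (*-monoʳ-≤ (hhh t) (𝟙-≤ (classes t ∈? ℰ) (λ t∈ →
          ≤-trans (≤-reflexive (sym (match-refl t))) (∑-∈ ℰ (λ e → match e t) t∈)))) (≤-reflexive (sym (∑-*ˡ ℰ (hhh t) _)))
        bool : ∀ b {m} → (T b → 1 ≤ m) → 𝟙 b ≤ m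
        bool true  f = f _
        bool false f = z≤n
        listwise : ∀ l → (∀ {α} → α ∈ l → h α ≡ 1) → T (test l) → 1 ≤ on₃ weight l
        listwise (α ∷ β ∷ γ ∷ []) h≡1 t = ≤-reflexive (sym (cong₂ _*_
          (cong₂ _*_ (cong₂ _*_ (h≡1 (here refl)) (h≡1 (there (here refl)))) (h≡1 (there (there (here refl)))))
          (T⇒𝟙 _ t)))
          where
          T⇒𝟙 : ∀ b → T b → 𝟙 b ≡ 1
          T⇒𝟙 true _ = refl
        pointwise : ∀ s → 𝟙 (edge s) ≤ on₃ weight (elements s)
        pointwise s = bool (edge s) (λ t → listwise (elements s)
          (λ {α} α∈ → cong 𝟙 ([]=⇒lookup (proj₁ (uniform {s} t) (lookup⇒[]= α s (∈-elements s α∈)))))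
          (proj₂ H⊆G {s} t))

    ∑-δ-count : (μ : Fin k → ℕ) → Set
    ∑-δ-count μ = ∀ c → ∑ (allFin N) (λ α → δ (cl α) c) ≡ μ c

    module _ (sorted : ∀ {e} → e ∈ ℰ → SortedTriple e) (unique : Unique ℰ)
             (monotone : ∀ {α β} → cl α Fin.< cl β → α Fin.< β) (μ : Fin k → ℕ) (∑-δ≡μ : ∑-δ-count μ) where

      -- Conversely nothing is counted twice: monotonicity makes a triple of vertices with classes
      -- in `ℰ` increasing, and uniqueness lets it match only one triple of `ℰ`.
      ∑≤E : ∑ ℰ (prodₜ μ) ≤ length (Hypergraph.E graph)
      ∑≤E = begin
        ∑ ℰ (prodₜ μ)
          ≡⟨ ∑-cong ℰ (λ (c , d , e) → trans (sym (cong₂ _*_ (cong₂ _*_ (∑-δ≡μ c) (∑-δ≡μ d)) (∑-δ≡μ e)))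
               (sym (∑³-prod N (λ α → δ (cl α) c) (λ β → δ (cl β) d) (λ γ → δ (cl γ) e)))) ⟩
        ∑ ℰ (λ e → ∑³ N (match e))
          ≡⟨ trans (∑-cong (allFin N) (λ α → trans (∑-cong (allFin N) (λ β → ∑-swap (allFin N) ℰ (λ γ e → match e (α , β , γ)))) (∑-swap (allFin N) ℰ _))) (∑-swap (allFin N) ℰ _) ⟨
        ∑³ N (λ t → ∑ ℰ (λ e → match e t))
          ≤⟨ ∑-mono (allFin N) (λ {α} _ → ∑-mono (allFin N) (λ {β} _ → ∑-mono (allFin N) (λ {γ} _ → matches≤ (α , β , γ)))) ⟩
        ∑³ N weight
          ≤⟨ ∑³≤∑-triples N weight (λ t unsorted → 𝟙-no (classes t ∈? ℰ) (λ t∈ → let c<d , d<e = sorted t∈ in unsorted (monotone c<d , monotone d<e))) ⟩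
        ∑ (triples N) weight
          ≡⟨ ∑-on₃ N weight ⟨
        ∑ (subsets N) (on₃ weight ∘ elements)
          ≡⟨ ∑-cong (subsets N) (λ s → listwise (elements s)) ⟩
        ∑ (subsets N) (𝟙 ∘ test ∘ elements)
          ≡⟨ length-filter-𝟙 (T? ∘ test ∘ elements) (subsets N) ⟨
        length (Hypergraph.E graph) ∎
        where
        open ≤-Reasoning
        weight : Fin N × Fin N × Fin N → ℕ
        weight t = 𝟙 (does (classes t ∈? ℰ))
        listwise : ∀ l → on₃ weight l ≡ 𝟙 (test l)
        listwise []                  = refl
        listwise (_ ∷ [])            = refl
        listwise (_ ∷ _ ∷ [])        = refl
        listwise (_ ∷ _ ∷ _ ∷ [])    = refl
        listwise (_ ∷ _ ∷ _ ∷ _ ∷ _) = refl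
        none : ∀ es t → ¬ classes t ∈ es → ∑ es (λ e → match e t) ≡ 0
        none []       t _  = refl
        none (e ∷ es) t t∉ = cong₂ _+_ (match-≢ e t (λ e≡ → t∉ (here (sym e≡)))) (none es t (t∉ ∘ there))
        once : ∀ es → Unique es → ∀ t → classes t ∈ es → ∑ es (λ e → match e t) ≤ 1
        once (e ∷ es) (e∉ ∷ u) t (here refl) = ≤-reflexive (cong₂ _+_ (match-refl t) (none es t (λ t∈ → All.lookup e∉ t∈ refl)))
        once (e ∷ es) (e∉ ∷ u) t (there t∈)  = ≤-trans (≤-reflexive (cong (_+ ∑ es (λ e → match e t)) (match-≢ e t (λ e≡ → All.lookup e∉ t∈ e≡)))) (once es u t t∈)
        matches≤ : ∀ t → ∑ ℰ (λ e → match e t) ≤ weight t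
        matches≤ t = either (classes t ∈? ℰ)
          where
          either : (d : Dec (classes t ∈ ℰ)) → ∑ ℰ (λ e → match e t) ≤ 𝟙 (does d)
          either (yes t∈) = once ℰ unique t t∈
          either (no t∉)  = ≤-reflexive (none ℰ t t∉)

  total : ∀ k → (Fin k → ℕ) → ℕ
  total zero    μ = 0
  total (suc k) μ = μ zero + total k (μ ∘ suc)

  classOf : ∀ k (μ : Fin k → ℕ) → Fin (total k μ) → Fin k
  classOf (suc k) μ α = [ (λ _ → zero) , (λ β → suc (classOf k (μ ∘ suc) β)) ]′ (splitAt (μ zero) α)

  classOf-monotone : ∀ k μ {α β} → classOf k μ α Fin.< classOf k μ β → α Fin.< β
  classOf-monotone (suc k) μ {α} {β} lt with splitAt (μ zero) α in eqα | splitAt (μ zero) β in eqβ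
  ... | inj₁ i | inj₂ j = subst₂ (λ α β → α Fin.< β) (Fin.splitAt⁻¹-↑ˡ eqα) (Fin.splitAt⁻¹-↑ʳ {μ zero} eqβ)
    (subst₂ ℕ._<_ (sym (Fin.toℕ-↑ˡ i _)) (sym (Fin.toℕ-↑ʳ (μ zero) j)) (≤-trans (Fin.toℕ<n i) (m≤m+n (μ zero) _)))
  ... | inj₂ i | inj₂ j = subst₂ (λ α β → α Fin.< β) (Fin.splitAt⁻¹-↑ʳ {μ zero} eqα) (Fin.splitAt⁻¹-↑ʳ {μ zero} eqβ)
    (subst₂ ℕ._<_ (sym (Fin.toℕ-↑ʳ (μ zero) i)) (sym (Fin.toℕ-↑ʳ (μ zero) j))
      (+-monoʳ-< (μ zero) (classOf-monotone k (μ ∘ suc) {i} {j} (s≤s⁻¹ lt))))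

  ∑-allFin-+ : ∀ a b (f : Fin (a + b) → ℕ) → ∑ (allFin (a + b)) f ≡ ∑ (allFin a) (λ i → f (i ↑ˡ b)) + ∑ (allFin b) (λ j → f (a ↑ʳ j))
  ∑-allFin-+ zero    b f = refl
  ∑-allFin-+ (suc a) b f = trans (∑-allFin (a + b) f) (trans (cong (f zero +_) (∑-allFin-+ a b (f ∘ suc)))
    (trans (sym (+-assoc (f zero) _ _)) (cong (_+ ∑ (allFin b) (λ j → f (suc a ↑ʳ j))) (sym (∑-allFin a (λ i → f (i ↑ˡ b)))))))

  ∑-classOf : ∀ k μ (f : Fin k → ℕ) → ∑ (allFin (total k μ)) (f ∘ classOf k μ) ≡ ∑ (allFin k) (λ c → μ c * f c)
  ∑-classOf zero    μ f = refl
  ∑-classOf (suc k) μ f = trans (∑-allFin-+ (μ zero) (total k (μ ∘ suc)) (f ∘ classOf (suc k) μ)) (trans (cong₂ _+_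
    (trans (∑-cong (allFin (μ zero)) (λ i → cong (f ∘ [ (λ _ → zero) , (λ β → suc (classOf k (μ ∘ suc) β)) ]′) (Fin.splitAt-↑ˡ (μ zero) i _)))
           (trans (∑-const (allFin (μ zero)) (f zero)) (cong (_* f zero) (length-allFin (μ zero)))))
    (trans (∑-cong (allFin (total k (μ ∘ suc))) (λ j → cong (f ∘ [ (λ _ → zero) , (λ β → suc (classOf k (μ ∘ suc) β)) ]′) (Fin.splitAt-↑ʳ (μ zero) _ j)))
           (∑-classOf k (μ ∘ suc) (f ∘ suc))))
    (sym (∑-allFin k (λ c → μ c * f c))))

-- Blow-ups of the split pattern: density of small subgraphs and surplus of the whole.

module BlowUps where

  open import Defs using (Hypergraph; _IsSubgraphOf_)
  open IntegerPolynomials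
  open FiniteSums
  open WeightedTriples
  open WeightBounds
  open SortedTriples
  open RandomSubsets using (𝟙-cong)
  open SparseTripleSystems using (∑-δ; ∑-lookup)
  open SparseTripleSystems
  open ClassGraphs
  open import Data.Fin as Fin using (Fin; zero; suc)
  open import Data.Fin.Patterns
  import Data.Fin.Properties as Fin
  open import Data.List using (List; []; _∷_; _++_; map; length; allFin)
  open import Data.List.Membership.Propositional using (_∈_)
  open import Data.List.Membership.Propositional.Properties using (∈-map⁻; ∈-++⁻)
  open import Data.List.Relation.Unary.Unique.Propositional using (Unique)
  open import Data.List.Relation.Unary.Unique.Propositional.Properties using (allFin⁺; map⁺; ++⁺)
  open import Data.Nat as ℕ hiding (_/_; _≟_)
  open import Data.Nat.Properties hiding (_≟_)
  open import Data.Nat.Tactic.RingSolver using (solve-∀)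
  open import Data.Product using (_×_; _,_; proj₁; proj₂; ∃-syntax)
  open import Data.Sum using (inj₁; inj₂)
  open import Data.Vec using ([]; _∷_; lookup)
  open import Data.Integer.Tactic.RingSolver using (ring)
  open import Tactic.RingSolver.NonReflective ring using (Ι; _⊕_; _⊗_)
  open import Function using (_∘_)
  open import Relation.Binary.PropositionalEquality
  open import Relation.Nullary using (¬_; does)

  ∑-pairs-square : ∀ n (f : Fin n → ℕ) → 2 * ∑ (pairs n) (λ (i , j) → f i * f j) + ∑ (allFin n) (λ i → f i * f i) ≡ ∑ (allFin n) f * ∑ (allFin n) f
  ∑-pairs-square zero    f = refl
  ∑-pairs-square (suc n) f = begin
    2 * ∑ (pairs (suc n)) (λ (i , j) → f i * f j) + ∑ (allFin (suc n)) (λ i → f i * f i)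
      ≡⟨ cong₂ (λ a b → 2 * a + b) (trans (∑-pairs n _) (cong (_+ P) (∑-*ˡ (allFin n) (f zero) (f ∘ suc)))) (∑-allFin n (λ i → f i * f i)) ⟩
    2 * (f zero * s + P) + (f zero * f zero + D)  ≡⟨ e₁ (f zero) s P D ⟩
    f zero * f zero + 2 * (f zero * s) + (2 * P + D) ≡⟨ cong (f zero * f zero + 2 * (f zero * s) +_) (∑-pairs-square n (f ∘ suc)) ⟩
    f zero * f zero + 2 * (f zero * s) + s * s       ≡⟨ e₂ (f zero) s ⟩
    (f zero + s) * (f zero + s)                      ≡⟨ cong (λ a → a * a) (∑-allFin n f) ⟨
    ∑ (allFin (suc n)) f * ∑ (allFin (suc n)) f ∎
    where
    open ≡-Reasoning
    s = ∑ (allFin n) (f ∘ suc)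
    P = ∑ (pairs n) (λ (i , j) → f (suc i) * f (suc j))
    D = ∑ (allFin n) (λ i → f (suc i) * f (suc i))
    e₁ : ∀ a s P D → 2 * (a * s + P) + (a * a + D) ≡ a * a + 2 * (a * s) + (2 * P + D)
    e₁ = solve-∀
    e₂ : ∀ a s → a * a + 2 * (a * s) + s * s ≡ (a + s) * (a + s)
    e₂ = solve-∀

  -- The classes are b = 0, the parts 1 and 2 of weight x₀ and x₁, and the T parts 3 + i of weight y i.
  module ClassEdges {T} (es : List (Fin T × Fin T × Fin T))
    (es-sorted : ∀ {t} → t ∈ es → SortedTriple t) (es-unique : Unique es) where

    shift : Fin T → Fin (3 + T)
    shift i = suc (suc (suc i))

    -- `loopEdges` takes b with any two different other classes, which covers bx₀x₁, bx₀Y, bx₁Y and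
    -- the triples bYY that meet two of the T classes. `starEdges` is x₀x₁Y.
    loopEdges starEdges sparseEdges ℰ : List (Fin (3 + T) × Fin (3 + T) × Fin (3 + T))
    loopEdges   = map (λ (d , e) → zero , suc d , suc e) (pairs (2 + T))
    starEdges   = map (λ i → 1F , 2F , shift i) (allFin T)
    sparseEdges = map (λ (i , j , k) → shift i , shift j , shift k) es
    ℰ           = loopEdges ++ (starEdges ++ sparseEdges)

    ℰ-sorted : ∀ {t} → t ∈ ℰ → SortedTriple t
    ℰ-sorted t∈ with ∈-++⁻ loopEdges t∈
    ... | inj₁ t∈₁ with ∈-map⁻ _ t∈₁
    ...   | _ , p∈ , refl = s≤s z≤n , s≤s (pairs-sorted (2 + T) p∈)
    ℰ-sorted t∈ | inj₂ t∈₁ with ∈-++⁻ starEdges t∈₁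
    ...   | inj₁ t∈₂ with ∈-map⁻ _ t∈₂
    ...     | _ , _ , refl = s≤s (s≤s z≤n) , s≤s (s≤s (s≤s z≤n))
    ℰ-sorted t∈ | inj₂ t∈₁ | inj₂ t∈₂ with ∈-map⁻ _ t∈₂
    ...     | _ , t∈₃ , refl = let i<j , j<k = es-sorted t∈₃ in s≤s (s≤s (s≤s i<j)) , s≤s (s≤s (s≤s j<k))

    ℰ-unique : Unique ℰ
    ℰ-unique = ++⁺ (map⁺ (λ { refl → refl }) (pairs-unique (2 + T)))
      (++⁺ (map⁺ (λ { refl → refl }) (allFin⁺ T)) (map⁺ (λ { refl → refl }) es-unique)
        λ (m₁ , m₂) → star≢sparse (∈-map⁻ _ m₁) (∈-map⁻ _ m₂))
      λ (m₁ , m₂) → loop≢ (∈-map⁻ _ m₁) (∈-++⁻ starEdges m₂)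
      where
      open import Data.Sum using (_⊎_)
      star≢sparse : ∀ {t} → ∃[ i ] (i ∈ allFin T × t ≡ (1F , 2F , shift i)) →
        ¬ (∃[ e ] (e ∈ es × t ≡ (shift (proj₁ e) , shift (proj₁ (proj₂ e)) , shift (proj₂ (proj₂ e)))))
      star≢sparse (_ , _ , refl) (_ , _ , ())
      loop≢ : ∀ {t} → ∃[ p ] (p ∈ pairs (2 + T) × t ≡ (zero , suc (proj₁ p) , suc (proj₂ p))) → ¬ (t ∈ starEdges ⊎ t ∈ sparseEdges)
      loop≢ (_ , _ , refl) (inj₁ m) with ∈-map⁻ _ m
      ... | _ , _ , ()
      loop≢ (_ , _ , refl) (inj₂ m) with ∈-map⁻ _ m
      ... | _ , _ , ()

    -- Twice the sum over pairs of classes other than b is the square of their total minus the sum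
    -- of squares. The squares of `x₀` and `x₁` cancel against those of the expansion; the squares
    -- of `y` stay as the loss caused by splitting.
    ∑ℰ : ∀ (m : Fin (3 + T) → ℕ) → let b = m 0F ; x₀ = m 1F ; x₁ = m 2F ; y = m ∘ shift ; Y = ∑ (allFin T) y in
      6 * ∑ ℰ (prodₜ m) + 3 * b * ∑ (allFin T) (λ i → y i * y i)
        ≡ 6 * (x₀ * x₁) * Y + 3 * b * (2 * (x₀ * x₁) + 2 * (x₀ + x₁) * Y + Y * Y) + 6 * ∑ es (prodₜ y)
    ∑ℰ m = begin
      6 * ∑ ℰ (prodₜ m) + 3 * b * s
        ≡⟨ cong (λ e → 6 * e + 3 * b * s) (trans (∑-++ loopEdges _ (prodₜ m)) (cong₂ _+_ loops
             (trans (∑-++ starEdges sparseEdges (prodₜ m)) (cong₂ _+_ stars (∑-map _ es (prodₜ m)))))) ⟩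
      6 * (b * P + (x₀ * x₁ * Y + Q)) + 3 * b * s
        ≡⟨ +-cancelʳ-≡ (3 * b * (x₀ * x₀ + x₁ * x₁)) _ _ (trans (e₁ b P x₀ x₁ Y Q s) (trans (cong (λ r → 6 * (x₀ * x₁ * Y + Q) + 3 * b * r) square) (e₂ b x₀ x₁ Y Q))) ⟩
      6 * (x₀ * x₁) * Y + 3 * b * (2 * (x₀ * x₁) + 2 * (x₀ + x₁) * Y + Y * Y) + 6 * Q ∎
      where
      open ≡-Reasoning
      b x₀ x₁ Y s Q P : ℕ
      b = m 0F
      x₀ = m 1F
      x₁ = m 2F
      Y = ∑ (allFin T) (m ∘ shift)
      s = ∑ (allFin T) (λ i → m (shift i) * m (shift i))
      Q = ∑ es (prodₜ (m ∘ shift))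
      P = ∑ (pairs (2 + T)) (λ (d , e) → m (suc d) * m (suc e))
      split : ∀ (f : Fin (2 + T) → ℕ) → ∑ (allFin (2 + T)) f ≡ f 0F + (f 1F + ∑ (allFin T) (λ i → f (suc (suc i))))
      split f = trans (∑-allFin (suc T) f) (cong (f 0F +_) (∑-allFin T (f ∘ suc)))
      square : 2 * P + (x₀ * x₀ + (x₁ * x₁ + s)) ≡ (x₀ + (x₁ + Y)) * (x₀ + (x₁ + Y))
      square = trans (cong (2 * P +_) (sym (split (λ d → m (suc d) * m (suc d)))))
        (trans (∑-pairs-square (2 + T) (m ∘ suc)) (cong (λ a → a * a) (split (m ∘ suc))))
      loops : ∑ loopEdges (prodₜ m) ≡ b * P
      loops = trans (∑-map _ (pairs (2 + T)) (prodₜ m)) (trans (∑-cong (pairs (2 + T)) (λ (d , e) → *-assoc b (m (suc d)) (m (suc e)))) (∑-*ˡ (pairs (2 + T)) b _))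
      stars : ∑ starEdges (prodₜ m) ≡ x₀ * x₁ * Y
      stars = trans (∑-map _ (allFin T) (prodₜ m)) (∑-*ˡ (allFin T) (x₀ * x₁) _)
      e₁ : ∀ b P x₀ x₁ Y Q s → 6 * (b * P + (x₀ * x₁ * Y + Q)) + 3 * b * s + 3 * b * (x₀ * x₀ + x₁ * x₁)
        ≡ 6 * (x₀ * x₁ * Y + Q) + 3 * b * (2 * P + (x₀ * x₀ + (x₁ * x₁ + s)))
      e₁ = solve-∀
      e₂ : ∀ b x₀ x₁ Y Q → 6 * (x₀ * x₁ * Y + Q) + 3 * b * ((x₀ + (x₁ + Y)) * (x₀ + (x₁ + Y)))
        ≡ 6 * (x₀ * x₁) * Y + 3 * b * (2 * (x₀ * x₁) + 2 * (x₀ + x₁) * Y + Y * Y) + 6 * Q + 3 * b * (x₀ * x₀ + x₁ * x₁)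
      e₂ = solve-∀

    ∑-classes : ∀ (m : Fin (3 + T) → ℕ) → ∑ (allFin (3 + T)) m ≡ m 1F + m 2F + ∑ (allFin T) (m ∘ shift) + m 0F
    ∑-classes m = trans (∑-allFin (2 + T) m) (trans (cong (m 0F +_) (trans (∑-allFin (1 + T) (m ∘ suc)) (cong (m 1F +_) (∑-allFin T (λ i → m (suc (suc i)))))))
      (lemma (m 0F) (m 1F) (m 2F) _))
      where
      lemma : ∀ b x y z → b + (x + (y + z)) ≡ x + y + z + b
      lemma = solve-∀

  module _ {n} (system : SparseSystem n) where
    open SparseSystem system
    open ClassEdges es sorted unique

    es-distinct : ∀ {t} → t ∈ es → Distinct t
    es-distinct t∈ = let i<j , j<k = sorted t∈ in Fin.<⇒≢ i<j , Fin.<⇒≢ (Fin.<-trans i<j j<k) , Fin.<⇒≢ j<k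

    module _ (u v : ℕ) (pell : u · u ≡ 5 · (v · v) + 1) (4≤v : 4 ≤ v) where

      -- The numbers of vertices of `H` in the classes are weights with sum `n`. So at most `n`
      -- classes are occupied, `Q-bounds` applies to the T classes, and `cubic-bound` gives the
      -- claim.
      upper : ∀ {N} (cl : Fin N → Fin (3 + T)) (H : Hypergraph 3 N) → H IsSubgraphOf ClassGraph.graph ℰ cl →
        Hypergraph.order H ≡ n → 12 · (v · v) · (n · n · n) + 121 · (v · v) · (6 · length (Hypergraph.E H)) ≤ (30 · u · v + 500) · (n · n · n)
      upper {N} cl H H⊆G order≡n = toℕ ((♯ 30 ⊗ Ι 0F ⊗ Ι 1F ⊕ ♯ 500) ⊗ n³) (♯ 12 ⊗ (Ι 1F ⊗ Ι 1F) ⊗ n³ ⊕ ♯ 121 ⊗ (Ι 1F ⊗ Ι 1F) ⊗ (♯ 6 ⊗ Ι 3F)) (by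
        (fromℕ ((♯ 30 ⊗ Ι 0F ⊗ Ι 1F ⊕ ♯ 500) ⊗ n³ ⊕ ♯ 121 ⊗ (Ι 1F ⊗ Ι 1F) ⊗ Ι 4F) (♯ 12 ⊗ (Ι 1F ⊗ Ι 1F) ⊗ n³ ⊕ ♯ 121 ⊗ (Ι 1F ⊗ Ι 1F) ⊗ Ι 5F) cubic
         +⁺ ♯⁺ {121} *⁺ (sq {Ι 1F} *⁺ fromℕ (Ι 5F) (♯ 6 ⊗ Ι 3F ⊕ Ι 4F) edges)) refl)
        where
        open ClassGraph ℰ cl using (count; E≤∑)
        m : Fin (3 + T) → ℕ
        m = count H H⊆G
        b x₀ x₁ Y s Q : ℕ
        b = m 0F
        x₀ = m 1F
        x₁ = m 2F
        Y = ∑ (allFin T) (m ∘ shift)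
        s = ∑ (allFin T) (λ i → m (shift i) * m (shift i))
        Q = ∑ es (prodₜ (m ∘ shift))
        poly = 6 · (x₀ · x₁) · Y + 3 · b · (2 · (x₀ · x₁) + 2 · (x₀ + x₁) · Y + Y · Y) + 6 · Q
        poly* = 6 * (x₀ * x₁) * Y + 3 * b * (2 * (x₀ * x₁) + 2 * (x₀ + x₁) * Y + Y * Y) + 6 * Q
        open NatPositivity (u ∷ v ∷ n ∷ length (Hypergraph.E H) ∷ 3 · b · s ∷ poly ∷ [])
        n³ : Poly 6
        n³ = Ι 2F ⊗ Ι 2F ⊗ Ι 2F
        ∑m≡n : x₀ + x₁ + Y + b ≡ n
        ∑m≡n = trans (sym (∑-classes m)) (trans (∑-swap (allFin (3 + T)) (allFin N) _)
          (trans (∑-cong (allFin N) (λ α → trans (∑-cong (allFin (3 + T)) (λ c → trans (*-comm (𝟙 (lookup (Hypergraph.V H) α)) _)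
            (cong (_* 𝟙 (lookup (Hypergraph.V H) α)) (𝟙-cong (cl α Fin.≟ c) (c Fin.≟ cl α) sym sym)))) (∑-δ (cl α) (λ _ → 𝟙 (lookup (Hypergraph.V H) α)))))
            (trans (∑-lookup (Hypergraph.V H)) order≡n)))
        Y≤n : Y ≤ n
        Y≤n = ≤-trans (m≤n+m Y (x₀ + x₁)) (≤-trans (m≤m+n _ b) (≤-reflexive ∑m≡n))
        bounds = Q-bounds es es-distinct sparse codegree≤8 4≤T (m ∘ shift) Y≤n
        cubic : 12 · (v · v) · (n · n · n) + 121 · (v · v) · poly ≤ (30 · u · v + 500) · (n · n · n) + 121 · (v · v) · (3 · b · s)
        cubic = subst (λ S → 12 · (v · v) · (S · S · S) + 121 · (v · v) · poly ≤ (30 · u · v + 500) · (S · S · S) + 121 · (v · v) · (3 · b · s)) ∑m≡n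
          (cubic-bound u v x₀ x₁ b Y s Q pell 4≤v (proj₁ bounds) (proj₁ (proj₂ bounds)) (proj₂ (proj₂ bounds)))
        opaque
          unfolding _·_
          poly≡ : poly ≡ poly*
          poly≡ = refl
          edges* : ∀ {e f} → e ≤ f → 6 · e + 3 · b · s ≤ 6 * f + 3 * b * s
          edges* e≤f = +-monoˡ-≤ (3 * b * s) (*-monoʳ-≤ 6 e≤f)
        edges : 6 · length (Hypergraph.E H) + 3 · b · s ≤ poly
        edges = ≤-trans (edges* (E≤∑ H H⊆G)) (≤-reflexive (trans (∑ℰ m) (sym poly≡)))

      -- The class sizes u T : v T : v T : u + v (T times) approximate the optimal ratio √5 : 1 : 1 : 1 + √5.
      module Lower (T≤v : T ≤ v) where

        weight : Fin (3 + T) → ℕ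
        weight 0F                  = u * T
        weight 1F                  = v * T
        weight 2F                  = v * T
        weight (suc (suc (suc _))) = u + v

        S₁ E₁ : ℕ
        S₁ = ∑ (allFin (3 + T)) weight
        E₁ = ∑ ℰ (prodₜ weight)

        module Scaled (j : ℕ) where

          N : ℕ
          N = total (3 + T) (λ c → weight c * j)

          cl : Fin N → Fin (3 + T)
          cl = classOf (3 + T) (λ c → weight c * j)

          N≡ : N ≡ S₁ * j
          N≡ = trans (sym (trans (trans (∑-const (allFin N) 1) (*-identityʳ _)) (length-allFin N)))
            (trans (∑-classOf (3 + T) (λ c → weight c * j) (λ _ → 1))
              (trans (∑-cong (allFin (3 + T)) (λ c → *-identityʳ (weight c * j))) (∑-*ʳ (allFin (3 + T)) j weight)))

          E₁≤ : E₁ * (j * j * j) ≤ length (Hypergraph.E (ClassGraph.graph ℰ cl))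
          E₁≤ = ≤-trans (≤-reflexive (trans (sym (∑-*ʳ ℰ (j * j * j) (prodₜ weight))) (∑-cong ℰ (λ (c , d , e) → lemma (weight c) (weight d) (weight e) j))))
            (ClassGraph.∑≤E ℰ cl ℰ-sorted ℰ-unique (λ {α} {β} → classOf-monotone (3 + T) (λ c → weight c * j) {α} {β})
              (λ c → weight c * j) (λ c → trans (∑-classOf (3 + T) (λ c → weight c * j) (λ d → 𝟙 (does (d Fin.≟ c))))
                (trans (∑-cong (allFin (3 + T)) (λ d → *-comm (weight d * j) _)) (∑-δ c (λ d → weight d * j)))))
            where
            lemma : ∀ a b c j → a * b * c * (j * j * j) ≡ a * j * (b * j) * (c * j)
            lemma = solve-∀

        S₁≡ : S₁ ≡ v * T + v * T + T * (u + v) + u * T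
        S₁≡ = trans (∑-classes weight) (cong (λ Y → v * T + v * T + Y + u * T) (trans (∑-const (allFin T) (u + v)) (cong (_* (u + v)) (length-allFin T))))

        -- The density of the weighted pattern exceeds α taken at `u / v`. The gain 6 l (u + v)³
        -- with 5 l ≥ 2 T² exceeds the loss 3 u T² (u + v)² by at least (3/5) T² (u + v)² (4 v - u).
        -- The error from u² - 5 v² = 1 is of order T³ v², and T ≤ v keeps it below the surplus.
        E₁-surplus : 30 · u · (S₁ · S₁ · S₁) + 1 ≤ 121 · v · (6 · E₁) + 12 · v · (S₁ · S₁ · S₁)
        E₁-surplus = subst (λ S → 30 · u · (S · S · S) + 1 ≤ 121 · v · (6 · E₁) + 12 · v · (S · S · S)) (trans (opaque-S) (sym S₁≡))
          (toℕ (♯ 121 ⊗ vₑ ⊗ (♯ 6 ⊗ Eₑ) ⊕ ♯ 12 ⊗ vₑ ⊗ (Sₑ ⊗ Sₑ ⊗ Sₑ)) (♯ 30 ⊗ uₑ ⊗ (Sₑ ⊗ Sₑ ⊗ Sₑ) ⊕ ♯ 1) surplus)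
          where
          l : ℕ
          l = length es
          open NatPositivity (u ∷ v ∷ T ∷ l ∷ E₁ ∷ [])
          uₑ vₑ Tₑ lₑ Eₑ Sₑ Xₑ Yₑ bₑ wₑ : Poly 5
          uₑ = Ι 0F
          vₑ = Ι 1F
          Tₑ = Ι 2F
          lₑ = Ι 3F
          Eₑ = Ι 4F
          bₑ = uₑ ⊗ Tₑ
          Xₑ = vₑ ⊗ Tₑ
          wₑ = uₑ ⊕ vₑ
          Yₑ = Tₑ ⊗ wₑ
          Sₑ = Xₑ ⊕ Xₑ ⊕ Yₑ ⊕ bₑ
          opaque
            unfolding _·_
            opaque-S : v · T + v · T + T · (u + v) + u · T ≡ v * T + v * T + T * (u + v) + u * T
            opaque-S = refl
            opaque-edges : 6 * E₁ + 3 * (u * T) * (T * ((u + v) * (u + v)))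
                ≡ 6 * (v * T * (v * T)) * (T * (u + v))
                  + 3 * (u * T) * (2 * (v * T * (v * T)) + 2 * (v * T + v * T) * (T * (u + v)) + T * (u + v) * (T * (u + v)))
                  + 6 * (l * ((u + v) * (u + v) * (u + v))) →
              6 · (v · T · (v · T)) · (T · (u + v))
                  + 3 · (u · T) · (2 · (v · T · (v · T)) + 2 · (v · T + v · T) · (T · (u + v)) + T · (u + v) · (T · (u + v)))
                  + 6 · (l · ((u + v) · (u + v) · (u + v)))
                ≤ 6 · E₁ + 3 · (u · T) · (T · ((u + v) · (u + v)))
            opaque-edges eq = ≤-reflexive (sym eq)
            opaque-large : 2 · (T · T) ≤ 5 · l
            opaque-large = large
          constant : ∀ c → ∑ (allFin T) (λ _ → c) ≡ T * c
          constant c = trans (∑-const (allFin T) c) (cong (_* c) (length-allFin T))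
          edges : 0≤ ♯ 6 ⊗ Eₑ ⊕ ♯ 3 ⊗ bₑ ⊗ (Tₑ ⊗ (wₑ ⊗ wₑ)) ⊖
            (♯ 6 ⊗ (Xₑ ⊗ Xₑ) ⊗ Yₑ ⊕ ♯ 3 ⊗ bₑ ⊗ (♯ 2 ⊗ (Xₑ ⊗ Xₑ) ⊕ ♯ 2 ⊗ (Xₑ ⊕ Xₑ) ⊗ Yₑ ⊕ Yₑ ⊗ Yₑ) ⊕ ♯ 6 ⊗ (lₑ ⊗ (wₑ ⊗ wₑ ⊗ wₑ)))
          edges = fromℕ (♯ 6 ⊗ Eₑ ⊕ ♯ 3 ⊗ bₑ ⊗ (Tₑ ⊗ (wₑ ⊗ wₑ)))
            (♯ 6 ⊗ (Xₑ ⊗ Xₑ) ⊗ Yₑ ⊕ ♯ 3 ⊗ bₑ ⊗ (♯ 2 ⊗ (Xₑ ⊗ Xₑ) ⊕ ♯ 2 ⊗ (Xₑ ⊕ Xₑ) ⊗ Yₑ ⊕ Yₑ ⊗ Yₑ) ⊕ ♯ 6 ⊗ (lₑ ⊗ (wₑ ⊗ wₑ ⊗ wₑ)))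
            (opaque-edges (trans (cong (λ c → 6 * E₁ + 3 * (u * T) * c) (sym (constant ((u + v) * (u + v)))))
              (trans (∑ℰ weight) (cong₂ (λ Y c → 6 * (v * T * (v * T)) * Y + 3 * (u * T) * (2 * (v * T * (v * T)) + 2 * (v * T + v * T) * Y + Y * Y) + 6 * c)
                (constant (u + v)) (∑-const es ((u + v) * (u + v) * (u + v)))))))
          4≤v⁺ : 0≤ vₑ ⊖ ♯ 4
          4≤v⁺ = fromℕ vₑ (♯ 4) 4≤v
          v⁺ = var⁺ 1F
          T⁺ = var⁺ 2F
          N⁺ : 0≤ ♯ 240 ⊗ uₑ ⊗ uₑ ⊕ ♯ 621 ⊗ uₑ ⊗ vₑ ⊕ ♯ 210 ⊗ vₑ ⊗ vₑ
          N⁺ = by (♯⁺ {240} *⁺ sq {uₑ} +⁺ ♯⁺ {621} *⁺ (var⁺ 0F *⁺ v⁺) +⁺ ♯⁺ {210} *⁺ sq {vₑ}) refl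
          T²v³≥1 : 0≤ Tₑ ⊗ Tₑ ⊗ (vₑ ⊗ vₑ ⊗ vₑ) ⊖ ♯ 1
          T²v³≥1 = by (fromℕ Tₑ (♯ 1) (≤-trans (s≤s z≤n) 4≤T) *⁺ (T⁺ +⁺ ♯⁺ {1}) *⁺ (v⁺ *⁺ v⁺ *⁺ v⁺)
            +⁺ (4≤v⁺ +⁺ ♯⁺ {3}) *⁺ (v⁺ *⁺ v⁺ +⁺ v⁺ +⁺ ♯⁺ {1})) refl
          surplus : 0≤ ♯ 121 ⊗ vₑ ⊗ (♯ 6 ⊗ Eₑ) ⊕ ♯ 12 ⊗ vₑ ⊗ (Sₑ ⊗ Sₑ ⊗ Sₑ) ⊖ (♯ 30 ⊗ uₑ ⊗ (Sₑ ⊗ Sₑ ⊗ Sₑ) ⊕ ♯ 1)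
          surplus = cancel♯ 19 (by
            (♯⁺ {2420} *⁺ (v⁺ *⁺ edges)
             +⁺ ♯⁺ {2904} *⁺ (v⁺ *⁺ ((var⁺ 0F +⁺ v⁺) *⁺ (var⁺ 0F +⁺ v⁺) *⁺ (var⁺ 0F +⁺ v⁺)) *⁺ fromℕ (♯ 5 ⊗ lₑ) (♯ 2 ⊗ (Tₑ ⊗ Tₑ)) opaque-large)
             +⁺ ♯⁺ {20} *⁺ ((T⁺ *⁺ T⁺ *⁺ T⁺) *⁺ N⁺ *⁺ fromℕ (♯ 5 ⊗ (vₑ ⊗ vₑ) ⊕ ♯ 1) (uₑ ⊗ uₑ) (≤-reflexive pell))
             +⁺ ♯⁺ {20} *⁺ (sq {Tₑ} *⁺ N⁺ *⁺ fromℕ vₑ Tₑ T≤v)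
             +⁺ sq {Tₑ} *⁺ v⁺ *⁺ (♯⁺ {363} *⁺ (sq {wₑ} *⁺ fromℕ (♯ 9 ⊗ vₑ) (♯ 4 ⊗ uₑ) (pell-ratio u v pell 4≤v))
                                  +⁺ ♯⁺ {2541} *⁺ (sq {wₑ} *⁺ 4≤v⁺)
                                  +⁺ ♯⁺ {5364} *⁺ sq {uₑ} +⁺ ♯⁺ {7908} *⁺ (var⁺ 0F *⁺ v⁺) +⁺ ♯⁺ {5944} *⁺ sq {vₑ})
             +⁺ ♯⁺ {20} *⁺ T²v³≥1) refl)

-- Comparison of the real number α with rational numbers.

module Levels where

  open import Defs
  open import Data.Empty using (⊥-elim)
  open import Data.Integer as ℤ using (+_)
  import Data.Integer.Properties as ℤₚ
  open import Data.Nat as ℕ using (ℕ; suc)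
  import Data.Nat.Properties as ℕₚ
  open import Data.Product using (_×_; _,_; ∃-syntax)
  open import Data.Rational hiding (∣_∣; _⊔_; _⊓_)
  open import Data.Rational.Properties
  open import Data.Rational.Solver using (module +-*-Solver)
  import Data.Rational.Unnormalised as ℚᵘ
  import Data.Rational.Unnormalised.Properties as ℚᵘₚ
  open import Data.Sum using ([_,_]′)
  open import Function using (id; _∘_)
  open import Relation.Binary.PropositionalEquality
  open import Relation.Nullary using (¬_; yes; no; contradiction)
  open ℝ

  α : ℝ
  α = (+ 6 / 121) ·ᴿ ((+ 5 / 1) ·ᴿ √ (+ 5 / 1) -ᴿ fromℚ (+ 2 / 1))

  opaque
    level : ℚ → ℚ
    level d = (+ 6 / 121) * ((+ 5 / 1) * d - (+ 2 / 1))

    level≡ : ∀ d → level d ≡ (+ 6 / 121) * ((+ 5 / 1) * d - (+ 2 / 1))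
    level≡ d = refl

  ≤⇒≯ : ∀ {p q} → p ≤ q → ¬ q < p
  ≤⇒≯ p≤q q<p = <-irrefl refl (≤-<-trans p≤q q<p)

  square-cancel : ∀ {d e} → 0ℚ < d → e * e ≤ d * d → e ≤ d
  square-cancel {d} {e} 0<d e²≤d² with e ≤? d
  ... | yes e≤d = e≤d
  ... | no  e≰d = contradiction (<-trans (*-monoʳ-<-pos d {{positive 0<d}} d<e)
      (*-monoˡ-<-pos e {{positive (<-trans 0<d d<e)}} d<e)) (≤⇒≯ e²≤d²)
    where
    d<e : d < e
    d<e = ≰⇒> e≰d

  L-α⁻ : ∀ {q} → L α q → ∃[ e ] (e * e ≤ (+ 5 / 1) × q < level e)
  L-α⁻ (a , (a′ , b′ , (a″ , (e , e²≤5 , a″<e) , a′<5a″) , 2<-b′ , a<a′+b′) , q<) =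
    e , e²≤5 , subst (_ <_) (sym (level≡ e)) (<-trans q< (*-monoʳ-<-pos (+ 6 / 121) (<-trans a<a′+b′
      (+-mono-< (<-trans a′<5a″ (*-monoʳ-<-pos (+ 5 / 1) a″<e)) b′<-2))))
    where
    open +-*-Solver
    b′<-2 : b′ < - (+ 2 / 1)
    b′<-2 = subst (_< - (+ 2 / 1)) (solve 1 (λ x → :- (:- x) := x) refl b′) (neg-antimono-< 2<-b′)

  U-α⁻ : ∀ {q} → U α q → ∃[ e ] (0ℚ < e × (+ 5 / 1) ≤ e * e × level e < q)
  U-α⁻ (a , (a′ , b′ , (a″ , (e , 0<e , 5≤e² , e<a″) , 5a″<a′) , -b′<2 , a′+b′<a) , <q) =
    e , 0<e , 5≤e² , subst (_< _) (sym (level≡ e)) (<-trans (*-monoʳ-<-pos (+ 6 / 121) (<-trans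
      (+-mono-< (<-trans (*-monoʳ-<-pos (+ 5 / 1) e<a″) 5a″<a′) -2<b′) a′+b′<a)) <q)
    where
    open +-*-Solver
    -2<b′ : - (+ 2 / 1) < b′
    -2<b′ = subst (- (+ 2 / 1) <_) (solve 1 (λ x → :- (:- x) := x) refl b′) (neg-antimono-< -b′<2)

  level-mono-≤ : ∀ {d e} → 0ℚ < e → d * d ≤ (+ 5 / 1) → (+ 5 / 1) ≤ e * e → level d ≤ level e
  level-mono-≤ {d} {e} 0<e d²≤5 5≤e² = subst₂ _≤_ (sym (level≡ d)) (sym (level≡ e)) (*-monoˡ-≤-nonNeg (+ 6 / 121)
    (+-monoˡ-≤ (- (+ 2 / 1)) (*-monoˡ-≤-nonNeg (+ 5 / 1) (square-cancel {e} {d} 0<e (≤-trans d²≤5 5≤e²)))))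

  -- No witnesses for the nested cuts are built: at a rational between `q` and `level d` locatedness
  -- leaves membership in the lower cut, as membership in the upper cut contradicts `U-α⁻`.
  L-α⁺ : ∀ {d q} → d * d ≤ (+ 5 / 1) → q < level d → L α q
  L-α⁺ {d} {q} d²≤5 q< = let m , q<m , m< = <-dense q< in [ id , ⊥-elim ∘ absurd m m< ]′ (located α q<m)
    where
    absurd : ∀ m → m < level d → ¬ U α m
    absurd m m< Um = let e , 0<e , 5≤e² , <m = U-α⁻ Um in ≤⇒≯ (level-mono-≤ {d} {e} 0<e d²≤5 5≤e²) (<-trans <m m<)

  U-α⁺ : ∀ {d q} → 0ℚ < d → (+ 5 / 1) ≤ d * d → level d < q → U α q
  U-α⁺ {d} {q} 0<d 5≤d² <q = let m , <m , m<q = <-dense <q in [ ⊥-elim ∘ absurd m <m , id ]′ (located α m<q)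
    where
    absurd : ∀ m → level d < m → ¬ L α m
    absurd m <m Lm = let e , e²≤5 , m< = L-α⁻ Lm in ≤⇒≯ (level-mono-≤ {e} {d} 0<d e²≤5 5≤d²) (<-trans <m m<)

  0≤α : 0ᴿ ≤ᴿ α
  0≤α q q<0 = L-α⁺ {+ 2 / 1} (*≤* (ℤ.+≤+ (ℕₚ.≤ᵇ⇒≤ 4 5 _))) (<-trans q<0 (subst (0ℚ <_) (sym (level≡ (+ 2 / 1))) (*<* (ℤ.+<+ (ℕₚ.≤ᵇ⇒≤ 1 48 _)))))

  α<1 : α <ᴿ 1ᴿ
  α<1 = + 1 / 2 , U-α⁺ {+ 9 / 4} (*<* (ℤ.+<+ (ℕₚ.≤ᵇ⇒≤ 1 9 _))) (*≤* (ℤ.+≤+ (ℕₚ.≤ᵇ⇒≤ 80 81 _)))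
    (subst (_< + 1 / 2) (sym (level≡ (+ 9 / 4))) (*<* (ℤ.+<+ (ℕₚ.<ᵇ⇒< 222 242 _)))) , *<* (ℤ.+<+ (ℕₚ.≤ᵇ⇒≤ 2 2 _))

  opaque
    ι : ℕ → ℚ
    ι n = + n / 1

    ι≡ : ∀ n → ι n ≡ + n / 1
    ι≡ n = refl

    toℚᵘ-ι : ∀ n → toℚᵘ (ι n) ℚᵘ.≃ ℚᵘ.mkℚᵘ (+ n) 0
    toℚᵘ-ι n = toℚᵘ-fromℚᵘ (ℚᵘ.mkℚᵘ (+ n) 0)

  ι-+ : ∀ m n → ι (m ℕ.+ n) ≡ ι m + ι n
  ι-+ m n = toℚᵘ-injective (ℚᵘₚ.≃-trans (toℚᵘ-ι (m ℕ.+ n)) (ℚᵘₚ.≃-trans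
    (ℚᵘ.*≡* (cong (ℤ._* + 1) (sym (cong₂ ℤ._+_ (ℤₚ.*-identityʳ (+ m)) (ℤₚ.*-identityʳ (+ n))))))
    (ℚᵘₚ.≃-sym (ℚᵘₚ.≃-trans (toℚᵘ-homo-+ (ι m) (ι n)) (ℚᵘₚ.+-cong (toℚᵘ-ι m) (toℚᵘ-ι n))))))

  ι-* : ∀ m n → ι (m ℕ.* n) ≡ ι m * ι n
  ι-* m n = toℚᵘ-injective (ℚᵘₚ.≃-trans (toℚᵘ-ι (m ℕ.* n)) (ℚᵘₚ.≃-trans
    (ℚᵘ.*≡* (cong (ℤ._* + 1) (ℤₚ.pos-* m n)))
    (ℚᵘₚ.≃-sym (ℚᵘₚ.≃-trans (toℚᵘ-homo-* (ι m) (ι n)) (ℚᵘₚ.*-cong (toℚᵘ-ι m) (toℚᵘ-ι n))))))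

  ι-< : ∀ {m n} → m ℕ.< n → ι m < ι n
  ι-< {m} {n} m<n = toℚᵘ-cancel-< (ℚᵘₚ.<-respˡ-≃ (ℚᵘₚ.≃-sym (toℚᵘ-ι m)) (ℚᵘₚ.<-respʳ-≃ (ℚᵘₚ.≃-sym (toℚᵘ-ι n))
    (ℚᵘ.*<* (subst₂ ℤ._<_ (sym (ℤₚ.*-identityʳ (+ m))) (sym (ℤₚ.*-identityʳ (+ n))) (ℤ.+<+ m<n)))))

  ι-≤ : ∀ {m n} → m ℕ.≤ n → ι m ≤ ι n
  ι-≤ {m} {n} m≤n = toℚᵘ-cancel-≤ (ℚᵘₚ.≤-respˡ-≃ (ℚᵘₚ.≃-sym (toℚᵘ-ι m)) (ℚᵘₚ.≤-respʳ-≃ (ℚᵘₚ.≃-sym (toℚᵘ-ι n))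
    (ℚᵘ.*≤* (subst₂ ℤ._≤_ (sym (ℤₚ.*-identityʳ (+ m))) (sym (ℤₚ.*-identityʳ (+ n))) (ℤ.+≤+ m≤n)))))

  ι-frac : ∀ a b .{{_ : ℕ.NonZero b}} → ι b * (+ a / b) ≡ ι a
  ι-frac a b@(suc b′) = toℚᵘ-injective (ℚᵘₚ.≃-trans (toℚᵘ-homo-* (ι b) (+ a / b)) (ℚᵘₚ.≃-trans
    (ℚᵘₚ.*-cong (toℚᵘ-ι b) (toℚᵘ-fromℚᵘ (ℚᵘ.mkℚᵘ (+ a) b′)))
    (ℚᵘₚ.≃-trans (ℚᵘ.*≡* (trans (ℤₚ.*-identityʳ (+ b ℤ.* + a)) (trans (ℤₚ.*-comm (+ b) (+ a)) (cong (λ c → + a ℤ.* + c) (sym (ℕₚ.*-identityˡ b))))))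
      (ℚᵘₚ.≃-sym (toℚᵘ-ι a)))))

  ι-nonNeg : ∀ n → NonNegative (ι n)
  ι-nonNeg n = nonNegative (subst (_≤ ι n) (ι≡ 0) (ι-≤ ℕ.z≤n))

  -- Clears denominators; the summand `c` outweighs the negative constant in `level`, so that both
  -- sides are natural numbers.
  cross-< : ∀ P c x y .{{_ : NonNegative P}} {m n} → P * x + c ≡ ι m → P * y + c ≡ ι n → m ℕ.< n → x < y
  cross-< P c x y Px Py m<n = *-cancelˡ-<-nonNeg P (subst₂ _<_ (e (P * x) c) (e (P * y) c)
    (+-monoˡ-< (- c) (subst₂ _<_ (sym Px) (sym Py) (ι-< m<n))))
    where
    open +-*-Solver
    e : ∀ a c → a + c - c ≡ a
    e = solve 2 (λ a c → a :+ c :- c := a) refl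

  cross-≤ : ∀ P x y .{{_ : Positive P}} {m n} → P * x ≡ ι m → P * y ≡ ι n → m ℕ.≤ n → x ≤ y
  cross-≤ P x y Px Py m≤n = *-cancelˡ-≤-pos P (subst₂ _≤_ (sym Px) (sym Py) (ι-≤ m≤n))

  ι-pos : ∀ n .{{_ : ℕ.NonZero n}} → Positive (ι n)
  ι-pos n@(suc _) = positive (subst (_< ι n) (ι≡ 0) (ι-< (ℕ.s≤s ℕ.z≤n)))

  -- `121 level d = 30 d − 12`, with 30 = 6 · 5 and 12 = 6 · 2, multiplied by `K` and freed of
  -- subtraction.
  level-scaled : ∀ K d → ι 121 * (K * level d) + ι 12 * K ≡ ι 30 * (K * d)
  level-scaled K d = trans (cong₂ (λ l t → ι 121 * (K * l) + t * K) (level≡ d) 12≡)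
    (trans (identity (ι 121) (+ 6 / 121) (+ 5 / 1) (+ 2 / 1) K d) (cong (_* (K * d)) 30≡))
    where
    open +-*-Solver
    12≡ : ι 12 ≡ ι 121 * (+ 6 / 121) * (+ 2 / 1)
    12≡ = trans (ι≡ 12) (cong (λ c → c * (+ 6 / 121) * (+ 2 / 1)) (sym (ι≡ 121)))
    30≡ : ι 121 * (+ 6 / 121) * (+ 5 / 1) ≡ ι 30
    30≡ = trans (cong (λ c → c * (+ 6 / 121) * (+ 5 / 1)) (ι≡ 121)) (sym (ι≡ 30))
    identity : ∀ a s f t K d → a * (K * (s * (f * d - t))) + a * s * t * K ≡ a * s * f * (K * d)
    identity = solve 6 (λ a s f t K d → a :* (K :* (s :* (f :* d :- t))) :+ a :* s :* t :* K := a :* s :* f :* (K :* d)) refl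

  module _ (u v : ℕ) .{{_ : ℕ.NonZero v}} where

    private
      d V : ℚ
      d = + u / v
      V = ι v

      square : V * V * (d * d) ≡ ι (u ℕ.* u)
      square = trans (solve 2 (λ V d → V :* V :* (d :* d) := V :* d :* (V :* d)) refl V d)
        (trans (cong₂ _*_ (ι-frac u v) (ι-frac u v)) (sym (ι-* u u)))
        where open +-*-Solver

      five : V * V * (+ 5 / 1) ≡ ι (5 ℕ.* (v ℕ.* v))
      five = trans (*-comm (V * V) (+ 5 / 1)) (trans (cong₂ _*_ (sym (ι≡ 5)) (sym (ι-* v v))) (sym (ι-* 5 (v ℕ.* v))))

      instance
        V²-pos : Positive (V * V)
        V²-pos = pos*pos⇒pos V {{ι-pos v}} V {{ι-pos v}}

    5≤frac² : 5 ℕ.* (v ℕ.* v) ℕ.≤ u ℕ.* u → (+ 5 / 1) ≤ d * d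
    5≤frac² = cross-≤ (V * V) (+ 5 / 1) (d * d) five square

    frac²≤5 : u ℕ.* u ℕ.≤ 5 ℕ.* (v ℕ.* v) → d * d ≤ (+ 5 / 1)
    frac²≤5 = cross-≤ (V * V) (d * d) (+ 5 / 1) square five

    frac-pos : .{{_ : ℕ.NonZero u}} → 0ℚ < d
    frac-pos = cross-< V 0ℚ 0ℚ d {{ι-nonNeg v}} (trans (solve 1 (λ V → V :* con 0ℚ :+ con 0ℚ := con 0ℚ) refl V) (sym (ι≡ 0)))
      (trans (+-identityʳ (V * d)) (ι-frac u v)) (ℕ.>-nonZero⁻¹ u)
      where open +-*-Solver

    level<frac : ∀ A B .{{_ : ℕ.NonZero B}} → 30 ℕ.* (u ℕ.* B) ℕ.< 121 ℕ.* (v ℕ.* A) ℕ.+ 12 ℕ.* (v ℕ.* B) → level d < + A / B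
    level<frac A B = cross-< (ι 121 * K) (ι 12 * K) (level d) ρ {{0≤P}}
      (begin
        ι 121 * K * level d + ι 12 * K   ≡⟨ cong (_+ ι 12 * K) (*-assoc (ι 121) K (level d)) ⟩
        ι 121 * (K * level d) + ι 12 * K ≡⟨ level-scaled K d ⟩
        ι 30 * (V * W * d)               ≡⟨ cong (ι 30 *_) (trans (rotate V W d) (cong (_* W) (ι-frac u v))) ⟩
        ι 30 * (ι u * W)                 ≡⟨ trans (cong (ι 30 *_) (sym (ι-* u B))) (sym (ι-* 30 (u ℕ.* B))) ⟩
        ι (30 ℕ.* (u ℕ.* B)) ∎)
      (begin
        ι 121 * K * ρ + ι 12 * K
          ≡⟨ cong₂ _+_ (trans (*-assoc (ι 121) K ρ) (cong (ι 121 *_) (trans (*-assoc V W ρ) (trans (cong (V *_) (ι-frac A B)) (sym (ι-* v A))))))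
               (cong (ι 12 *_) (sym (ι-* v B))) ⟩
        ι 121 * ι (v ℕ.* A) + ι 12 * ι (v ℕ.* B)
          ≡⟨ cong₂ _+_ (sym (ι-* 121 (v ℕ.* A))) (sym (ι-* 12 (v ℕ.* B))) ⟩
        ι (121 ℕ.* (v ℕ.* A)) + ι (12 ℕ.* (v ℕ.* B))
          ≡⟨ ι-+ (121 ℕ.* (v ℕ.* A)) (12 ℕ.* (v ℕ.* B)) ⟨
        ι (121 ℕ.* (v ℕ.* A) ℕ.+ 12 ℕ.* (v ℕ.* B)) ∎)
      where
      open ≡-Reasoning
      W ρ K : ℚ
      W = ι B
      ρ = + A / B
      K = V * W
      0≤P : NonNegative (ι 121 * K)
      0≤P = nonNeg*nonNeg⇒nonNeg (ι 121) {{ι-nonNeg 121}} K {{nonNeg*nonNeg⇒nonNeg V {{ι-nonNeg v}} W {{ι-nonNeg B}}}}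
      rotate : ∀ V W d → V * W * d ≡ V * d * W
      rotate V W d = trans (*-assoc V W d) (trans (cong (V *_) (*-comm W d)) (sym (*-assoc V d W)))

    -- g stands for a lower bound 1/J on the gap δ.
    frac<level+ : ∀ E C J g .{{_ : ℕ.NonZero C}} → ι J * g ≡ ι 1 →
      121 ℕ.* (v ℕ.* (J ℕ.* E)) ℕ.+ 12 ℕ.* (v ℕ.* (J ℕ.* C)) ℕ.< 30 ℕ.* (u ℕ.* (J ℕ.* C)) ℕ.+ 121 ℕ.* (v ℕ.* C) →
      + E / C < level d + g
    frac<level+ E C J g Jg≡1 = cross-< (ι 121 * K) (ι 12 * K) ρ (level d + g) {{0≤P}}
      (begin
        ι 121 * K * ρ + ι 12 * K
          ≡⟨ cong₂ _+_ (trans (*-assoc (ι 121) K ρ) (cong (ι 121 *_) (trans (assoc₃ V (ι J) W ρ) (trans (cong (λ r → V * (ι J * r)) (ι-frac E C)) (ι₃ v J E)))))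
               (cong (ι 12 *_) (trans (*-assoc V (ι J) W) (ι₃ v J C))) ⟩
        ι 121 * ι (v ℕ.* (J ℕ.* E)) + ι 12 * ι (v ℕ.* (J ℕ.* C))
          ≡⟨ cong₂ _+_ (sym (ι-* 121 _)) (sym (ι-* 12 _)) ⟩
        ι (121 ℕ.* (v ℕ.* (J ℕ.* E))) + ι (12 ℕ.* (v ℕ.* (J ℕ.* C)))
          ≡⟨ ι-+ _ _ ⟨
        ι (121 ℕ.* (v ℕ.* (J ℕ.* E)) ℕ.+ 12 ℕ.* (v ℕ.* (J ℕ.* C))) ∎)
      (begin
        ι 121 * K * (level d + g) + ι 12 * K                     ≡⟨ distribute (ι 121) (ι 12) K (level d) g ⟩
        ι 121 * (K * level d) + ι 12 * K + ι 121 * (K * g)       ≡⟨ cong₂ _+_ (level-scaled K d) (cong (ι 121 *_) (collect V (ι J) W g)) ⟩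
        ι 30 * (K * d) + ι 121 * (V * (ι J * g * W))
          ≡⟨ cong₂ (λ a b → ι 30 * a + ι 121 * (V * (b * W))) (trans (gather V (ι J) W d) (cong (_* (ι J * W)) (ι-frac u v))) Jg≡1 ⟩
        ι 30 * (ι u * (ι J * W)) + ι 121 * (V * (ι 1 * W))
          ≡⟨ cong₂ (λ a b → ι 30 * a + ι 121 * (V * b)) (ι₃ u J C) (trans (sym (ι-* 1 C)) (cong ι (ℕₚ.*-identityˡ C))) ⟩
        ι 30 * ι (u ℕ.* (J ℕ.* C)) + ι 121 * (V * W)
          ≡⟨ cong₂ _+_ (sym (ι-* 30 _)) (trans (cong (ι 121 *_) (sym (ι-* v C))) (sym (ι-* 121 _))) ⟩
        ι (30 ℕ.* (u ℕ.* (J ℕ.* C))) + ι (121 ℕ.* (v ℕ.* C))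
          ≡⟨ ι-+ _ _ ⟨
        ι (30 ℕ.* (u ℕ.* (J ℕ.* C)) ℕ.+ 121 ℕ.* (v ℕ.* C)) ∎)
      where
      open ≡-Reasoning
      W ρ K : ℚ
      W = ι C
      ρ = + E / C
      K = V * ι J * W
      0≤P : NonNegative (ι 121 * K)
      0≤P = nonNeg*nonNeg⇒nonNeg (ι 121) {{ι-nonNeg 121}} K
        {{nonNeg*nonNeg⇒nonNeg (V * ι J) {{nonNeg*nonNeg⇒nonNeg V {{ι-nonNeg v}} (ι J) {{ι-nonNeg J}}}} W {{ι-nonNeg C}}}}
      ι₃ : ∀ a b c → ι a * (ι b * ι c) ≡ ι (a ℕ.* (b ℕ.* c))
      ι₃ a b c = trans (cong (ι a *_) (sym (ι-* b c))) (sym (ι-* a (b ℕ.* c)))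
      open +-*-Solver
      assoc₃ : ∀ a b c d → a * b * c * d ≡ a * (b * (c * d))
      assoc₃ = solve 4 (λ a b c d → a :* b :* c :* d := a :* (b :* (c :* d))) refl
      distribute : ∀ a e K l g → a * K * (l + g) + e * K ≡ a * (K * l) + e * K + a * (K * g)
      distribute = solve 5 (λ a e K l g → a :* K :* (l :+ g) :+ e :* K := a :* (K :* l) :+ e :* K :+ a :* (K :* g)) refl
      collect : ∀ V J W g → V * J * W * g ≡ V * (J * g * W)
      collect = solve 4 (λ V J W g → V :* J :* W :* g := V :* (J :* g :* W)) refl
      gather : ∀ V J W d → V * J * W * d ≡ V * d * (J * W)
      gather = solve 4 (λ V J W d → V :* J :* W :* d := V :* d :* (J :* W)) refl

-- The contradiction with a jump at α.

module NonJump where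

  open import Defs
  open IntegerPolynomials
  open FiniteSums
  open WeightBounds
  open RandomSubsets
  open SparseTripleSystems
  open ClassGraphs
  open BlowUps
  open Levels
  open import Data.Empty using (⊥)
  open import Data.Fin as Fin using (zero; suc)
  open import Data.Fin.Patterns
  open import Data.Fin.Subset.Properties using (∣⊤∣≡n)
  open import Data.Integer as ℤ using (+_; -[1+_])
  open import Data.List using (length)
  open import Data.Nat as ℕ using (ℕ; zero; suc; _+_; _*_; _≤_; z≤n; s≤s; _^_)
  open import Data.Nat.Properties
  open import Data.Nat.Tactic.RingSolver using (solve-∀)
  open import Data.Product using (_×_; _,_; ∃-syntax; proj₁; proj₂)
  open import Data.Rational as ℚ using (ℚ; 0ℚ; mkℚ; _/_)
  import Data.Rational.Properties as ℚₚ
  open import Data.Rational.Solver using (module +-*-Solver)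
  open import Data.Vec using ([]; _∷_)
  open import Data.Integer.Tactic.RingSolver using (ring)
  open import Tactic.RingSolver.NonReflective ring using (Ι; _⊕_; _⊗_)
  open import Relation.Binary.PropositionalEquality
  open import Relation.Nullary using (¬_)
  open ℝ

  -- Starts from 9² = 5 · 4² + 1 and multiplies `u + v √5` by the unit 9 + 4 √5.
  pell-solution : ∀ k → ∃[ u ] ∃[ v ] (u · u ≡ 5 · (v · v) + 1 × 4 ≤ v × k ≤ v)
  pell-solution zero = 9 , 4 , trans (·≡* 9 9) (sym (trans (cong (_+ 1) (trans (·≡* 5 (4 · 4)) (cong (5 *_) (·≡* 4 4)))) refl)) , ≤-refl , z≤n
  pell-solution (suc k) = let u , v , eq , 4≤v , k≤v = pell-solution k in
    9 * u + 20 * v , 4 * u + 9 * v , step u v eq , ≤-trans 4≤v (v≤ u v) , (begin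
      suc k                 ≤⟨ s≤s k≤v ⟩
      suc v                 ≤⟨ +-monoˡ-≤ v (≤-trans (s≤s z≤n) 4≤v) ⟩
      v + v                 ≤⟨ m≤m+n (v + v) (4 * u + 7 * v) ⟩
      v + v + (4 * u + 7 * v) ≡⟨ e₃ u v ⟩
      4 * u + 9 * v         ∎)
    where
    open ≤-Reasoning
    e₃ : ∀ u v → v + v + (4 * u + 7 * v) ≡ 4 * u + 9 * v
    e₃ = solve-∀
    v≤ : ∀ u v → v ≤ 4 * u + 9 * v
    v≤ u v = ≤-trans (m≤m+n v (8 * v)) (m≤n+m (9 * v) (4 * u))
    e₁ : ∀ u v → (9 * u + 20 * v) * (9 * u + 20 * v) ≡ 80 * (u * u) + 360 * (u * v) + 400 * (v * v) + u * u
    e₁ = solve-∀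
    e₂ : ∀ u v → 80 * (u * u) + 360 * (u * v) + 400 * (v * v) + (5 * (v * v) + 1) ≡ 5 * ((4 * u + 9 * v) * (4 * u + 9 * v)) + 1
    e₂ = solve-∀
    opaque
      unfolding _·_
      step : ∀ u v → u · u ≡ 5 · (v · v) + 1 →
        (9 * u + 20 * v) · (9 * u + 20 * v) ≡ 5 · ((4 * u + 9 * v) · (4 * u + 9 * v)) + 1
      step u v eq = trans (e₁ u v) (trans (cong (λ t → 80 * (u * u) + 360 * (u * v) + 400 * (v * v) + t) eq) (e₂ u v))

  -- Says that `E / C` is below α taken at `5 v / u`, plus 1/J. Passing from n³/6 to the true number
  -- `C` of triples costs a relative error of about 3/n, a density of roughly 1.4/n, which n = 8 (J
  -- + 1) keeps below 1/J. The bound `4 · W ≤ v` controls the slack 500 and the distance between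
  -- `u / v` and `5 v / u`.
  density-gap : ∀ u v E C J → let W = J + 1 ; n = 8 · W in u · u ≡ 5 · (v · v) + 1 → 4 ≤ v → 4 · W ≤ v →
    12 · (v · v) · (n · n · n) + 121 · (v · v) · (6 · E) ≤ (30 · u · v + 500) · (n · n · n) →
    n · n · n ≤ 6 · C + 3 · (n · n) →
    121 · (u · (J · E)) + 12 · (u · (J · C)) + 1 ≤ 30 · (5 · v · (J · C)) + 121 · (u · C)
  density-gap u v E C J pell 4≤v 4W≤v h₁ h₂ =
    toℕ (♯ 30 ⊗ (♯ 5 ⊗ vₑ ⊗ (Jₑ ⊗ Cₑ)) ⊕ ♯ 121 ⊗ (uₑ ⊗ Cₑ)) (♯ 121 ⊗ (uₑ ⊗ (Jₑ ⊗ Eₑ)) ⊕ ♯ 12 ⊗ (uₑ ⊗ (Jₑ ⊗ Cₑ)) ⊕ ♯ 1)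
      (cancel {♯ 6 ⊗ (vₑ ⊗ vₑ)} 1≤6v² (by
        (u⁺ *⁺ J⁺ *⁺ fromℕ ((♯ 30 ⊗ uₑ ⊗ vₑ ⊕ ♯ 500) ⊗ (n ⊗ n ⊗ n)) (♯ 12 ⊗ (vₑ ⊗ vₑ) ⊗ (n ⊗ n ⊗ n) ⊕ ♯ 121 ⊗ (vₑ ⊗ vₑ) ⊗ (♯ 6 ⊗ Eₑ)) h₁
         +⁺ sq {vₑ} *⁺ G⁺ *⁺ fromℕ (♯ 6 ⊗ Cₑ ⊕ ♯ 3 ⊗ (n ⊗ n)) (n ⊗ n ⊗ n) h₂
         +⁺ sq {n} *⁺ n⁺ *⁺ (♯⁺ {30} *⁺ (v⁺ *⁺ J⁺ *⁺ u²≤))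
         +⁺ sq {n} *⁺ (♯⁺ {450} *⁺ (sq {vₑ} *⁺ J⁺ *⁺ v≤u) +⁺ ♯⁺ {554} *⁺ (u⁺ *⁺ sq {vₑ} *⁺ J⁺)
                       +⁺ ♯⁺ {600} *⁺ (u⁺ *⁺ 4W≤v⁺ *⁺ (v⁺ +⁺ ♯⁺ {4} *⁺ W⁺))
                       +⁺ ♯⁺ {240} *⁺ (J⁺ *⁺ W⁺ *⁺ v≤u) +⁺ ♯⁺ {5360} *⁺ (u⁺ *⁺ J⁺ *⁺ W⁺) +⁺ ♯⁺ {9600} *⁺ (u⁺ *⁺ W⁺))
         +⁺ sq {vₑ} *⁺ (♯⁺ {6} *⁺ ((v≤u +⁺ 4≤v⁺ +⁺ ♯⁺ {3}) *⁺ sq {W} +⁺ J⁺ *⁺ (J⁺ +⁺ ♯⁺ {2})) +⁺ ♯⁺ {314} *⁺ (u⁺ *⁺ sq {W}))) refl))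
    where
    open NatPositivity (u ∷ v ∷ E ∷ C ∷ J ∷ [])
    uₑ vₑ Eₑ Cₑ Jₑ W n : Poly 5
    uₑ = Ι 0F
    vₑ = Ι 1F
    Eₑ = Ι 2F
    Cₑ = Ι 3F
    Jₑ = Ι 4F
    W = Jₑ ⊕ ♯ 1
    n = ♯ 8 ⊗ W
    u⁺ = var⁺ 0F
    v⁺ = var⁺ 1F
    J⁺ = var⁺ 4F
    n⁺ : 0≤ n
    n⁺ = ♯⁺ {8} *⁺ (var⁺ 4F +⁺ ♯⁺ {1})
    W⁺ : 0≤ W
    W⁺ = J⁺ +⁺ ♯⁺ {1}
    4≤v⁺ : 0≤ vₑ ⊖ ♯ 4
    4≤v⁺ = fromℕ vₑ (♯ 4) 4≤v
    4W≤v⁺ : 0≤ vₑ ⊖ ♯ 4 ⊗ W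
    4W≤v⁺ = fromℕ vₑ (♯ 4 ⊗ W) 4W≤v
    1≤6v² : 0≤ ♯ 6 ⊗ (vₑ ⊗ vₑ) ⊖ ♯ 1
    1≤6v² = by (♯⁺ {6} *⁺ (4≤v⁺ *⁺ (v⁺ +⁺ ♯⁺ {4})) +⁺ ♯⁺ {95}) refl
    u²≤ : 0≤ ♯ 5 ⊗ (vₑ ⊗ vₑ) ⊕ ♯ 1 ⊖ uₑ ⊗ uₑ
    u²≤ = fromℕ (♯ 5 ⊗ (vₑ ⊗ vₑ) ⊕ ♯ 1) (uₑ ⊗ uₑ) (≤-reflexive pell)
    v≤u : 0≤ uₑ ⊖ vₑ
    v≤u = cancel {uₑ ⊕ vₑ} (by (u⁺ +⁺ 4≤v⁺ +⁺ ♯⁺ {3}) refl)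
      (by (fromℕ (uₑ ⊗ uₑ) (♯ 5 ⊗ (vₑ ⊗ vₑ) ⊕ ♯ 1) (≤-reflexive (sym pell)) +⁺ ♯⁺ {4} *⁺ sq {vₑ} +⁺ ♯⁺ {1}) refl)
    G⁺ : 0≤ ♯ 150 ⊗ vₑ ⊗ Jₑ ⊕ ♯ 121 ⊗ uₑ ⊖ ♯ 12 ⊗ uₑ ⊗ Jₑ
    G⁺ = by (♯⁺ {3} *⁺ (J⁺ *⁺ fromℕ (♯ 9 ⊗ vₑ) (♯ 4 ⊗ uₑ) (pell-ratio u v pell 4≤v)) +⁺ ♯⁺ {123} *⁺ (v⁺ *⁺ J⁺) +⁺ ♯⁺ {121} *⁺ u⁺) refl

  open Hypergraph using (order)

  -- A set of o vertices has at most o³/6 triples, so 6 |E| / o³ bounds the density from below.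
  density-≥ : ∀ {m} (G : Hypergraph 3 m) (r≤ : 3 ≤ order G) A B .{{_ : ℕ.NonZero B}} →
    A * (order G * order G * order G) ≤ B * (6 * length (Hypergraph.E G)) →
    + A / B ℚ.≤ Hypergraph.density G r≤
  density-≥ G r≤ A B h = cross-≤ (ι C ℚ.* ι B) (+ A / B) (Hypergraph.density G r≤) {{ℚₚ.pos*pos⇒pos (ι C) {{ι-pos C}} (ι B) {{ι-pos B}}}}
    (trans (ℚₚ.*-assoc (ι C) (ι B) (+ A / B)) (trans (cong (ι C ℚ.*_) (ι-frac A B)) (sym (ι-* C A))))
    (trans (cong (ℚ._* D) (ℚₚ.*-comm (ι C) (ι B))) (trans (ℚₚ.*-assoc (ι B) (ι C) D) (trans (cong (ι B ℚ.*_) (ι-frac E C)) (sym (ι-* B E)))))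
    (*-cancelˡ-≤ 6 (begin
      6 * (C * A)         ≡⟨ cong (λ c → 6 * (c * A)) (length-⁽⁾ (Hypergraph.V G) 3) ⟩
      6 * (binomial o 3 * A) ≡⟨ trans (sym (*-assoc 6 (binomial o 3) A)) (*-comm _ A) ⟩
      A * (6 * binomial o 3) ≤⟨ *-monoʳ-≤ A (≤-trans (binomial-! o 3) (≤-reflexive (lemma o))) ⟩
      A * (o * o * o)     ≤⟨ h ⟩
      B * (6 * E)         ≡⟨ trans (sym (*-assoc B 6 E)) (trans (cong (_* E) (*-comm B 6)) (*-assoc 6 B E)) ⟩
      6 * (B * E)         ∎))
    where
    open ≤-Reasoning
    o C E : ℕ
    o = order G
    C = length (Hypergraph.V G ⁽ 3 ⁾)
    E = length (Hypergraph.E G)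
    instance
      C≢0 : ℕ.NonZero C
      C≢0 = ⁽⁾-nonZero (Hypergraph.V G) r≤
    D : ℚ
    D = Hypergraph.density G r≤
    lemma : ∀ o → o ^ 3 ≡ o * o * o
    lemma o = trans (cong (λ c → o * (o * c)) (*-identityʳ o)) (sym (*-assoc o o o))

  unit-fraction-≤ : ∀ q → 0ℚ ℚ.< q → ∃[ J ] ∃[ g ] (ι J ℚ.* g ≡ ι 1 × g ℚ.≤ q)
  unit-fraction-≤ q@(mkℚ (+ suc a) k _) _ = suc k , + 1 / suc k , ι-frac 1 (suc k) ,
    cross-≤ (ι (suc k)) (+ 1 / suc k) q {{ι-pos (suc k)}} (ι-frac 1 (suc k))
      (trans (cong (ι (suc k) ℚ.*_) (sym (ℚₚ.↥p/↧p≡p q))) (ι-frac (suc a) (suc k))) (s≤s z≤n)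
  unit-fraction-≤ (mkℚ (+ 0) k _)    (ℚ.*<* (ℤ.+<+ ()))
  unit-fraction-≤ (mkℚ -[1+ a ] k _) (ℚ.*<* ())

  opaque
    unfolding _·_

    surplus* : ∀ u v S E → 30 · u · (S · S · S) + 1 ≤ 121 · v · (6 · E) + 12 · v · (S · S · S) →
      30 * (u * (S * S * S)) ℕ.< 121 * (v * (6 * E)) + 12 * (v * (S * S * S))
    surplus* u v S E h = subst₂ _≤_ (trans (+-comm _ 1) (cong suc (*-assoc 30 u (S * S * S))))
      (cong₂ _+_ (*-assoc 121 v (6 * E)) (*-assoc 12 v (S * S * S))) h

    gap* : ∀ u v E C J → 121 · (u · (J · E)) + 12 · (u · (J · C)) + 1 ≤ 30 · (5 · v · (J · C)) + 121 · (u · C) →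
      121 * (u * (J * E)) + 12 * (u * (J * C)) ℕ.< 30 * (5 * v * (J * C)) + 121 * (u * C)
    gap* u v E C J h = ≤-trans (≤-reflexive (+-comm 1 (121 * (u * (J * E)) + 12 * (u * (J * C))))) h

    pell* : ∀ u v → u · u ≡ 5 · (v · v) + 1 → u * u ≡ 5 * (v * v) + 1
    pell* u v eq = eq

    cube* : ∀ J C → (let n = 8 * (J + 1) in n * n * n ≤ 6 * C + 3 * (n * n)) → let n = 8 · (J + 1) in n · n · n ≤ 6 · C + 3 · (n · n)
    cube* J C h = h

    four* : ∀ J v → 4 * (J + 1) ≤ v → 4 · (J + 1) ≤ v
    four* J v h = h

    eight : ∀ J → 8 * (J + 1) ≡ 8 · (J + 1)
    eight J = refl

  -- The order of the choices matters: δ fixes J and thereby n, n fixes the sparse system and T, T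
  -- bounds `u` and `v` from below, these fix the class weights and ε, and the scale `j` is chosen
  -- only after the threshold for ε and n is known.
  module Contradiction (δ : ℝ) {q₀} (Lδq₀ : L δ q₀)
    (jump : ∀ ε → 0ᴿ <ᴿ ε → ∀ n → 3 ≤ n → ∃[ N ] (∀ {m} (G : Hypergraph 3 m) → N ≤ order G →
      DensityAtLeast (α +ᴿ ε) G → ∃[ H ] (H IsSubgraphOf G × order H ≡ n × DensityAtLeast (α +ᴿ δ) H)))
    (J : ℕ) (g : ℚ) (Jg≡1 : ι J ℚ.* g ≡ ι 1) (g≤q₀ : g ℚ.≤ q₀) (system : SparseSystem (8 * (J + 1))) where

    n : ℕ
    n = 8 * (J + 1)

    3≤n : 3 ≤ n
    3≤n = ≤-trans (ℕ.s≤s (s≤s (s≤s z≤n))) (*-monoʳ-≤ 8 (m≤n+m 1 J))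

    open SparseSystem system using (T; 4≤T; es; sorted; unique)

    module _ (u v : ℕ) (pell : u · u ≡ 5 · (v · v) + 1) (4≤v : 4 ≤ v) (k≤v : T + 4 * (J + 1) ≤ v) where

      instance
        v≢0 : ℕ.NonZero v
        v≢0 = ℕ.>-nonZero (≤-trans (s≤s z≤n) 4≤v)
        u≢0 : ℕ.NonZero u
        u≢0 = ℕ.≢-nonZero λ u≡0 → 0≢1+n (trans (cong (λ u → u * u) (sym u≡0)) (trans (pell* u v pell) (+-comm _ 1)))

      open Lower system u v pell 4≤v (≤-trans (m≤m+n T _) k≤v)

      instance
        S₁≢0 : ℕ.NonZero S₁
        S₁≢0 = ℕ.>-nonZero (≤-trans (*-mono-≤ {1} {v} {1} {T} (≤-trans (s≤s z≤n) 4≤v) (≤-trans (s≤s z≤n) 4≤T))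
          (≤-trans (≤-trans (m≤m+n (v * T) _) (≤-trans (m≤m+n _ _) (m≤m+n _ (u * T)))) (≤-reflexive (sym S₁≡))))
        S₁³≢0 : ℕ.NonZero (S₁ * S₁ * S₁)
        S₁³≢0 = m*n≢0 (S₁ * S₁) S₁ {{m*n≢0 S₁ S₁}}

      d ρ : ℚ
      d = + u / v
      ρ = + (6 * E₁) / (S₁ * S₁ * S₁)

      level<ρ : level d ℚ.< ρ
      level<ρ = level<frac u v (6 * E₁) (S₁ * S₁ * S₁) (surplus* u v S₁ E₁ E₁-surplus)

      -- `a₂` separates α from the density `ρ` of the weighted pattern, so `α + e < ρ` for
      -- `e = ρ − a₂`, and this `e` serves as ε at every scale.
      middle = ℚₚ.<-dense level<ρ
      a₂ e : ℚ
      a₂ = proj₁ middle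
      e = ρ ℚ.- a₂

      Uα : U α a₂
      Uα = U-α⁺ {d} (frac-pos u v) (5≤frac² u v (≤-trans (m≤m+n _ 1) (≤-reflexive (sym (pell* u v pell))))) (proj₁ (proj₂ middle))

      0<e : 0ℚ ℚ.< e
      0<e = subst (ℚ._< e) (ℚₚ.+-inverseʳ a₂) (ℚₚ.+-monoˡ-< (ℚ.- a₂) (proj₂ (proj₂ middle)))

      0<fromℚ : 0ᴿ <ᴿ fromℚ e
      0<fromℚ = ℚₚ.<-dense 0<e

      threshold = jump (fromℚ e) 0<fromℚ n 3≤n
      -- The additional 3 guarantees order at least 3, where the density is defined.
      j : ℕ
      j = proj₁ threshold + 3

      open Scaled j

      G : Hypergraph 3 N
      G = ClassGraph.graph (ClassEdges.ℰ es sorted unique) cl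

      order≡ : order G ≡ S₁ * j
      order≡ = trans (∣⊤∣≡n N) N≡

      j≤order : j ≤ order G
      j≤order = ≤-trans (m≤n*m j S₁) (≤-reflexive (sym order≡))

      3≤order : 3 ≤ order G
      3≤order = ≤-trans (m≤n+m 3 (proj₁ threshold)) j≤order

      ρ≤density : ρ ℚ.≤ Hypergraph.density G 3≤order
      ρ≤density = density-≥ G 3≤order (6 * E₁) (S₁ * S₁ * S₁) (begin
        6 * E₁ * (o * o * o)                          ≡⟨ cong (λ o → 6 * E₁ * (o * o * o)) order≡ ⟩
        6 * E₁ * (S₁ * j * (S₁ * j) * (S₁ * j))       ≡⟨ lemma E₁ S₁ j ⟩
        S₁ * S₁ * S₁ * (6 * (E₁ * (j * j * j)))       ≤⟨ *-monoʳ-≤ (S₁ * S₁ * S₁) (*-monoʳ-≤ 6 E₁≤) ⟩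
        S₁ * S₁ * S₁ * (6 * length (Hypergraph.E G))  ∎)
        where
        open ≤-Reasoning
        o = order G
        lemma : ∀ E S j → 6 * E * (S * j * (S * j) * (S * j)) ≡ S * S * S * (6 * (E * (j * j * j)))
        lemma = solve-∀

      dense : DensityAtLeast (α +ᴿ fromℚ e) G
      dense = 3≤order , λ { q (a , b , Lαa , b<e , q<a+b) →
        ℚₚ.<-≤-trans (ℚₚ.<-trans q<a+b (ℚₚ.+-mono-< (L<U α Lαa Uα) b<e)) (ℚₚ.≤-trans (ℚₚ.≤-reflexive (cancel ρ a₂)) ρ≤density) }
        where
        open +-*-Solver
        cancel : ∀ ρ a → a ℚ.+ (ρ ℚ.- a) ≡ ρ
        cancel = solve 2 (λ ρ a → a :+ (ρ :- a) := ρ) refl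

      result = proj₂ threshold G (≤-trans (m≤m+n _ 3) j≤order) dense
      H : Hypergraph 3 N
      H = proj₁ result
      H⊆G : H IsSubgraphOf G
      H⊆G = proj₁ (proj₂ result)
      order-H : order H ≡ n
      order-H = proj₁ (proj₂ (proj₂ result))
      H-dense : DensityAtLeast (α +ᴿ δ) H
      H-dense = proj₂ (proj₂ (proj₂ result))

      x : ℚ
      x = Hypergraph.density H (proj₁ H-dense)

      E C : ℕ
      E = length (Hypergraph.E H)
      C = length (Hypergraph.V H ⁽ 3 ⁾)

      -- The approximation is now `5 v / u`, from below, because `level` of it has to be a lower
      -- bound for α; for the blow-up itself `u / v`, from above, was needed.
      x<level+ : x ℚ.< level (+ (5 * v) / u) ℚ.+ g
      x<level+ = frac<level+ (5 * v) u E C J g {{⁽⁾-nonZero (Hypergraph.V H) (proj₁ H-dense)}} Jg≡1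
        (gap* u v E C J (density-gap u v E C J pell 4≤v (four* J v (≤-trans (m≤n+m _ T) k≤v))
          (subst (λ n → 12 · (v · v) · (n · n · n) + 121 · (v · v) · (6 · E) ≤ (30 · u · v + 500) · (n · n · n)) (eight J)
            (upper system u v pell 4≤v cl H H⊆G order-H))
          (cube* J C (begin
            n * n * n                          ≤⟨ m≤m+n (n * n * n) (2 * n) ⟩
            n * n * n + 2 * n                  ≡⟨ binomial-3 n ⟨
            6 * binomial n 3 + 3 * (n * n)     ≡⟨ cong (λ c → 6 * c + 3 * (n * n)) (trans (length-⁽⁾ (Hypergraph.V H) 3) (cong (λ o → binomial o 3) order-H)) ⟨
            6 * C + 3 * (n * n)                ∎))))
        where open ≤-Reasoning

      absurd : ⊥
      -- The density `x` of `H` is tested against itself: `x < a + q₀` with `a` below α and `q₀`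
      -- below δ puts it into the lower cut of α + δ, and density at least α + δ then means `x < x`.
      absurd = ℚₚ.<-irrefl refl (proj₂ H-dense x (a , q₀ , Lαa , Lδq₀ , x<a+q₀))
        where
        open +-*-Solver
        x-q₀<level : x ℚ.- q₀ ℚ.< level (+ (5 * v) / u)
        x-q₀<level = subst (x ℚ.- q₀ ℚ.<_) (cancel (level (+ (5 * v) / u)) q₀)
          (ℚₚ.+-monoˡ-< (ℚ.- q₀) (ℚₚ.<-≤-trans x<level+ (ℚₚ.+-monoʳ-≤ (level (+ (5 * v) / u)) g≤q₀)))
          where
          cancel : ∀ l q → l ℚ.+ q ℚ.- q ≡ l
          cancel = solve 2 (λ l q → l :+ q :- q := l) refl
        between = ℚₚ.<-dense x-q₀<level
        a : ℚ
        a = proj₁ between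
        Lαa : L α a
        Lαa = L-α⁺ {+ (5 * v) / u} (frac²≤5 (5 * v) u (≤-trans (≤-reflexive (lemma v)) (*-monoʳ-≤ 5 (≤-trans (m≤m+n _ 1) (≤-reflexive (sym (pell* u v pell)))))))
          (proj₂ (proj₂ between))
          where
          lemma : ∀ v → 5 * v * (5 * v) ≡ 5 * (5 * (v * v))
          lemma = solve-∀
        x<a+q₀ : x ℚ.< a ℚ.+ q₀
        x<a+q₀ = subst (ℚ._< a ℚ.+ q₀) (cancel x q₀) (ℚₚ.+-monoˡ-< q₀ (proj₁ (proj₂ between)))
          where
          cancel : ∀ x q → x ℚ.- q ℚ.+ q ≡ x
          cancel = solve 2 (λ x q → x :- q :+ q := x) refl

  ¬jump : ¬ IsJump 3 α
  ¬jump (δ , (q₀ , 0<q₀ , Lδq₀) , jump) =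
    let J , g , Jg≡1 , g≤q₀ = unit-fraction-≤ q₀ 0<q₀
        system = sparse-system (8 * (J + 1))
        u , v , pell , 4≤v , k≤v = pell-solution (SparseSystem.T system + 4 * (J + 1))
    in Contradiction.absurd δ Lδq₀ jump J g Jg≡1 g≤q₀ system u v pell 4≤v k≤v


open import Defs
open import Data.Integer using (+_)
open import Data.Product using (_,_)
open import Data.Rational using (_/_)
open Levels using (0≤α; α<1)
open NonJump using (¬jump)

theorem1p3 : IsNonJump 3 ((+ 6 / 121) ·ᴿ ((+ 5 / 1) ·ᴿ √ (+ 5 / 1) -ᴿ fromℚ (+ 2 / 1)))
theorem1p3 = 0≤α , α<1 , ¬jump
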